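{- Let $\ell \geq 1$ and $k\geq 9\ell^2 - 3\ell +1$ be integers. Let $G$ be a minor-minimal $2$-connected graph containing a subdivision of $\Gamma_k$, and let $T^1$ be a full binary tree of height at most $3\ell-2$. Then either $G$ contains $\Gamma_{\ell}^{+}$ as a minor, or $G$ contains a clean binary pear tree $(T^1, \mathcal{B})$.
   Context: All graphs are finite and simple. $\Gamma_m$ is the complete binary tree of height $m$ (rooted; every non-leaf vertex has two children; every root-to-leaf path has $m$ edges); $\Gamma_\ell^+$ is obtained from $\Gamma_\ell$ by adding a new vertex adjacent to all its leaves. "$G$ is a minor-minimal $2$-connected graph containing a subdivision of $\Gamma_k$" means $G$ is $2$-connected, contains a subdivision of $\Gamma_k$ as a subgraph, and no proper minor of $G$ is $2$-connected and contains a subdivision of $\Gamma_k$. A binary tree is a rooted tree in which every vertex has at most two children; it is full if every non-leaf vertex has exactly two children; $T_x$ is the subtree rooted at $x$. The length of a path is its number of edges; for a subgraph $H$, an $H$-ear is a path with both ends in $V(H)$ and no internal vertex in $V(H)$. A binary pear tree in $G$ is a pair $(T,\mathcal{B})$ with $T$ a binary tree and $\mathcal{B}=\{(P_x,Q_x):x\in V(T)\}$ pairs of paths in $G$ of length at least $2$ with $P_x\subseteq Q_x$, such that for every non-root $x$ with parent $y$: (1) $Q_x$ is a $P_y$-ear; (2) if $x$ has no sibling, no internal vertex of $Q_x$ lies in $\bigcup_{z\in V(T)\setminus V(T_x)}V(Q_z)$; (3) if $x$ has a sibling $x'$, then no internal vertex of $Q_x$ lies in $\bigcup_{z\in V(T)\setminus(V(T_x)\cup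 V(T_{x'}))}V(Q_z)$, and no internal vertex of $P_x$ lies in $Q_{x'}$. It is clean if for every non-leaf $y$ of $T$ some end of $P_y$ is not contained in any $Q_x$ with $x$ a child of $y$. -}

module Defs where

open import Data.Nat using (ℕ; zero; suc; _+_; _*_; _∸_; _^_; _≤_; _≡ᵇ_; _≤ᵇ_; _⊔_)
open import Data.Fin using (Fin; toℕ)
open import Data.Bool using (Bool; true; false; _∨_; _∧_; not; T)
open import Data.Bool.Properties using (∨-comm)
open import Data.Maybe using (Maybe; just; nothing)
open import Data.List using (List; []; _∷_; _++_; length)
open import Data.List.Membership.Propositional using (_∈_; _∉_)
open import Data.List.Relation.Unary.All using (All)
open import Data.List.Relation.Unary.Linked using (Linked)
open import Data.List.Relation.Unary.Unique.Propositional using (Unique)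
open import Data.Product using (Σ; ∃; ∃₂; _×_; _,_)
open import Data.Sum using (_⊎_)
open import Data.Empty using (⊥)
open import Relation.Nullary using (¬_)
open import Relation.Binary.PropositionalEquality using (_≡_; _≢_; refl; cong₂)
open import Function.Bundles using (_↔_; Inverse)

record Graph : Set where
  field
    size    : ℕ
    adj     : Fin size → Fin size → Bool
    adj-sym : ∀ u v → adj u v ≡ adj v u
    adj-irr : ∀ v → adj v v ≡ false

open Graph public

V : Graph → Set
V G = Fin (size G)

E : (G : Graph) → V G → V G → Set
E G u v = T (adj G u v)

≡ᵇ-sym : ∀ m n → (m ≡ᵇ n) ≡ (n ≡ᵇ m)
≡ᵇ-sym zero zero = refl
≡ᵇ-sym zero (suc n) = refl
≡ᵇ-sym (suc m) zero = refl
≡ᵇ-sym (suc m) (suc n) = ≡ᵇ-sym m n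

≡ᵇ-refl : ∀ n → (n ≡ᵇ n) ≡ true
≡ᵇ-refl zero = refl
≡ᵇ-refl (suc n) = ≡ᵇ-refl n

∧-false : ∀ b → (b ∧ false) ≡ false
∧-false true = refl
∧-false false = refl

fromRel : (n : ℕ) → (ℕ → ℕ → Bool) → Graph
fromRel n r = record
  { size = n
  ; adj = λ u v → (r (toℕ u) (toℕ v) ∨ r (toℕ v) (toℕ u)) ∧ not (toℕ u ≡ᵇ toℕ v)
  ; adj-sym = λ u v → cong₂ (λ a b → a ∧ not b)
                        (∨-comm (r (toℕ u) (toℕ v)) (r (toℕ v) (toℕ u)))
                        (≡ᵇ-sym (toℕ u) (toℕ v))
  ; adj-irr = λ v → helper (r (toℕ v) (toℕ v) ∨ r (toℕ v) (toℕ v)) (toℕ v)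
  }
  where
  helper : ∀ b m → (b ∧ not (m ≡ᵇ m)) ≡ false
  helper b m with m ≡ᵇ m | ≡ᵇ-refl m
  ... | .true | refl = ∧-false b

-- Complete binary tree Γ m of height m: vertices 0 … 2^(m+1)-2
-- (heap numbering: the children of i are 2i+1 and 2i+2; root 0).

treeRel : ℕ → ℕ → Bool
treeRel i j = (j ≡ᵇ (2 * i + 1)) ∨ (j ≡ᵇ (2 * i + 2))

Γ : ℕ → Graph
Γ m = fromRel (2 ^ (suc m) ∸ 1) treeRel

-- Γ⁺ m : Γ m plus a new vertex N = 2^(m+1)-1 adjacent to all leaves
-- of Γ m (the leaves are the vertices 2^m-1 … 2^(m+1)-2).
Γ⁺ : ℕ → Graph
Γ⁺ m = fromRel (2 ^ (suc m)) rel
  where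
  N : ℕ
  N = 2 ^ (suc m) ∸ 1
  rel : ℕ → ℕ → Bool
  rel i j = treeRel i j ∨ ((i ≡ᵇ N) ∧ ((2 ^ m ∸ 1) ≤ᵇ j))

Reach : (G : Graph) → (V G → Set) → V G → V G → Set
Reach G S a b = a ≡ b ⊎ Σ (List (V G)) (λ mid → Linked (E G) (a ∷ mid ++ b ∷ []) × All S mid)

ConnectedSet : (G : Graph) → (V G → Set) → Set
ConnectedSet G S = ∀ a b → S a → S b → Reach G S a b

Connected : Graph → Set
Connected G = ConnectedSet G (λ _ → ⊤')
  where
  open import Data.Unit using () renaming (⊤ to ⊤')

TwoConnected : Graph → Set
TwoConnected G = 3 ≤ size G × Connected G × (∀ x → ConnectedSet G (λ v → v ≢ x))

record Path (G : Graph) : Set where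
  field
    start : V G
    inner : List (V G)
    end   : V G
    linked : Linked (E G) (start ∷ inner ++ end ∷ [])
    unique : Unique (start ∷ inner ++ end ∷ [])

open Path public

verts : {G : Graph} → Path G → List (V G)
verts p = start p ∷ inner p ++ end p ∷ []

pathLength : {G : Graph} → Path G → ℕ
pathLength p = suc (length (inner p))

PEdge : {G : Graph} → Path G → V G → V G → Set
PEdge {G} p u v = ∃₂ λ (xs ys : List (V G)) → verts p ≡ xs ++ u ∷ v ∷ ys

SubPath : {G : Graph} → Path G → Path G → Set
SubPath {G} p q = (∀ v → v ∈ verts p → v ∈ verts q)
                × (∀ u v → PEdge p u v → PEdge q u v ⊎ PEdge q v u)

IsEar : {G : Graph} → Path G → Path G → Set
IsEar q p = start q ∈ verts p × end q ∈ verts p × (∀ v → v ∈ inner q → v ∉ verts p)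

-- H is a minor of G: branch sets given by f (nothing = deleted),
-- each nonempty and connected, adjacent branch sets joined by an edge.
record Minor (H G : Graph) : Set where
  field
    f        : V G → Maybe (V H)
    nonempty : ∀ h → ∃ λ g → f g ≡ just h
    conn     : ∀ h → ConnectedSet G (λ g → f g ≡ just h)
    edges    : ∀ h h' → E H h h' → ∃₂ λ g g' → f g ≡ just h × f g' ≡ just h' × E G g g'

Iso : Graph → Graph → Set
Iso H G = Σ (V H ↔ V G) λ φ → ∀ u v → adj H u v ≡ adj G (Inverse.to φ u) (Inverse.to φ v)

ProperMinor : Graph → Graph → Set
ProperMinor H G = Minor H G × ¬ Iso H G

record ContainsSubdivision (G H : Graph) : Set where
  field
    φ       : V H → V G
    φ-inj   : ∀ u v → φ u ≡ φ v → u ≡ v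
    route   : (u v : V H) → E H u v → Path G
    r-start : ∀ u v e → start (route u v e) ≡ φ u
    r-end   : ∀ u v e → end (route u v e) ≡ φ v
    r-avoid : ∀ u v e w x → x ∈ inner (route u v e) → x ≢ φ w
    r-disj  : ∀ u v e u' v' e' x → x ∈ inner (route u v e) → x ∈ inner (route u' v' e')
                → (u ≡ u' × v ≡ v') ⊎ (u ≡ v' × v ≡ u')

MinorMinimal2ConnSubdiv : Graph → Graph → Set
MinorMinimal2ConnSubdiv G H =
  TwoConnected G × ContainsSubdivision G H
  × (∀ G' → ProperMinor G' G → TwoConnected G' → ¬ ContainsSubdivision G' H)

data BTree : Set where
  leaf  : BTree
  node1 : BTree → BTree
  node2 : BTree → BTree → BTree

data Full : BTree → Set where
  leaf  : Full leaf
  node2 : ∀ {l r} → Full l → Full r → Full (node2 l r)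

height : BTree → ℕ
height leaf = 0
height (node1 t) = suc (height t)
height (node2 l r) = suc (height l ⊔ height r)

data Pos : BTree → Set where
  here : ∀ {t} → Pos t
  in1  : ∀ {t} → Pos t → Pos (node1 t)
  inL  : ∀ {l r} → Pos l → Pos (node2 l r)
  inR  : ∀ {l r} → Pos r → Pos (node2 l r)

data ChildOf : {t : BTree} → Pos t → Pos t → Set where
  c1 : ∀ {t} → ChildOf {node1 t} (in1 here) here
  cL : ∀ {l r} → ChildOf {node2 l r} (inL here) here
  cR : ∀ {l r} → ChildOf {node2 l r} (inR here) here
  s1 : ∀ {t} {c p : Pos t} → ChildOf c p → ChildOf (in1 c) (in1 p)
  sL : ∀ {l r} {c p : Pos l} → ChildOf c p → ChildOf {node2 l r} (inL c) (inL p)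
  sR : ∀ {l r} {c p : Pos r} → ChildOf c p → ChildOf {node2 l r} (inR c) (inR p)

data InSub : {t : BTree} → Pos t → Pos t → Set where
  top : ∀ {t} {z : Pos t} → InSub here z
  d1  : ∀ {t} {x z : Pos t} → InSub x z → InSub (in1 x) (in1 z)
  dL  : ∀ {l r} {x z : Pos l} → InSub x z → InSub {node2 l r} (inL x) (inL z)
  dR  : ∀ {l r} {x z : Pos r} → InSub x z → InSub {node2 l r} (inR x) (inR z)

Sibling : {t : BTree} → Pos t → Pos t → Set
Sibling {t} x x' = Σ (Pos t) λ y → ChildOf x y × ChildOf x' y × x ≢ x'

record PearData (G : Graph) (T : BTree) : Set where
  field
    P Q : Pos T → Path G

open PearData public

IsPearTree : (G : Graph) (T : BTree) → PearData G T → Set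
IsPearTree G T B =
    (∀ x → 2 ≤ pathLength (P B x) × 2 ≤ pathLength (Q B x) × SubPath (P B x) (Q B x))
  × (∀ x y → ChildOf x y →
        IsEar (Q B x) (P B y)
      × ((∀ x' → ¬ Sibling x x') →
           ∀ z → ¬ InSub x z → ∀ v → v ∈ inner (Q B x) → v ∉ verts (Q B z))
      × (∀ x' → Sibling x x' →
           (∀ z → ¬ InSub x z → ¬ InSub x' z → ∀ v → v ∈ inner (Q B x) → v ∉ verts (Q B z))
         × (∀ v → v ∈ inner (P B x) → v ∉ verts (Q B x'))))

Clean : (G : Graph) (T : BTree) → PearData G T → Set
Clean G T B =
  ∀ y → (∃ λ x → ChildOf x y) →
    Σ (V G) λ e → (e ≡ start (P B y) ⊎ e ≡ end (P B y))
                  × (∀ x → ChildOf x y → e ∉ verts (Q B x))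

-- A vertex off the subdivided tree has a neighbour into which it can be contracted keeping G
-- 2-connected, so by minimality the subdivision of Γ k is a rooted spanning tree of G. Fix a vertex a
-- and a vertex c below it. If each of the 2 ^ ℓ subtrees lying ℓ branchings below c sends an edge out
-- of the subtree of a, contracting the outside of that subtree, which is connected, gives Γ⁺ ℓ.
-- Otherwise all edges from one of these subtrees stay below a.
--
-- The pear tree is grown downwards. A path P comes with a vertex v above its lower part and a reserve
-- U hanging off a vertex q of P, such that edges out of U stay below v and everything else below v,
-- except q, is joined to P. In U choose v₁ and v₂ in two disjoint subtrees which their edges do not
-- leave. By 2-connectedness there are two disjoint walks from the subtree of v₁, one to q and one to
-- the rest of P, both avoiding the subtree of v₂. Closing them up below v₁ gives an ear of P, and the
-- closing path can be routed past a new reserve. Exchanging v₁ and v₂ gives the sibling ear.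

module Submission where

open import Defs
open import Data.Bool using (T; Bool; true; false; _∧_; _∨_; not; if_then_else_)
open import Data.Bool.Properties using (T?; T-∧; T-∨; T-irrelevant)
open import Data.Empty using (⊥; ⊥-elim)
open import Data.Fin using (Fin; toℕ; fromℕ<; punchIn; punchOut)
open import Data.Fin.Permutation using (↔⇒≡)
open import Data.Fin.Properties using (_≟_; any?)
import Data.Fin.Properties as Fin
open import Data.List using (List; []; _∷_; _++_; filter; allFin; map)
open import Data.List.Membership.Propositional using (_∈_; _∉_)
open import Data.List.Membership.Propositional.Properties
  using (∈-++⁺ˡ; ∈-++⁺ʳ; ∈-++⁻; ∈-filter⁺; ∈-filter⁻; ∈-allFin; ∈-map⁻)
open import Data.List.Properties using (++-assoc; ++-identityʳ; ∷-injective; map-++)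
open import Data.List.Relation.Unary.All as All using (All; []; _∷_)
import Data.List.Relation.Unary.All.Properties as Allₚ
open import Data.List.Relation.Unary.All.Properties using (¬Any⇒All¬; All¬⇒¬Any)
open import Data.List.Relation.Unary.AllPairs using ([]; _∷_)
open import Data.List.Relation.Unary.Any using (here; there)
open import Data.List.Relation.Unary.Linked using (Linked; []; [-]; _∷_)
open import Data.List.Relation.Unary.Unique.Propositional using (Unique)
import Data.List.Relation.Unary.Unique.Propositional.Properties as Uniqueₚ
open import Data.Maybe using (Maybe; just; nothing)
open import Data.Maybe.Properties using (just-injective)
open import Data.Nat using (ℕ; zero; suc; _+_; _*_; _∸_; _^_; _≤_; _<_; z≤n; s≤s)
import Data.Nat as ℕ
open import Data.Nat.Induction using (<-wellFounded)
import Data.Nat.Properties as ℕ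
open import Data.Nat.Solver using (module +-*-Solver)
open import Data.Product using (Σ; ∃; ∃₂; _×_; _,_; proj₁; proj₂)
open import Data.Sum using (_⊎_; inj₁; inj₂; [_,_]′)
open import Data.Unit using (⊤; tt)
open import Function using (_∘_; id; case_of_)
open import Function.Bundles using (Equivalence)
open import Induction.WellFounded using (Acc; acc)
open import Level using (0ℓ)
open import Relation.Binary.PropositionalEquality
  using (_≡_; _≢_; refl; sym; trans; cong; subst; subst₂; ≢-sym; subst-subst-sym; subst-sym-subst)
open import Relation.Nullary using (¬_; Dec; yes; no; contradiction)
open import Relation.Nullary.Decidable
  using (¬?; _×-dec_; _⊎-dec_; does; isYes; fromWitness; toWitness; toSum)
open import Relation.Unary using (Pred; Decidable)

-- Walks

-- Spanning is what makes the tree usable: every vertex can climb to each of its ancestors, so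
-- subtrees and their complements are connected.
--
-- The obstacle is the closing path. Its ends are dictated by the two disjoint walks, yet everything
-- left beside the next reserve must be able to return to it. For this, one walk is kept starting at
-- `v₁`, so that only one end `f` is unknown, and the reserve is put under a child of `v₁` that is
-- not above `f`. If the path to `f` would strand vertices around the reserve, it descends instead
-- past the reserve to a vertex with an edge out of the subtree of `v₁`, and that edge takes over
-- the beginning of one of the walks.
--
-- The walks can spare the subtree of `v₂` because its neighbours lie below one child of the
-- branching that separates `v₁` from `v₂`, where detours around it are available.
--
-- A generation uses `2ℓ + 2` branchings and the first path `ℓ + 2`. For height `3ℓ - 2` this makes
-- `6ℓ² + 3ℓ - 2`, which is `9ℓ² - 3ℓ + 1` minus `3(ℓ - 1)²`.

unique-∉ : ∀ {A : Set} {x : A} {xs} → Unique (x ∷ xs) → x ∉ xs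
unique-∉ (x≢ ∷ _) = All¬⇒¬Any x≢

unique-∷ : ∀ {A : Set} {x : A} {xs} → x ∉ xs → Unique xs → Unique (x ∷ xs)
unique-∷ x∉ u = ¬Any⇒All¬ _ x∉ ∷ u

unique-++-disjoint : ∀ {A : Set} (xs : List A) {ys v} →
  Unique (xs ++ ys) → v ∈ xs → v ∉ ys
unique-++-disjoint (x ∷ xs) u (here refl) v∈ys = unique-∉ u (∈-++⁺ʳ xs v∈ys)
unique-++-disjoint (x ∷ xs) (_ ∷ u) (there v∈) v∈ys = unique-++-disjoint xs u v∈ v∈ys

module Walks (G : Graph) where

  open import Data.List.Membership.DecPropositional (_≟_ {size G}) public using (_∈?_)

  E-sym : ∀ {u v} → E G u v → E G v u
  E-sym {u} {v} = subst T (adj-sym G u v)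

  E? : ∀ u v → Dec (E G u v)
  E? u v = T? (adj G u v)

  E-irrefl : ∀ {v} → ¬ E G v v
  E-irrefl {v} e = subst T (adj-irr G v) e

  data Walk : V G → List (V G) → V G → Set where
    stop : ∀ {a} → Walk a (a ∷ []) a
    _►_  : ∀ {a b c vs} → E G a b → Walk b vs c → Walk a (a ∷ vs) c

  infixr 5 _►_

  start∈ : ∀ {a vs b} → Walk a vs b → a ∈ vs
  start∈ stop    = here refl
  start∈ (_ ► _) = here refl

  end∈ : ∀ {a vs b} → Walk a vs b → b ∈ vs
  end∈ stop    = here refl
  end∈ (_ ► w) = there (end∈ w)

  join : ∀ {a us b c vs d} → Walk a us b → E G b c → Walk c vs d → Walk a (us ++ vs) d
  join stop    e w′ = e ► w′
  join (f ► w) e w′ = f ► join w e w′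

  prefix : ∀ {a vs b m} → Walk a vs b → m ∈ vs →
    ∃ λ us → Walk a us m × (∀ {z} → z ∈ us → z ∈ vs)
  prefix stop (here refl) = _ , stop , id
  prefix (e ► w) (here refl) = _ , stop , λ { (here eq) → here eq }
  prefix (e ► w) (there m∈) with us , w′ , us⊆ ← prefix w m∈ =
    _ , e ► w′ , λ { (here eq) → here eq ; (there z∈) → there (us⊆ z∈) }

  suffix : ∀ {a vs b m} → Walk a vs b → m ∈ vs →
    ∃ λ us → Walk m us b × (∀ {z} → z ∈ us → z ∈ vs) × (Unique vs → Unique us)
  suffix stop (here refl) = _ , stop , id , id
  suffix (e ► w) (here refl) = _ , e ► w , id , id
  suffix (e ► w) (there m∈) with us , w′ , us⊆ , u ← suffix w m∈ =
    _ , w′ , there ∘ us⊆ , λ { (_ ∷ uq) → u uq }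

  WalkIn : Pred (V G) 0ℓ → V G → V G → Set
  WalkIn S a b = ∃ λ vs → Walk a vs b × All S vs

  walkIn-start : ∀ {S a b} → WalkIn S a b → S a
  walkIn-start (_ , w , s) = All.lookup s (start∈ w)

  walkIn-end : ∀ {S a b} → WalkIn S a b → S b
  walkIn-end (_ , w , s) = All.lookup s (end∈ w)

  here-walk : ∀ {S : Pred (V G) 0ℓ} {a} → S a → WalkIn S a a
  here-walk s = _ , stop , s ∷ []

  step-walk : ∀ {S : Pred (V G) 0ℓ} {a b c} → S a → E G a b → WalkIn S b c → WalkIn S a c
  step-walk s e (_ , w , ss) = _ , e ► w , s ∷ ss

  weaken : ∀ {S R : Pred (V G) 0ℓ} {a b} → (∀ {z} → S z → R z) → WalkIn S a b → WalkIn R a b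
  weaken f (_ , w , s) = _ , w , All.map f s

  join-in : ∀ {S a b c d} → WalkIn S a b → E G b c → WalkIn S c d → WalkIn S a d
  join-in (_ , w , s) e (_ , w′ , s′) = _ , join w e w′ , Allₚ.++⁺ s s′

  infixr 5 _⊙_
  _⊙_ : ∀ {S a b c} → WalkIn S a b → WalkIn S b c → WalkIn S a c
  (_ , stop , _) ⊙ r = r
  (_ , e ► w , s ∷ ss) ⊙ r = step-walk s e ((_ , w , ss) ⊙ r)

  reverse-in : ∀ {S a b} → WalkIn S a b → WalkIn S b a
  reverse-in (_ , stop , s) = _ , stop , s
  reverse-in (_ , e ► w , s ∷ ss) =
    join-in (reverse-in (_ , w , ss)) (E-sym e) (here-walk s)

  simple : ∀ {a vs b} → Walk a vs b →
    ∃ λ us → Walk a us b × Unique us × (∀ {z} → z ∈ us → z ∈ vs)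
  simple stop = _ , stop , [] ∷ [] , id
  simple {a} (e ► w) with us , w′ , u , us⊆ ← simple w with a ∈? us
  ... | no a∉ = _ , e ► w′ , unique-∷ a∉ u ,
    λ { (here eq) → here eq ; (there z∈) → there (us⊆ z∈) }
  ... | yes a∈ with ts , w″ , ts⊆ , u′ ← suffix w′ a∈ = ts , w″ , u′ u , there ∘ us⊆ ∘ ts⊆

  simple-in : ∀ {S a b} → WalkIn S a b → ∃ λ us → Walk a us b × Unique us × All S us
  simple-in (_ , w , s) with us , w′ , u , us⊆ ← simple w =
    us , w′ , u , All.tabulate (All.lookup s ∘ us⊆)

  reversed : ∀ {a vs b} → Walk a vs b → Unique vs →
    ∃ λ us → Walk b us a × Unique us × (∀ {z} → z ∈ us → z ∈ vs) × (∀ {z} → z ∈ vs → z ∈ us)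
  reversed stop u = _ , stop , u , id , id
  reversed {a} (e ► w) u@(_ ∷ u′) with us , r , uu , us⊆ , ⊆us ← reversed w u′ =
    _ , join r (E-sym e) stop
    , Uniqueₚ.++⁺ uu ([] ∷ []) (λ { (z∈ , here refl) → unique-∉ u (us⊆ z∈) })
    , (λ z∈ → case ∈-++⁻ us z∈ of λ
        { (inj₁ z∈us) → there (us⊆ z∈us) ; (inj₂ (here eq)) → here eq })
    , λ { (here eq) → ∈-++⁺ʳ us (here eq) ; (there z∈) → ∈-++⁺ˡ (⊆us z∈) }

  -- The recursion settles the rest of the walk before it tests the current vertex, so the first
  -- vertex of `X` it finds is the last one visited.
  last-visit : ∀ {X S : Pred (V G) 0ℓ} → Decidable X → ∀ {a b} → WalkIn S a b → ¬ X b →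
    ¬ X a × WalkIn (λ z → S z × ¬ X z) a b
    ⊎ ∃₂ λ x y → S x × X x × E G x y × WalkIn (λ z → S z × ¬ X z) y b
  last-visit X? (_ , stop , s ∷ _) ¬Xa = inj₁ (¬Xa , here-walk (s , ¬Xa))
  last-visit X? (_ , _►_ {a} {b} e w , s ∷ ss) ¬Xc with last-visit X? (_ , w , ss) ¬Xc
  ... | inj₂ r = inj₂ r
  ... | inj₁ (¬Xb , r) with X? a
  ...   | yes Xa = inj₂ (a , b , s , Xa , e , r)
  ...   | no ¬Xa = inj₁ (¬Xa , step-walk (s , ¬Xa) e r)

  first-visit : ∀ {X S : Pred (V G) 0ℓ} → Decidable X → ∀ {a b} → WalkIn S a b → X b →
    X a ⊎ ∃₂ λ m x → WalkIn (λ z → S z × ¬ X z) a m × E G m x × X x × S x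
  first-visit X? (_ , stop , _) Xb = inj₁ Xb
  first-visit X? (_ , _►_ {a} {b} e w , s ∷ ss) Xc with first-visit X? (_ , w , ss) Xc | X? a
  ... | _ | yes Xa = inj₁ Xa
  ... | inj₁ Xb | no ¬Xa = inj₂ (a , b , here-walk (s , ¬Xa) , e , Xb , All.lookup ss (start∈ w))
  ... | inj₂ (m , x , w′ , r) | no ¬Xa = inj₂ (m , x , step-walk (s , ¬Xa) e w′ , r)

  walk⇒linked : ∀ {a vs b} → Walk a vs b → Linked (E G) vs
  walk⇒linked stop = [-]
  walk⇒linked (e ► stop) = e ∷ [-]
  walk⇒linked (e ► w@(_ ► _)) = e ∷ walk⇒linked w

  linked⇒walk : ∀ {a} mid {b} → Linked (E G) (a ∷ mid ++ b ∷ []) →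
    Walk a (a ∷ mid ++ b ∷ []) b
  linked⇒walk []        (e ∷ _) = e ► stop
  linked⇒walk (x ∷ mid) (e ∷ l) = e ► linked⇒walk mid l

  reach⇒walk : ∀ {S : Pred (V G) 0ℓ} {a b} → S a → S b → Reach G S a b → WalkIn S a b
  reach⇒walk sa sb (inj₁ refl) = here-walk sa
  reach⇒walk sa sb (inj₂ (mid , l , s)) =
    _ , linked⇒walk mid l , sa ∷ Allₚ.++⁺ s (sb ∷ [])

  walk-ends : ∀ {a vs b} → Walk a vs b →
    (a ≡ b × vs ≡ a ∷ []) ⊎ ∃ λ mid → vs ≡ a ∷ mid ++ b ∷ []
  walk-ends stop = inj₁ (refl , refl)
  walk-ends (e ► w) with walk-ends w
  ... | inj₁ (refl , refl) = inj₂ ([] , refl)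
  ... | inj₂ (mid , refl) = inj₂ (_ ∷ mid , refl)

  walk⇒reach : ∀ {S : Pred (V G) 0ℓ} {a b} → WalkIn S a b → Reach G S a b
  walk⇒reach (_ , w , s) with walk-ends w
  ... | inj₁ (a≡b , _) = inj₁ a≡b
  walk⇒reach (_ , w , _ ∷ s) | inj₂ (mid , refl) =
    inj₂ (mid , walk⇒linked w , Allₚ.++⁻ˡ mid s)

  walk⇒path : ∀ {a vs b} → Walk a vs b → Unique vs → a ≢ b →
    Σ (Path G) λ p → verts p ≡ vs × start p ≡ a × end p ≡ b
  walk⇒path w u a≢b with walk-ends w
  ... | inj₁ (a≡b , _) = contradiction a≡b a≢b
  ... | inj₂ (mid , refl) =
    record { start = _ ; inner = mid ; end = _ ; linked = walk⇒linked w ; unique = u }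
    , refl , refl , refl

  inner-props : (p : Path G) → ∀ {v} → v ∈ inner p → v ∈ verts p × v ≢ start p × v ≢ end p
  inner-props p v∈ = there (∈-++⁺ˡ v∈)
    , (λ { refl → unique-∉ (unique p) (∈-++⁺ˡ v∈) })
    , λ { refl → case unique p of λ { (_ ∷ u) →
          unique-++-disjoint (inner p) u v∈ (here refl) } }

  inner-intro : (p : Path G) → ∀ {v} → v ∈ verts p → v ≢ start p → v ≢ end p → v ∈ inner p
  inner-intro p (here v≡) v≢s _ = contradiction v≡ v≢s
  inner-intro p (there v∈) _ v≢e with ∈-++⁻ (inner p) v∈
  ... | inj₁ v∈i = v∈i
  ... | inj₂ (here v≡) = contradiction v≡ v≢e

  backwards : (p : Path G) → Σ (Path G) λ p′ → start p′ ≡ end p × end p′ ≡ start p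
    × (∀ {v} → v ∈ inner p′ → v ∈ inner p)
  backwards p with us , w , u , us⊆ , _ ← reversed (linked⇒walk (inner p) (linked p)) (unique p)
    with p′ , eq , refl , refl ← walk⇒path w u
           (λ { refl → unique-∉ (unique p) (∈-++⁺ʳ (inner p) (here refl)) })
    = p′ , refl , refl , λ v∈ → let v∈p′ , v≢s , v≢e = inner-props p′ v∈ in
        inner-intro p (us⊆ (subst (_ ∈_) eq v∈p′)) v≢e v≢s

  long-path : (p : Path G) → ∀ {v} → v ∈ verts p → v ≢ start p → v ≢ end p → 2 ≤ pathLength p
  long-path p (here v≡) v≢s v≢e = contradiction v≡ v≢s
  long-path p (there v∈) v≢s v≢e with inner p
  ... | _ ∷ _ = s≤s (s≤s z≤n)
  ... | []    = case v∈ of λ { (here v≡) → contradiction v≡ v≢e }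

  subPath : (p q : Path G) → ∀ ls rs → verts q ≡ ls ++ verts p ++ rs → SubPath p q
  subPath p q ls rs eq =
    (λ v v∈ → subst (v ∈_) (sym eq) (∈-++⁺ʳ ls (∈-++⁺ˡ v∈)))
    , λ { u v (xs , ys , eq′) → inj₁ (ls ++ xs , ys ++ rs , trans eq (shape xs ys u v eq′)) }
    where
    shape : ∀ xs ys u v → verts p ≡ xs ++ u ∷ v ∷ ys →
      ls ++ verts p ++ rs ≡ (ls ++ xs) ++ u ∷ v ∷ ys ++ rs
    shape xs ys u v eq′ = trans (cong (λ vs → ls ++ vs ++ rs) eq′)
      (trans (cong (ls ++_) (++-assoc xs (u ∷ v ∷ ys) rs)) (sym (++-assoc ls xs _)))

-- Rooted spanning trees

data Ancestor {A : Set} (Ch : A → A → Set) (a : A) : A → Set where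
  self : Ancestor Ch a a
  down : ∀ {y z} → Ancestor Ch a y → Ch z y → Ancestor Ch a z

ancestor-trans : ∀ {A : Set} {Ch : A → A → Set} {a b c} →
  Ancestor Ch a b → Ancestor Ch b c → Ancestor Ch a c
ancestor-trans p self       = p
ancestor-trans p (down q c) = down (ancestor-trans p q) c

ancestor-laminar : ∀ {A : Set} {Ch : A → A → Set} →
  (∀ {c p p′} → Ch c p → Ch c p′ → p ≡ p′) → ∀ {a b x} →
  Ancestor Ch a x → Ancestor Ch b x → Ancestor Ch a b ⊎ Ancestor Ch b a
ancestor-laminar parent self q = inj₂ q
ancestor-laminar parent (down p c) self = inj₁ (down p c)
ancestor-laminar parent (down p c) (down q d) with refl ← parent c d =
  ancestor-laminar parent p q

-- Ch c p says that c is a child of p.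
record SpanningBinaryTree (G : Graph) : Set₁ where
  field
    Ch       : V G → V G → Set
    Ch-edge  : ∀ {c p} → Ch c p → E G p c
    Ch-parent : ∀ {c p p′} → Ch c p → Ch c p′ → p ≡ p′
    Ch-two   : ∀ {a b c p} → Ch a p → Ch b p → Ch c p → a ≡ b ⊎ a ≡ c ⊎ b ≡ c
    root     : V G
    root-top : ∀ {p} → ¬ Ch root p
    reach    : ∀ x → Ancestor Ch root x

module Tree {G : Graph} (tree : SpanningBinaryTree G) where
  open SpanningBinaryTree tree public
  open Walks G

  infix 4 _⊑_ _⋢_ _⊑?_
  _⊑_ : V G → V G → Set
  _⊑_ = Ancestor Ch

  _⋢_ : V G → V G → Set
  a ⋢ b = ¬ a ⊑ b

  ⊑-trans : ∀ {a b c} → a ⊑ b → b ⊑ c → a ⊑ c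
  ⊑-trans = ancestor-trans

  child⇒⊑ : ∀ {c p} → Ch c p → p ⊑ c
  child⇒⊑ = down self

  private
    len : ∀ {a b} → a ⊑ b → ℕ
    len self       = 0
    len (down p _) = suc (len p)

    -- `Ch` alone could contain cycles. Since the root has no parent and parents are unique, all
    -- descents from the root to `x` have the same length; this gives a depth, which rules cycles
    -- out.
    len-unique : ∀ {x} (p q : root ⊑ x) → len p ≡ len q
    len-unique self self = refl
    len-unique self (down _ c) = ⊥-elim (root-top c)
    len-unique (down _ c) self = ⊥-elim (root-top c)
    len-unique (down p c) (down q d) with refl ← Ch-parent c d = cong suc (len-unique p q)

    depth : V G → ℕ
    depth x = len (reach x)

    depth-child : ∀ {c p} → Ch c p → depth c ≡ suc (depth p)
    depth-child {c} ch = len-unique (reach c) (down (reach _) ch)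

    depth-mono : ∀ {a b} → a ⊑ b → depth a ≤ depth b
    depth-mono self = ℕ.≤-refl
    depth-mono (down p ch) =
      ℕ.≤-trans (depth-mono p) (ℕ.≤-trans (ℕ.n≤1+n _) (ℕ.≤-reflexive (sym (depth-child ch))))

  child-⋢ : ∀ {c p} → Ch c p → c ⋢ p
  child-⋢ ch c⊑p = ℕ.1+n≰n (subst (_≤ _) (depth-child ch) (depth-mono c⊑p))

  ⊑-antisym : ∀ {a b} → a ⊑ b → b ⊑ a → a ≡ b
  ⊑-antisym self _ = refl
  ⊑-antisym (down p ch) q = ⊥-elim (child-⋢ ch (⊑-trans q p))

  _⊑?_ : ∀ a x → Dec (a ⊑ x)
  a ⊑? x = go (reach x)
    where
    go : ∀ {x} → root ⊑ x → Dec (a ⊑ x)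
    go {x} r with a ≟ x
    ... | yes refl = yes self
    go self | no a≢ = no λ { self → a≢ refl ; (down _ ch) → root-top ch }
    go (down r ch) | no a≢ with go r
    ... | yes p = yes (down p ch)
    ... | no ¬p = no λ { self → a≢ refl
                       ; (down p ch′) → ¬p (subst (a ⊑_) (Ch-parent ch′ ch) p) }

  laminar : ∀ {a b x} → a ⊑ x → b ⊑ x → a ⊑ b ⊎ b ⊑ a
  laminar = ancestor-laminar Ch-parent

  towards : ∀ {a x} → a ⊑ x → a ≢ x → ∃ λ c → Ch c a × c ⊑ x
  towards self a≢ = ⊥-elim (a≢ refl)
  towards {a} (down {y} p ch) _ with a ≟ y
  ... | yes refl = _ , ch , self
  ... | no a≢ with c , ch′ , q ← towards p a≢ = c , ch′ , down q ch

  above-child : ∀ {a c p} → Ch c p → a ⊑ c → a ≢ c → a ⊑ p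
  above-child ch self a≢ = ⊥-elim (a≢ refl)
  above-child ch (down p d) _ with refl ← Ch-parent ch d = p

  siblings-disjoint : ∀ {c c′ p x} → Ch c p → Ch c′ p → c ≢ c′ → c ⊑ x → c′ ⋢ x
  siblings-disjoint ch ch′ c≢ p q with laminar p q
  ... | inj₁ r = child-⋢ ch (above-child ch′ r c≢)
  ... | inj₂ r = child-⋢ ch′ (above-child ch r (≢-sym c≢))

  up : ∀ {a x} → a ⊑ x → WalkIn (λ z → a ⊑ z × z ⊑ x) x a
  up self = here-walk (self , self)
  up (down p ch) = step-walk (down p ch , self) (E-sym (Ch-edge ch))
    (weaken (λ (s , t) → s , down t ch) (up p))

  -- A subdivided complete binary tree of height `h` hangs below the vertex. Only branchings are
  -- counted; `along` passes over the subdivision vertices.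
  data Big : ℕ → V G → Set where
    big0   : ∀ {p} → Big 0 p
    along  : ∀ {h c p} → Ch c p → Big h c → Big h p
    branch : ∀ {h c c′ p} → Ch c p → Ch c′ p → c ≢ c′ → Big h c → Big h c′ → Big (suc h) p

  big-up : ∀ {h a b} → a ⊑ b → Big h b → Big h a
  big-up self       B = B
  big-up (down p c) B = big-up p (along c B)

  big-pred : ∀ {h p} → Big (suc h) p → Big h p
  big-pred (along c B) = along c (big-pred B)
  big-pred {zero} B@(branch _ _ _ _ _) = big0
  big-pred {suc h} (branch c c′ c≢ B B′) = branch c c′ c≢ (big-pred B) (big-pred B′)

  big-≤ : ∀ {m n p} → m ≤ n → Big n p → Big m p
  big-≤ {n = zero} z≤n B = B
  big-≤ {m} {suc n} m≤ B with m ℕ.≟ suc n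
  ... | yes refl = B
  ... | no m≢ = big-≤ (ℕ.≤-pred (ℕ.≤∧≢⇒< m≤ m≢)) (big-pred B)

  record Branching (h : ℕ) (p : V G) : Set where
    constructor mkBranching
    field
      {apex l r} : V G
      p⊑apex : p ⊑ apex
      l-child : Ch l apex
      r-child : Ch r apex
      l≢r : l ≢ r
      l-big : Big h l
      r-big : Big h r

  branching : ∀ {h p} → Big (suc h) p → Branching h p
  branching (branch c c′ c≢ B B′) = mkBranching self c c′ c≢ B B′
  branching (along c B) with mkBranching q cl cr l≢ L R ← branching B =
    mkBranching (⊑-trans (child⇒⊑ c) q) cl cr l≢ L R

  -- The tree of a successful search is kept as data because the branch sets of the minor are read
  -- off from it.
  data Frontier (Q : Pred (V G) 0ℓ) : ℕ → V G → Set where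
    tip    : ∀ {p} → Q p → Frontier Q 0 p
    along  : ∀ {h c p} → Ch c p → Frontier Q h c → Frontier Q h p
    branch : ∀ {h c c′ p} → Ch c p → Ch c′ p → c ≢ c′ →
             Frontier Q h c → Frontier Q h c′ → Frontier Q (suc h) p

  -- Only the vertices reached after `m` branchings are tested, so one that fails still has `h`
  -- branchings below it.
  frontier-or-gap : ∀ {Q : Pred (V G) 0ℓ} → Decidable Q → ∀ m {h p} → Big (m + h) p →
    Frontier Q m p ⊎ ∃ λ z → p ⊑ z × Big h z × ¬ Q z
  frontier-or-gap Q? zero {p = p} B with Q? p
  ... | yes q = inj₁ (tip q)
  ... | no ¬q = inj₂ (p , self , B , ¬q)
  frontier-or-gap Q? (suc m) (along ch B) with frontier-or-gap Q? (suc m) B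
  ... | inj₁ F = inj₁ (along ch F)
  ... | inj₂ (z , p⊑z , Bz , ¬q) = inj₂ (z , ⊑-trans (child⇒⊑ ch) p⊑z , Bz , ¬q)
  frontier-or-gap Q? (suc m) (branch ch ch′ c≢ B B′)
    with frontier-or-gap Q? m B | frontier-or-gap Q? m B′
  ... | inj₁ F | inj₁ F′ = inj₁ (branch ch ch′ c≢ F F′)
  ... | inj₂ (z , p⊑z , r) | _ = inj₂ (z , ⊑-trans (child⇒⊑ ch) p⊑z , r)
  ... | inj₁ _ | inj₂ (z , p⊑z , r) = inj₂ (z , ⊑-trans (child⇒⊑ ch′) p⊑z , r)

-- Two disjoint walks

-- Two disjoint walks from X, one along the way to p and one to A, as in Menger's theorem; the
-- fixed walk v, ts from X to p is absorbed vertex by vertex, rerouting through the escape walks.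
module TwoLinks (G : Graph)
  {X A Al Z : Pred (V G) 0ℓ} (X? : Decidable X) (A? : Decidable A)
  (X⊆Al : ∀ {z} → X z → Al z) (p : V G)
  (closed : ∀ {c d} → Al c → E G c d → ¬ Z d → Al d ⊎ d ≡ p ⊎ A d)
  where
  open Walks G

  Ok : Pred (V G) 0ℓ
  Ok z = Al z ⊎ z ≡ p

  Target : List (V G) → Pred (V G) 0ℓ
  Target rest w = w ∈ rest ⊎ A w

  -- The form in which 2-connectedness enters: deleting one vertex `q` of the fixed walk must still
  -- leave a way from `X` to `A`.
  Escape : V G → Set
  Escape q = ∃₂ λ b a → X b × A a × WalkIn (λ z → z ≢ q × ¬ Z z) b a

  module Scan (q : V G) (rest : List (V G)) (p∈ : p ≢ q → p ∈ rest)
    {Anch : Pred (V G) 0ℓ} (Anch? : Decidable Anch) where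

    Fresh : Pred (V G) 0ℓ
    Fresh z = Al z × z ≢ q × ¬ Anch z × z ∉ rest

    Onward : V G → Set
    Onward c = ∃ λ w → Target rest w × (c ≡ w ⊎ ∃ λ e → WalkIn Fresh c e × E G e w)

    Anchored : Set
    Anchored = ∃₂ λ m d → Al m × m ≢ q × m ∉ rest × Anch m × E G m d × Onward d

    -- The walk is cut where it first meets the target. The part ahead is examined before `c` is
    -- tested, so the anchor returned is the last one before the cut, and from there on the walk is
    -- fresh.
    scan : ∀ {c a vs} → Walk c vs a → All (λ z → z ≢ q × ¬ Z z) vs → A a → Al c ⊎ c ≡ p ⊎ A c →
      Anchored ⊎ Onward c
    scan stop _ Aa _ = inj₂ (_ , inj₂ Aa , inj₁ refl)
    scan {c} (e ► w) ((c≢q , ¬Zc) ∷ s) Aa k with (c ∈? rest) ⊎-dec (A? c)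
    ... | yes t = inj₂ (c , t , inj₁ refl)
    ... | no ¬t with k
    ...   | inj₂ (inj₁ refl) = ⊥-elim (¬t (inj₁ (p∈ c≢q)))
    ...   | inj₂ (inj₂ Ac) = ⊥-elim (¬t (inj₂ Ac))
    ...   | inj₁ Al-c
      with scan w s Aa (closed Al-c e (proj₂ (All.lookup s (start∈ w)))) | Anch? c
    ...     | inj₁ r | _ = inj₁ r
    ...     | inj₂ r | yes an = inj₁ (c , _ , Al-c , c≢q , ¬t ∘ inj₁ , an , e , r)
    ...     | inj₂ (w′ , t , inj₁ refl) | no ¬an =
      inj₂ (w′ , t , inj₂ (c , here-walk (Al-c , c≢q , ¬an , ¬t ∘ inj₁) , e))
    ...     | inj₂ (w′ , t , inj₂ (e′ , r , f)) | no ¬an =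
      inj₂ (w′ , t , inj₂ (e′ , step-walk (Al-c , c≢q , ¬an , ¬t ∘ inj₁) e r , f))

    anchored : (∀ {z} → X z → z ≢ q → z ∉ rest × ¬ A z × Anch z) → Escape q → Anchored
    anchored X⇒ (b , a , Xb , Aa , w@(_ , w′ , s′))
      with b≢q , _ ← walkIn-start w
      with b∉ , ¬Ab , an ← X⇒ Xb b≢q
      with scan w′ s′ Aa (inj₁ (X⊆Al Xb))
    ... | inj₁ r = r
    ... | inj₂ (_ , inj₁ b∈ , inj₁ refl) = ⊥-elim (b∉ b∈)
    ... | inj₂ (_ , inj₂ Ab , inj₁ refl) = ⊥-elim (¬Ab Ab)
    ... | inj₂ (_ , _ , inj₂ (_ , r , _)) = ⊥-elim (proj₁ (proj₂ (proj₂ (walkIn-start r))) an)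

    extend : ∀ {x us m d} → Walk x us m → E G m d → Onward d →
      ∃₂ λ ds e → ∃ λ w → Walk x (us ++ ds) e × E G e w × Target rest w × All Fresh ds
    extend {us = us} r e (w , t , inj₁ refl) =
      [] , _ , w , subst (λ vs → Walk _ vs _) (sym (++-identityʳ us)) r , e , t , []
    extend r e (w , t , inj₂ (e′ , (ds , s , c) , f)) = ds , e′ , w , join r e s , f , t , c

  -- The invariant of the absorption. The first walk ends at the vertex `t` of the fixed walk
  -- reached so far; the second is one edge short of `A` or of the part of the fixed walk still to
  -- come. By `v≡` the vertex `v` remains one of the two starting points.
  record Links (v t : V G) (rest : List (V G)) : Set where
    field
      {x₁ x₂ e w} : V G
      {vs₁ vs₂} : List (V G)
      X₁ : X x₁
      X₂ : X x₂
      x₁≢x₂ : x₁ ≢ x₂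
      v≡ : v ≡ x₁ ⊎ v ≡ x₂
      walk₁ : Walk x₁ vs₁ t
      walk₂ : Walk x₂ vs₂ e
      edge : E G e w
      target : Target rest w
      ok₁ : ∀ {z} → z ∈ vs₁ → Ok z × z ∉ rest × (X z → z ≡ x₁)
      ok₂ : ∀ {z} → z ∈ vs₂ → Ok z × z ∉ rest × (X z → z ≡ x₂)
      disjoint : ∀ {z} → z ∈ vs₁ → z ∉ vs₂

  module _ (X∩A : ∀ {z} → X z → ¬ A z) {v : V G} (Xv : X v) where

    Last : V G → List (V G) → Set
    Last t []       = t ≡ p
    Last t (s ∷ ss) = Last s ss

    last∈ : ∀ {t} ss → Last t ss → p ≢ t → p ∈ ss
    last∈ [] eq p≢ = ⊥-elim (p≢ (sym eq))
    last∈ (s ∷ ss) l _ with p ≟ s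
    ... | yes eq = here eq
    ... | no p≢ = there (last∈ ss l p≢)

    start-links : ∀ {ts} → Last v ts → (∀ {z} → z ∈ ts → ¬ X z) → v ∉ ts →
      Escape v → Links v v ts
    start-links {ts} last ¬X v∉ esc
      with m , d , Al-m , m≢ , m∉ , an , f , on ←
             Scan.anchored v ts (last∈ ts last) X? (λ Xz _ → (λ z∈ → ¬X z∈ Xz) , X∩A Xz , Xz) esc
      with ds , e , w , r , g , t , cl ← Scan.extend v ts (last∈ ts last) X? stop f on
      = record
        { X₁ = Xv ; X₂ = an ; x₁≢x₂ = ≢-sym m≢ ; v≡ = inj₁ refl
        ; walk₁ = stop ; walk₂ = r ; edge = g ; target = t
        ; ok₁ = λ { (here refl) → inj₁ (X⊆Al Xv) , v∉ , λ _ → refl }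
        ; ok₂ = λ { (here refl) → inj₁ Al-m , m∉ , λ _ → refl
                  ; (there z∈) → let al , _ , ¬Xz , z∉ = All.lookup cl z∈ in
                      inj₁ al , z∉ , λ Xz → ⊥-elim (¬Xz Xz) }
        ; disjoint = λ { (here refl) (here eq) → m≢ (sym eq)
                       ; (here refl) (there z∈) → proj₁ (proj₂ (All.lookup cl z∈)) refl } }

    -- Unless the second walk is about to enter `t′`, the first one simply moves on. Otherwise both
    -- lead to `t′`: one of them takes it, and the escape past `t′`, followed from its last anchor,
    -- gives the other a new continuation.
    grow : ∀ {t t′ ss} → Links v t (t′ ∷ ss) → E G t t′ → Last t′ ss → Unique (t′ ∷ ss) →
      Ok t′ → (∀ {z} → z ∈ t′ ∷ ss → ¬ X z) → Escape t′ → Links v t′ ss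
    grow {t} {t′} {ss} L tt′ last uniq okt ¬X esc = go
      where
      open Links L
      Anch : Pred (V G) 0ℓ
      Anch z = z ∈ vs₁ ⊎ z ∈ vs₂ ⊎ X z
      Anch? : Decidable Anch
      Anch? z = (z ∈? vs₁) ⊎-dec ((z ∈? vs₂) ⊎-dec X? z)
      open Scan t′ ss (last∈ ss last) Anch?

      ok-snoc : ∀ {x us} → (∀ {z} → z ∈ us → Ok z × z ∉ t′ ∷ ss × (X z → z ≡ x)) →
        ∀ {z} → z ∈ us ++ t′ ∷ [] → Ok z × z ∉ ss × (X z → z ≡ x)
      ok-snoc {us = us} ok z∈ with ∈-++⁻ us z∈
      ... | inj₁ z∈us = let o , z∉ , x = ok z∈us in o , z∉ ∘ there , x
      ... | inj₂ (here refl) = okt , unique-∉ uniq , λ Xz → ⊥-elim (¬X (here refl) Xz)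

      reroute : ∀ {x x′ us us′ y m d} → X x → X x′ → x ≢ x′ → v ≡ x ⊎ v ≡ x′ →
        Walk x us y → E G y t′ → Walk x′ us′ m → E G m d → Onward d →
        (∀ {z} → z ∈ us → Ok z × z ∉ t′ ∷ ss × (X z → z ≡ x)) →
        (∀ {z} → z ∈ us′ → Ok z × z ∉ t′ ∷ ss × (X z → z ≡ x′)) →
        (∀ {z} → z ∈ us → Anch z) →
        (∀ {z} → z ∈ us → z ∉ us′) → Links v t′ ss
      reroute {us = us} {us′} Xx Xx′ x≢ v≡ r f r′ g on ok ok′ an dis
        with ds , e , w , r″ , h , t , cl ← extend r′ g on
        = record
          { X₁ = Xx ; X₂ = Xx′ ; x₁≢x₂ = x≢ ; v≡ = v≡
          ; walk₁ = join r f stop ; walk₂ = r″ ; edge = h ; target = t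
          ; ok₁ = ok-snoc ok
          ; ok₂ = λ z∈ → case ∈-++⁻ us′ z∈ of λ
              { (inj₁ z∈us′) → let o , z∉ , x = ok′ z∈us′ in o , z∉ ∘ there , x
              ; (inj₂ z∈ds) → let al , _ , ¬an , z∉ = All.lookup cl z∈ds in
                  inj₁ al , z∉ , λ Xz → ⊥-elim (¬an (inj₂ (inj₂ Xz))) }
          ; disjoint = λ z∈ z∈′ → case ∈-++⁻ us z∈ of λ
              { (inj₁ z∈us) → case ∈-++⁻ us′ z∈′ of λ
                  { (inj₁ z∈us′) → dis z∈us z∈us′
                  ; (inj₂ z∈ds) → proj₁ (proj₂ (proj₂ (All.lookup cl z∈ds))) (an z∈us) }
              ; (inj₂ (here refl)) → case ∈-++⁻ us′ z∈′ of λ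
                  { (inj₁ z∈us′) → proj₁ (proj₂ (ok′ z∈us′)) (here refl)
                  ; (inj₂ z∈ds) → proj₁ (proj₂ (All.lookup cl z∈ds)) refl } } }

      swap : v ≡ x₁ ⊎ v ≡ x₂ → v ≡ x₂ ⊎ v ≡ x₁
      swap (inj₁ eq) = inj₂ eq
      swap (inj₂ eq) = inj₁ eq

      meet : E G e t′ → Anchored → Links v t′ ss
      meet et′ (m , d , Al-m , m≢ , m∉ , an , g , on) with m ∈? vs₁ | m ∈? vs₂
      ... | yes m∈ | _ with us , r , us⊆ ← prefix walk₁ m∈ =
        reroute X₂ X₁ (≢-sym x₁≢x₂) (swap v≡) walk₂ et′ r g on ok₂ (ok₁ ∘ us⊆)
          (inj₂ ∘ inj₁) (λ z∈ z∈us → disjoint (us⊆ z∈us) z∈)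
      ... | no _ | yes m∈ with us , r , us⊆ ← prefix walk₂ m∈ =
        reroute X₁ X₂ x₁≢x₂ v≡ walk₁ tt′ r g on ok₁ (ok₂ ∘ us⊆)
          inj₁ (λ z∈ z∈us → disjoint z∈ (us⊆ z∈us))
      -- The escape branches off from neither walk, so it starts afresh in `X`. Whichever walk
      -- starts at `v` is continued to `t′`, and the other one is given up.
      ... | no m∉₁ | no m∉₂ with an | v≡
      ...   | inj₁ m∈ | _ = ⊥-elim (m∉₁ m∈)
      ...   | inj₂ (inj₁ m∈) | _ = ⊥-elim (m∉₂ m∈)
      ...   | inj₂ (inj₂ Xm) | inj₁ v≡x₁ =
        reroute X₁ Xm (λ { refl → m∉₁ (start∈ walk₁) }) (inj₁ v≡x₁) walk₁ tt′ stop g on ok₁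
          (λ { (here refl) → inj₁ Al-m , (λ { (here eq) → m≢ eq ; (there m∈) → m∉ m∈ }) , λ _ → refl })
          inj₁ (λ { z∈ (here refl) → m∉₁ z∈ })
      ...   | inj₂ (inj₂ Xm) | inj₂ v≡x₂ =
        reroute X₂ Xm (λ { refl → m∉₂ (start∈ walk₂) }) (inj₁ v≡x₂) walk₂ et′ stop g on ok₂
          (λ { (here refl) → inj₁ Al-m , (λ { (here eq) → m≢ eq ; (there m∈) → m∉ m∈ }) , λ _ → refl })
          (inj₂ ∘ inj₁) (λ { z∈ (here refl) → m∉₂ z∈ })

      extended : Target ss w → Links v t′ ss
      extended tgt = record
        { X₁ = X₁ ; X₂ = X₂ ; x₁≢x₂ = x₁≢x₂ ; v≡ = v≡
        ; walk₁ = join walk₁ tt′ stop ; walk₂ = walk₂ ; edge = edge ; target = tgt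
        ; ok₁ = ok-snoc ok₁
        ; ok₂ = λ z∈ → let o , z∉ , x = ok₂ z∈ in o , z∉ ∘ there , x
        ; disjoint = λ z∈ z∈₂ → case ∈-++⁻ vs₁ z∈ of λ
            { (inj₁ z∈₁) → disjoint z∈₁ z∈₂
            ; (inj₂ (here refl)) → proj₁ (proj₂ (ok₂ z∈₂)) (here refl) } }

      go : Links v t′ ss
      go with target
      ... | inj₂ Aw = extended (inj₂ Aw)
      ... | inj₁ (there w∈) = extended (inj₁ w∈)
      ... | inj₁ (here refl) = meet edge (anchored
        (λ Xz z≢ → (λ z∈ → ¬X (there z∈) Xz) , X∩A Xz , inj₂ (inj₂ Xz)) esc)

    two-links : ∀ {ts} → Walk v (v ∷ ts) p → Unique (v ∷ ts) →
      (∀ {z} → z ∈ ts → Ok z × ¬ X z) → (∀ {z} → z ∈ v ∷ ts → Escape z) → Links v p []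
    two-links {ts} w uniq@(_ ∷ u) ok esc =
      run w u ok (esc ∘ there)
        (start-links (last-of w) (proj₂ ∘ ok) (unique-∉ uniq) (esc (here refl)))
      where
      last-of : ∀ {t ss} → Walk t (t ∷ ss) p → Last t ss
      last-of stop = refl
      last-of (_ ► stop) = refl
      last-of (_ ► w@(_ ► _)) = last-of w
      run : ∀ {t ss} → Walk t (t ∷ ss) p → Unique ss → (∀ {z} → z ∈ ss → Ok z × ¬ X z) →
        (∀ {z} → z ∈ ss → Escape z) → Links v t ss → Links v p []
      run stop _ _ _ L = L
      run (e ► stop) u ok esc L =
        grow L e refl u (proj₁ (ok (here refl))) (proj₂ ∘ ok) (esc (here refl))
      run (e ► w@(_ ► _)) u@(_ ∷ u′) ok esc L = run w u′ (ok ∘ there) (esc ∘ there)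
        (grow L e (last-of w) u (proj₁ (ok (here refl))) (proj₂ ∘ ok) (esc (here refl)))

-- Reserves

module Pockets {G : Graph} (tree : SpanningBinaryTree G) where
  open Walks G
  open Tree tree

  ascent : ∀ {a x} → a ⊑ x → ∃ λ vs → Walk x vs a × Unique vs
    × (∀ {z} → z ∈ vs → a ⊑ z × z ⊑ x) × (∀ {z} → a ⊑ z → z ⊑ x → z ∈ vs)
  ascent self = _ , stop , [] ∷ [] , (λ { (here refl) → self , self })
    , λ p q → here (sym (⊑-antisym p q))
  ascent {x = x} (down p ch) with vs , w , u , vs⊆ , ⊆vs ← ascent p =
    _ , E-sym (Ch-edge ch) ► w
    , unique-∷ (λ x∈ → child-⋢ ch (proj₂ (vs⊆ x∈))) u
    , (λ { (here refl) → down p ch , self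
         ; (there z∈) → let s , t = vs⊆ z∈ in s , down t ch })
    , λ {z} s t → case z ≟ x of λ
        { (yes eq) → here eq ; (no z≢) → there (⊆vs s (above-child ch t z≢)) }

  -- U is the reserve in which the ears of the next generation will grow, and q is the vertex of
  -- the current path P where they all start; through A, the rest of the subtree of v, they
  -- return to P.
  record Pocket (v : V G) : Set₁ where
    field
      {q u} : V G
      {U} : Pred (V G) 0ℓ
      U? : Decidable U
      v⊑q : v ⊑ q
      u-child : Ch u q
      below-u : ∀ {x} → u ⊑ x → U x
      U⇒below : ∀ {x} → U x → q ⊑ x
      q∉U : ¬ U q
      closed : ∀ {x w} → U x → E G x w → v ⊑ w

    A : Pred (V G) 0ℓ
    A w = v ⊑ w × w ≢ q × ¬ U w

    A? : Decidable A
    A? w = (v ⊑? w) ×-dec (¬? (w ≟ q) ×-dec ¬? (U? w))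

  -- An ear grown in `U` has one end at `q`. Its other leg enters `A` and needs `return` to come
  -- back to the path without touching `q` or `U`.
  record Guards {v} (K : Pocket v) (L : List (V G)) : Set where
    open Pocket K
    field
      q∈ : q ∈ L
      avoids : ∀ {z} → z ∈ L → ¬ U z
      return : ∀ {w} → A w → ∃ λ m → m ∈ L × WalkIn A w m
      some : ∃ A

  guards-⊆ : ∀ {v} {K : Pocket v} {L L′} → (∀ {z} → z ∈ L → z ∈ L′) →
    (∀ {z} → z ∈ L′ → ¬ Pocket.U K z) → Guards K L → Guards K L′
  guards-⊆ f av g = record
    { q∈ = f q∈ ; avoids = av ; some = some
    ; return = λ a → let m , m∈ , w = return a in m , f m∈ , w }
    where open Guards g

  Guarding : ∀ {v} → Pocket v → V G → V G → Set
  Guarding {v} K a b = ∃ λ L → Walk a L b × Unique L × (∀ {z} → z ∈ L → v ⊑ z) × Guards K L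

  turn : ∀ {v} {K : Pocket v} {a b} → Guarding K a b → Guarding K b a
  turn {K = K} (L , w , u , L⊆ , g) with L′ , w′ , u′ , f , f′ ← reversed w u =
    L′ , w′ , u′ , L⊆ ∘ f , guards-⊆ {K = K} f′ (Guards.avoids g ∘ f) g

  Exit : V G → V G → Set
  Exit v x = ∃ λ w → v ⋢ w × E G x w

  HasExit : V G → V G → Set
  HasExit v y = ∃ λ x → y ⊑ x × Exit v x

  exit? : ∀ v x → Dec (Exit v x)
  exit? v x = any? λ w → ¬? (v ⊑? w) ×-dec E? x w

  hasExit? : ∀ v y → Dec (HasExit v y)
  hasExit? v y = any? λ x → (y ⊑? x) ×-dec exit? v x

  no-exit-below : ∀ {v a b} → a ⊑ b → ¬ HasExit v a → ¬ HasExit v b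
  no-exit-below a⊑b n (x , b⊑x , ex) = n (x , ⊑-trans a⊑b b⊑x , ex)

  no-exit : ∀ {v y x w} → ¬ HasExit v y → y ⊑ x → E G x w → v ⊑ w
  no-exit {v} {w = w} n y⊑x e with v ⊑? w
  ... | yes p = p
  ... | no ¬p = ⊥-elim (n (_ , y⊑x , w , ¬p , e))

  -- The path ends in `f′` instead of `f`, and the edge out of the subtree of `v` makes up for it.
  -- It is not known beforehand which of the two walks this edge will replace, so the surviving end
  -- may be `v` or `f`, and both need a path to `f′`.
  record Exiting {v} (K : Pocket v) (f : V G) : Set where
    field
      {f′ w} : V G
      v⊑f′ : v ⊑ f′
      f′≢v : f′ ≢ v
      v⋢w : v ⋢ w
      edge : E G f′ w
      guarding : ∀ {x} → x ≡ v ⊎ x ≡ f → Guarding K x f′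

  -- Here u is the topmost vertex on the way from v to z without an exit below it, and q is its
  -- parent. A path from v can therefore leave the subtree of v below q and off U, unless q is v.
  module Pick {v c c′ f : V G} (ch : Ch c v) (ch′ : Ch c′ v) (c≢c′ : c ≢ c′) (c⊑f : c ⊑ f) where

    Result : V G → Set₁
    Result z = Σ (Pocket v) λ K → Pocket.u K ⊑ z × (Guarding K v f ⊎ Exiting K f)

    private
      topmost : ∀ {z} → c′ ⊑ z → ¬ HasExit v z →
        ∃₂ λ q u → Ch u q × u ⊑ z × ¬ HasExit v u × (q ≡ v × u ≡ c′ ⊎ HasExit v q × c′ ⊑ q)
      topmost self n = v , c′ , ch′ , self , n , inj₁ (refl , refl)
      topmost (down {y} p d) n with hasExit? v y
      ... | yes h = y , _ , d , self , n , inj₂ (h , p)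
      ... | no n′ with q , u , chu , u⊑ , r ← topmost p n′ = q , u , chu , down u⊑ d , r

      at-v : ¬ HasExit v c′ → Result c′
      at-v n = K , self , inj₁ path
        where
        K : Pocket v
        K = record
          { U = c′ ⊑_ ; U? = c′ ⊑?_ ; v⊑q = self ; u-child = ch′ ; below-u = id
          ; U⇒below = ⊑-trans (child⇒⊑ ch′) ; q∉U = child-⋢ ch′ ; closed = no-exit n }
        ret : ∀ {w} → Pocket.A K w → WalkIn (Pocket.A K) w c
        ret (v⊑w , w≢v , c′⋢w) with d , chd , d⊑w ← towards v⊑w (≢-sym w≢v)
          -- A vertex has at most two children, so what is left of the subtree of `v` beside `v` and
          -- the reserve is the subtree of `c`, and `c` lies on the path to `f`.
          with Ch-two chd ch ch′
        ... | inj₁ refl = weaken (λ (s , t) →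
                ⊑-trans (child⇒⊑ ch) s , (λ { refl → child-⋢ ch s }) , λ r → c′⋢w (⊑-trans r t)) (up d⊑w)
        ... | inj₂ (inj₁ refl) = ⊥-elim (c′⋢w d⊑w)
        ... | inj₂ (inj₂ eq) = ⊥-elim (c≢c′ eq)
        path : Guarding K v f
        path with vs , w , u , vs⊆ , ⊆vs ← ascent (⊑-trans (child⇒⊑ ch) c⊑f)
          with us , r , u′ , f₁ , f₂ ← reversed w u =
          us , r , u′ , proj₁ ∘ vs⊆ ∘ f₁ , record
            { q∈ = start∈ r
            ; avoids = λ z∈ s → siblings-disjoint ch ch′ c≢c′ c⊑f (⊑-trans s (proj₂ (vs⊆ (f₁ z∈))))
            ; return = λ a → c , f₂ (⊆vs (child⇒⊑ ch) c⊑f) , ret a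
            ; some = c , child⇒⊑ ch , (λ { refl → child-⋢ ch self })
                   , siblings-disjoint ch ch′ c≢c′ self }

      module Below {q f′ w} (K : Pocket v) (q≡ : Pocket.q K ≡ q) (c′⊑q : c′ ⊑ q) (q⊑f′ : q ⊑ f′)
        (v⋢w : v ⋢ w) (edge : E G f′ w) (off : ∀ {z} → z ⊑ f′ → ¬ Pocket.U K z)
        (U-down : ∀ {z x} → Pocket.U K z → z ⊑ x → Pocket.U K x)
        (rest : ∀ {x} → Pocket.A K x → q ⊑ x → ∃ λ d → Ch d q × d ⊑ x × d ⊑ f′) where
        open Pocket K using (U; A; U⇒below)

        v⊑c′ : v ⊑ c′
        v⊑c′ = child⇒⊑ ch′
        c′⊑f′ : c′ ⊑ f′
        c′⊑f′ = ⊑-trans c′⊑q q⊑f′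
        v⊑f′ : v ⊑ f′
        v⊑f′ = ⊑-trans v⊑c′ c′⊑f′

        U⇒q⊑ : ∀ {x} → U x → q ⊑ x
        U⇒q⊑ Ux = subst (_⊑ _) q≡ (U⇒below Ux)

        outside : ∀ {z} → v ⊑ z → q ⋢ z → A z
        outside v⊑z q⋢z = v⊑z , (λ { refl → q⋢z (subst (_⊑ _) q≡ self) }) , λ Uz → q⋢z (U⇒q⊑ Uz)

        v-in-A : A v
        v-in-A = outside self λ q⊑v → child-⋢ ch′ (⊑-trans c′⊑q q⊑v)

        ret : ∀ {x} → A x → ∃ λ m → (v ⊑ m × m ⊑ f′) × WalkIn A x m
        ret {x} a@(v⊑x , x≢ , ¬U) with q ⊑? x
        ... | no q⋢x = v , (self , v⊑f′) ,
          weaken (λ (s , t) → outside s λ r → q⋢x (⊑-trans r t)) (up v⊑x)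
        ... | yes q⊑x with d , chd , d⊑x , d⊑f′ ← rest a q⊑x =
          d , (v⊑d , d⊑f′) , weaken (λ (s , t) → ⊑-trans v⊑d s
            , (λ { refl → child-⋢ chd (subst (d ⊑_) q≡ s) })
            , λ Uz → ¬U (U-down Uz t)) (up d⊑x)
          where
          v⊑d : v ⊑ d
          v⊑d = ⊑-trans v⊑c′ (⊑-trans c′⊑q (child⇒⊑ chd))

        exiting : Exiting K f
        exiting with vs , r , u , vs⊆ , ⊆vs ← ascent v⊑f′
                   | us , s , u′ , us⊆ , ⊆us ← ascent c⊑f = record
          { v⊑f′ = v⊑f′ ; f′≢v = (λ { refl → child-⋢ ch′ c′⊑f′ }) ; v⋢w = v⋢w ; edge = edge
          ; guarding = λ { (inj₁ refl) → turn {K = K} (vs , r , u , proj₁ ∘ vs⊆ , guards)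
                         ; (inj₂ refl) → turn {K = K} long } }
          where
          guards : Guards K vs
          guards = record
            { q∈ = subst (_∈ vs) (sym q≡) (⊆vs (⊑-trans v⊑c′ c′⊑q) q⊑f′)
            ; avoids = off ∘ proj₂ ∘ vs⊆
            ; return = λ a → let m , (s , t) , w = ret a in m , ⊆vs s t , w
            ; some = v , v-in-A }
          long : Guarding K f′ f
          long with ts , r′ , u″ , ts⊆ , ⊆ts ← reversed s u′ =
            vs ++ ts , join r (Ch-edge ch) r′
            , Uniqueₚ.++⁺ u u″ (λ (z∈ , z∈′) →
                siblings-disjoint ch ch′ c≢c′
                  (⊑-trans (proj₁ (us⊆ (ts⊆ z∈′))) (proj₂ (vs⊆ z∈))) c′⊑f′)
            , (λ z∈ → [ proj₁ ∘ vs⊆ , (λ z∈′ → ⊑-trans (child⇒⊑ ch) (proj₁ (us⊆ (ts⊆ z∈′)))) ]′ (∈-++⁻ vs z∈))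
            , guards-⊆ {K = K} ∈-++⁺ˡ (λ z∈ Uz → [ (λ z∈vs → off (proj₂ (vs⊆ z∈vs)) Uz)
                , (λ z∈ts → let s₁ , s₂ = us⊆ (ts⊆ z∈ts) in
                    siblings-disjoint ch ch′ c≢c′ s₁ (⊑-trans c′⊑q (U⇒q⊑ Uz))) ]′ (∈-++⁻ vs z∈)) guards

      -- If an exit lies strictly below `q` and outside the subtree of `u`, it is under the only
      -- other child of `q`. A path descending to it passes through that child, and the rest of the
      -- subtree of `q` can return there.
      below : ∀ {q u} → Ch u q → ¬ HasExit v u → HasExit v q → c′ ⊑ q →
        Σ (Pocket v) λ K → Pocket.u K ≡ u × Exiting K f
      below {q} {u} chu n (y , q⊑y , w₀ , v⋢w₀ , e₀) c′⊑q
        with any? (λ x → (q ⊑? x) ×-dec (¬? (x ≟ q) ×-dec (¬? (u ⊑? x) ×-dec exit? v x)))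
      ... | yes (f′ , q⊑f′ , f′≢q , u⋢f′ , w , v⋢w , e) = K , refl , Below.exiting K refl c′⊑q q⊑f′
              v⋢w e (λ s t → u⋢f′ (⊑-trans t s)) ⊑-trans rest
        where
        v⊑q : v ⊑ q
        v⊑q = ⊑-trans (child⇒⊑ ch′) c′⊑q
        K : Pocket v
        K = record
          { U = u ⊑_ ; U? = u ⊑?_ ; v⊑q = v⊑q ; u-child = chu ; below-u = id
          ; U⇒below = ⊑-trans (child⇒⊑ chu) ; q∉U = child-⋢ chu ; closed = no-exit n }
        rest : ∀ {x} → Pocket.A K x → q ⊑ x → ∃ λ d → Ch d q × d ⊑ x × d ⊑ f′
        rest (_ , x≢q , u⋢x) q⊑x
          with d , chd , d⊑x ← towards q⊑x (≢-sym x≢q)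
             | d′ , chd′ , d′⊑f′ ← towards q⊑f′ (≢-sym f′≢q)
          with Ch-two chd chd′ chu
        ... | inj₁ refl = d , chd , d⊑x , d′⊑f′
        ... | inj₂ (inj₁ refl) = ⊥-elim (u⋢x d⊑x)
        ... | inj₂ (inj₂ refl) = ⊥-elim (u⋢f′ d′⊑f′)
      -- Here the exit is at `q` itself and the path stops there. A second child of `q` would then
      -- be cut off from the path by `q`, so the reserve takes in everything strictly below `q`.
      ... | no none = K , refl , Below.exiting K refl c′⊑q self
              (proj₁ (proj₂ q-exit)) (proj₂ (proj₂ q-exit))
              (λ s (t , z≢) → z≢ (⊑-antisym s t))
              (λ (t , z≢) s → ⊑-trans t s , λ { refl → z≢ (⊑-antisym s t) })
              (λ (_ , x≢q , ¬U) q⊑x → ⊥-elim (¬U (q⊑x , x≢q)))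
        where
        silent : ∀ {x} → q ⊑ x → x ≢ q → ¬ Exit v x
        silent {x} q⊑x x≢q ex with u ⊑? x
        ... | yes u⊑x = n (x , u⊑x , ex)
        ... | no u⋢x = none (x , q⊑x , x≢q , u⋢x , ex)
        q-exit : Exit v q
        q-exit with y ≟ q
        ... | yes refl = w₀ , v⋢w₀ , e₀
        ... | no y≢q = ⊥-elim (silent q⊑y y≢q (w₀ , v⋢w₀ , e₀))
        inside : ∀ {x w} → q ⊑ x × x ≢ q → E G x w → v ⊑ w
        inside {w = w} (q⊑x , x≢q) e with v ⊑? w
        ... | yes p = p
        ... | no ¬p = ⊥-elim (silent q⊑x x≢q (w , ¬p , e))
        K : Pocket v
        K = record
          { U = λ x → q ⊑ x × x ≢ q ; U? = λ x → (q ⊑? x) ×-dec ¬? (x ≟ q)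
          ; v⊑q = ⊑-trans (child⇒⊑ ch′) c′⊑q ; u-child = chu
          ; below-u = λ s → ⊑-trans (child⇒⊑ chu) s , λ { refl → child-⋢ chu s }
          ; U⇒below = proj₁ ; q∉U = λ (_ , q≢) → q≢ refl ; closed = inside }

    pick : ∀ {z} → c′ ⊑ z → ¬ HasExit v z → Result z
    pick c′⊑z n with topmost c′⊑z n
    ... | q , u , chu , u⊑z , nu , inj₁ (refl , refl) with K , u⊑ , g ← at-v nu =
      K , ⊑-trans u⊑ u⊑z , g
    ... | q , u , chu , u⊑z , nu , inj₂ (h , c′⊑q) with K , refl , ex ← below chu nu h c′⊑q =
      K , u⊑z , inj₂ ex

-- Ears

recast : ∀ {A : Set} {xs ys : List A} {z} → xs ≡ ys → z ∈ xs → z ∈ ys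
recast refl = id

module Avoiding (G : Graph) where
  open Walks G

  -- Each visit to Z is replaced by a detour inside C.
  avoiding : ∀ {Z C S : Pred (V G) 0ℓ} → Decidable Z →
    (∀ {x y} → Z x → E G x y → ¬ Z y → C y) →
    (∀ {a b} → C a → ¬ Z a → C b → ¬ Z b → WalkIn (λ z → S z × ¬ Z z) a b) →
    ∀ {a b} → WalkIn S a b → ¬ Z a → ¬ Z b → WalkIn (λ z → S z × ¬ Z z) a b
  avoiding {Z} {C} {S} Z? nbr conn (_ , w , s) = outside w s
    where
    outside : ∀ {a vs b} → Walk a vs b → All S vs → ¬ Z a → ¬ Z b →
      WalkIn (λ z → S z × ¬ Z z) a b
    inside : ∀ {a vs b g} → Walk a vs b → All S vs → Z a → ¬ Z b → C g → ¬ Z g →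
      WalkIn (λ z → S z × ¬ Z z) g b
    outside stop (s ∷ _) ¬Za _ = here-walk (s , ¬Za)
    outside (_►_ {b = y} e w) (s ∷ ss) ¬Za ¬Zb with Z? y
    ... | no ¬Zy = step-walk (s , ¬Za) e (outside w ss ¬Zy ¬Zb)
    ... | yes Zy = inside w ss Zy ¬Zb (nbr Zy (E-sym e) ¬Za) ¬Za
    inside stop _ Za ¬Za _ _ = ⊥-elim (¬Za Za)
    inside (_►_ {b = y} e w) (_ ∷ ss) Za ¬Zb Cg ¬Zg with Z? y
    ... | no ¬Zy = conn Cg ¬Zg (nbr Za e ¬Zy) ¬Zy ⊙ outside w ss ¬Zy ¬Zb
    ... | yes Zy = inside w ss Zy ¬Zb Cg ¬Zg

module Sites {G : Graph} (tree : SpanningBinaryTree G) where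
  open Walks G
  open Tree tree
  open Pockets tree

  -- `outer` is the source of cleanness: the ears grown from here stay below `v`, so they all miss
  -- this end of `P`.
  record Site (P : Path G) (n : ℕ) : Set₁ where
    field
      {v} : V G
      pocket : Pocket v
      guards : Guards pocket (verts P)
      big : Big n (Pocket.u pocket)
      outer : ∃ λ e → (e ≡ start P ⊎ e ≡ end P) × v ⋢ e

  -- By `Q-pocket` the path `Qₓ` has no vertices below `v₁` beyond those of `Pₓ`; hence an ear of
  -- `Pₓ` that stays below `v₁` is also disjoint from `Qₓ` in its interior. `Q-avoids` keeps the
  -- sibling's part of the reserve free.
  record Pear (P : Path G) {v₀} (K₀ : Pocket v₀) (v₁ v₂ : V G) (n : ℕ) : Set₁ where
    field
      Pₓ Qₓ : Path G
      P⊆Q : SubPath Pₓ Qₓ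
      P-long : 2 ≤ pathLength Pₓ
      Q-long : 2 ≤ pathLength Qₓ
      ear : IsEar Qₓ P
      P-inner : ∀ {z} → z ∈ inner Pₓ → v₁ ⊑ z
      Q-region : ∀ {z} → z ∈ verts Qₓ → v₀ ⊑ z
      Q-pocket : ∀ {z} → z ∈ verts Qₓ → v₁ ⊑ z → z ∈ verts Pₓ
      Q-avoids : ∀ {z} → z ∈ verts Qₓ → v₂ ⋢ z
      site : Site Pₓ n
      site-v : Site.v site ≡ v₁

  -- The ear Qₓ follows k₁ backwards, then L, then k₂; Pₓ is its part in the subtree of v₁ together
  -- with one more vertex on each side. The ends of Pₓ are thus outside that subtree, which is
  -- what makes the pear tree clean.
  module Assemble {P : Path G} {v₀} (K₀ : Pocket v₀) (guards₀ : Guards K₀ (verts P))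
    {v₁ v₂} (v₁-in : ∀ {z} → v₁ ⊑ z → Pocket.U K₀ z) (apart : ∀ {z} → v₁ ⊑ z → v₂ ⋢ z)
    (v₂-in : ∀ {z} → v₂ ⊑ z → Pocket.U K₀ z)
    where
    open Pocket K₀ using (q; U; A; q∉U) renaming (v⊑q to v₀⊑q)
    open Guards guards₀ using () renaming (q∈ to q∈P; avoids to P∌U)

    K₁ K₂ : Pred (V G) 0ℓ
    K₁ z = ((U z × v₂ ⋢ z) ⊎ z ≡ q) × v₁ ⋢ z
    K₂ z = ((U z × v₂ ⋢ z) ⊎ A z) × v₁ ⋢ z

    U⇒region : ∀ {z} → U z → v₀ ⊑ z
    U⇒region Uz = ⊑-trans v₀⊑q (Pocket.U⇒below K₀ Uz)

    -- The parts of the two disjoint walks outside the subtree of `v₁`. They begin one edge away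
    -- from `x₁` and `x₂`, so either foot can be exchanged without touching the closing path below
    -- `v₁`.
    record Prongs (x₁ x₂ : V G) : Set where
      field
        {y₁ y₂ m} : V G
        {k₁ k₂} : List (V G)
        edge₁ : E G x₁ y₁
        edge₂ : E G x₂ y₂
        walk₁ : Walk y₁ k₁ q
        walk₂ : Walk y₂ k₂ m
        unique₁ : Unique k₁
        unique₂ : Unique k₂
        in₁ : ∀ {z} → z ∈ k₁ → K₁ z
        in₂ : ∀ {z} → z ∈ k₂ → K₂ z × (z ∈ verts P → z ≡ m)
        disjoint : ∀ {z} → z ∈ k₁ → z ∉ k₂
        m∈P : m ∈ verts P

    module _ {x₁ x₂} (prongs : Prongs x₁ x₂) {n} {K : Pocket v₁} (big : Big n (Pocket.u K))
      (path : Guarding K x₁ x₂) where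
      open Prongs prongs
      L = proj₁ path

      L-walk : Walk x₁ L x₂
      L-walk = proj₁ (proj₂ path)
      L-in : ∀ {z} → z ∈ L → v₁ ⊑ z
      L-in = proj₁ (proj₂ (proj₂ (proj₂ path)))
      L-guards : Guards K L
      L-guards = proj₂ (proj₂ (proj₂ (proj₂ path)))
      L-unique : Unique L
      L-unique = proj₁ (proj₂ (proj₂ path))

      last-snoc : ∀ {a vs b} → Walk a vs b → ∃ λ us → vs ≡ us ++ b ∷ []
      last-snoc {a} stop = [] , refl
      last-snoc {a} (e ► w) with us , eq ← last-snoc w = a ∷ us , cong (a ∷_) eq
      first-cons : ∀ {a vs b} → Walk a vs b → ∃ λ us → vs ≡ a ∷ us
      first-cons stop = [] , refl
      first-cons (e ► w) = _ , refl

      y₁∈ : y₁ ∈ k₁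
      y₁∈ = start∈ walk₁
      y₂∈ : y₂ ∈ k₂
      y₂∈ = start∈ walk₂

      -- The path `P` misses `U`, so `m` can only come from `A`. This makes the ends `q` and `m` of
      -- the ear different.
      m-in-A : A m
      m-in-A with in₂ (end∈ walk₂)
      ... | (inj₁ (Um , _) , _) , _ = ⊥-elim (P∌U m∈P Um)
      ... | (inj₂ Am , _) , _ = Am

      pVs : List (V G)
      pVs = y₁ ∷ L ++ y₂ ∷ []
      pWalk : Walk y₁ pVs y₂
      pWalk = E-sym edge₁ ► join L-walk edge₂ stop
      pUnique : Unique pVs
      pUnique = unique-∷
        (λ y∈ → [ (λ y∈L → proj₂ (in₁ y₁∈) (L-in y∈L))
                , (λ { (here refl) → disjoint y₁∈ y₂∈ }) ]′ (∈-++⁻ L y∈))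
        (Uniqueₚ.++⁺ L-unique ([] ∷ [])
          λ { (z∈L , here refl) → proj₂ (proj₁ (in₂ y₂∈)) (L-in z∈L) })

      rev₁ = reversed walk₁ unique₁
      h₁ : List (V G)
      h₁ = proj₁ rev₁
      h₁⊆ : ∀ {z} → z ∈ h₁ → z ∈ k₁
      h₁⊆ = proj₁ (proj₂ (proj₂ (proj₂ rev₁)))
      qVs : List (V G)
      qVs = h₁ ++ L ++ k₂
      qWalk : Walk q qVs m
      qWalk = join (proj₁ (proj₂ rev₁)) (E-sym edge₁) (join L-walk edge₂ walk₂)
      qUnique : Unique qVs
      qUnique = Uniqueₚ.++⁺ (proj₁ (proj₂ (proj₂ rev₁)))
        (Uniqueₚ.++⁺ L-unique unique₂ λ (z∈L , z∈k) → proj₂ (proj₁ (in₂ z∈k)) (L-in z∈L))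
        λ (z∈h , z∈) → [ (λ z∈L → proj₂ (in₁ (h₁⊆ z∈h)) (L-in z∈L))
                       , disjoint (h₁⊆ z∈h) ]′ (∈-++⁻ L z∈)

      q-cases : ∀ {z} → z ∈ qVs → z ∈ k₁ ⊎ z ∈ L ⊎ z ∈ k₂
      q-cases z∈ with ∈-++⁻ h₁ z∈
      ... | inj₁ z∈h = inj₁ (h₁⊆ z∈h)
      ... | inj₂ z∈′ = inj₂ (∈-++⁻ L z∈′)

      shape : ∃₂ λ ls rs → qVs ≡ ls ++ pVs ++ rs
      shape with ls , eq ← last-snoc (proj₁ (proj₂ rev₁)) | rs , eq′ ← first-cons walk₂ =
        ls , rs , trans (cong (_++ L ++ k₂) eq) (trans (++-assoc ls (y₁ ∷ []) (L ++ k₂))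
          (cong (λ xs → ls ++ y₁ ∷ xs)
            (trans (cong (L ++_) eq′) (sym (++-assoc L (y₂ ∷ []) rs)))))

      assembled : Pear P K₀ v₁ v₂ n
      assembled
        with Pₓ , eqP , refl , refl ← walk⇒path pWalk pUnique (λ { refl → disjoint y₁∈ y₂∈ })
           | Qₓ , eqQ , refl , refl ← walk⇒path qWalk qUnique (λ { refl → proj₁ (proj₂ m-in-A) refl })
           | ls , rs , eq ← shape
        = record
          { Pₓ = Pₓ ; Qₓ = Qₓ
          ; P⊆Q = subPath Pₓ Qₓ ls rs (trans eqQ (trans eq (cong (λ vs → ls ++ vs ++ rs) (sym eqP))))
          ; P-long = long-path Pₓ (recast (sym eqP) (there (∈-++⁺ˡ x₁∈)))
              (λ { refl → proj₂ (in₁ y₁∈) (L-in x₁∈) })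
              (λ { refl → proj₂ (proj₁ (in₂ y₂∈)) (L-in x₁∈) })
          ; Q-long = long-path Qₓ (recast (sym eqQ) (∈-++⁺ʳ h₁ (∈-++⁺ˡ x₁∈)))
              (λ { refl → proj₂ (in₁ (end∈ walk₁)) (L-in x₁∈) })
              (λ { refl → proj₂ (proj₁ (in₂ (end∈ walk₂))) (L-in x₁∈) })
          ; ear = q∈P , m∈P , λ z z∈ z∈P →
              let z∈Q , z≢q , z≢m = inner-props Qₓ z∈ in
              [ (λ z∈k → case in₁ z∈k of λ { (inj₁ (Uz , _) , _) → P∌U z∈P Uz
                                           ; (inj₂ z≡q , _) → z≢q z≡q })
              , [ (λ z∈L → P∌U z∈P (v₁-in (L-in z∈L)))
                , (λ z∈k → z≢m (proj₂ (in₂ z∈k) z∈P)) ]′ ]′ (q-cases (recast eqQ z∈Q))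
          ; P-inner = λ z∈ → let z∈P , z≢y₁ , z≢y₂ = inner-props Pₓ z∈ in
              case recast eqP z∈P of λ
                { (here z≡) → ⊥-elim (z≢y₁ z≡)
                ; (there z∈′) → [ L-in , (λ { (here z≡) → ⊥-elim (z≢y₂ z≡) }) ]′ (∈-++⁻ L z∈′) }
          ; Q-region = λ z∈ →
              [ (λ z∈k → case in₁ z∈k of λ { (inj₁ (Uz , _) , _) → U⇒region Uz
                                           ; (inj₂ refl , _) → v₀⊑q })
              , [ (λ z∈L → U⇒region (v₁-in (L-in z∈L)))
                , (λ z∈k → case proj₁ (in₂ z∈k) of λ
                    { (inj₁ (Uz , _) , _) → U⇒region Uz ; (inj₂ (r , _) , _) → r }) ]′ ]′
              (q-cases (recast eqQ z∈))
          ; Q-pocket = λ z∈ v₁⊑z → recast (sym eqP)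
              ([ (λ z∈k → ⊥-elim (proj₂ (in₁ z∈k) v₁⊑z))
               , [ there ∘ ∈-++⁺ˡ , (λ z∈k → ⊥-elim (proj₂ (proj₁ (in₂ z∈k)) v₁⊑z)) ]′ ]′
              (q-cases (recast eqQ z∈)))
          ; Q-avoids = λ z∈ v₂⊑z →
              [ (λ z∈k → case in₁ z∈k of λ { (inj₁ (_ , n) , _) → n v₂⊑z
                                           ; (inj₂ refl , _) → q∉U (v₂-in v₂⊑z) })
              , [ (λ z∈L → apart (L-in z∈L) v₂⊑z)
                , (λ z∈k → case proj₁ (in₂ z∈k) of λ
                    { (inj₁ (_ , n) , _) → n v₂⊑z
                    ; (inj₂ (_ , _ , ¬U) , _) → ¬U (v₂-in v₂⊑z) }) ]′ ]′
              (q-cases (recast eqQ z∈))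
          ; site = record
              { pocket = K
              ; guards = guards-⊆ {K = K} (λ z∈ → recast (sym eqP) (there (∈-++⁺ˡ z∈)))
                  (λ z∈ Uz → case recast eqP z∈ of λ
                    { (here refl) → proj₂ (in₁ y₁∈) (in-v₁ Uz)
                    ; (there z∈′) → [ (λ z∈L → Guards.avoids L-guards z∈L Uz)
                        , (λ { (here refl) → proj₂ (proj₁ (in₂ y₂∈)) (in-v₁ Uz) }) ]′ (∈-++⁻ L z∈′) })
                  L-guards
              ; big = big
              ; outer = _ , inj₁ refl , proj₂ (in₁ y₁∈) }
          ; site-v = refl }
        where
        x₁∈ : x₁ ∈ L
        x₁∈ = start∈ L-walk
        in-v₁ : ∀ {z} → Pocket.U K z → v₁ ⊑ z
        in-v₁ Uz = ⊑-trans (Pocket.v⊑q K) (Pocket.U⇒below K Uz)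

-- One generation of ears

module Growing {G : Graph} (tree : SpanningBinaryTree G)
  (no-cut : ∀ x → ConnectedSet G (λ v → v ≢ x)) {M : Set} (ℓ : ℕ)
  (gap : ∀ {a c h} → a ≢ Tree.root tree → Tree._⊑_ tree a c → Tree.Big tree (ℓ + h) c →
    M ⊎ ∃ λ z → Tree._⊑_ tree c z × Tree.Big tree h z × ¬ Pockets.HasExit tree a z)
  where
  open Walks G
  open Tree tree
  open Pockets tree
  open Sites tree

  below-child≢root : ∀ {c p x} → Ch c p → c ⊑ x → x ≢ root
  below-child≢root ch self refl = root-top ch
  below-child≢root ch (down _ d) refl = root-top d

  -- Since edges from the subtree of `v` stay below `c`, a walk that enters this subtree can be led
  -- around it below `c`.
  record Nest (c : V G) (h : ℕ) : Set where
    field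
      {v l r} : V G
      c⊑v : c ⊑ v
      no-exit-v : ¬ HasExit c v
      l-child : Ch l v
      r-child : Ch r v
      l≢r : l ≢ r
      l-big : Big h l
      r-big : Big h r

  nest : ∀ {c h} → c ≢ root → Big (ℓ + suc h) c → M ⊎ Nest c h
  nest c≢ B with gap c≢ self B
  ... | inj₁ m = inj₁ m
  ... | inj₂ (z , c⊑z , Bz , n) with mkBranching z⊑a lc rc l≢r L R ← branching Bz = inj₂ record
    { c⊑v = ⊑-trans c⊑z z⊑a ; no-exit-v = no-exit-below z⊑a n
    ; l-child = lc ; r-child = rc ; l≢r = l≢r ; l-big = L ; r-big = R }

  record Forked (v f : V G) (n : ℕ) : Set₁ where
    field
      pocket : Pocket v
      big : Big n (Pocket.u pocket)
      outcome : Guarding pocket v f ⊎ Exiting pocket f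

  -- The pocket goes into a child of `v` that is not above `f`. Because `f` comes out of the
  -- disjoint walks only after `v` is fixed, both children have to be big.
  fork : ∀ {v l r f n} → v ≢ root → Ch l v → Ch r v → l ≢ r → Big (ℓ + n) l → Big (ℓ + n) r →
    v ⊑ f → f ≢ v → M ⊎ Forked v f n
  fork {v} {l} {r} {f} v≢ lc rc l≢r L R v⊑f f≢v with towards v⊑f (≢-sym f≢v)
  ... | d , dc , d⊑f with d ≟ l
  ...   | yes refl with gap v≢ (child⇒⊑ rc) R
  ...     | inj₁ m = inj₁ m
  ...     | inj₂ (z , r⊑z , B , n) with K , u⊑z , o ← Pick.pick lc rc l≢r d⊑f r⊑z n =
    inj₂ record { pocket = K ; big = big-up u⊑z B ; outcome = o }
  fork {v} {l} {r} {f} v≢ lc rc l≢r L R v⊑f f≢v | d , dc , d⊑f | no d≢l with gap v≢ (child⇒⊑ lc) L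
  ...     | inj₁ m = inj₁ m
  ...     | inj₂ (z , l⊑z , B , n) with K , u⊑z , o ← Pick.pick dc lc d≢l d⊑f l⊑z n =
    inj₂ record { pocket = K ; big = big-up u⊑z B ; outcome = o }

  module Half {P : Path G} {v₀} (K₀ : Pocket v₀) (guards₀ : Guards K₀ (verts P))
    {a c₁ c₂} (ch₁ : Ch c₁ a) (ch₂ : Ch c₂ a) (c₁≢c₂ : c₁ ≢ c₂)
    (u⊑c₁ : Pocket.u K₀ ⊑ c₁) (u⊑c₂ : Pocket.u K₀ ⊑ c₂)
    {n h₂} (N₁ : Nest c₁ (ℓ + n)) (N₂ : Nest c₂ h₂)
    where
    open Nest N₁ using () renaming (v to v₁; c⊑v to c₁⊑v₁; no-exit-v to no-exit₁)
    open Nest N₂ using () renaming (v to v₂; c⊑v to c₂⊑v₂; no-exit-v to no-exit₂)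
    open Pocket K₀
    open Guards guards₀ using () renaming (avoids to P∌U; return to return₀; some to some₀)

    v₁-in : ∀ {z} → v₁ ⊑ z → U z
    v₁-in s = below-u (⊑-trans u⊑c₁ (⊑-trans c₁⊑v₁ s))
    v₂-in : ∀ {z} → v₂ ⊑ z → U z
    v₂-in s = below-u (⊑-trans u⊑c₂ (⊑-trans c₂⊑v₂ s))
    c-apart : ∀ {z} → c₁ ⊑ z → c₂ ⋢ z
    c-apart = siblings-disjoint ch₁ ch₂ c₁≢c₂
    apart : ∀ {z} → v₁ ⊑ z → v₂ ⋢ z
    apart s t = c-apart (⊑-trans c₁⊑v₁ s) (⊑-trans c₂⊑v₂ t)
    q⊑u : q ⊑ u
    q⊑u = child⇒⊑ u-child
    q⊑v₁ : q ⊑ v₁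
    q⊑v₁ = ⊑-trans q⊑u (⊑-trans u⊑c₁ c₁⊑v₁)

    open Assemble {P = P} K₀ guards₀ v₁-in apart v₂-in

    on-chain : ∀ {z} → q ⊑ z → z ⊑ v₁ → U z ⊎ z ≡ q
    on-chain {z} q⊑z z⊑v₁ with z ≟ q
    ... | yes eq = inj₂ eq
    ... | no z≢q with d , chd , d⊑z ← towards q⊑z (≢-sym z≢q) with d ≟ u
    ...   | yes refl = inj₁ (below-u d⊑z)
    ...   | no d≢u = ⊥-elim (siblings-disjoint chd u-child d≢u
                      (⊑-trans d⊑z z⊑v₁) (⊑-trans u⊑c₁ c₁⊑v₁))

    Al : Pred (V G) 0ℓ
    Al z = U z × v₂ ⋢ z

    X⊆Al : ∀ {z} → v₁ ⊑ z → Al z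
    X⊆Al s = v₁-in s , apart s

    Al-closed : ∀ {c d} → Al c → E G c d → v₂ ⋢ d → Al d ⊎ d ≡ q ⊎ A d
    Al-closed {d = d} (Uc , _) e ¬Z with d ≟ q | U? d
    ... | yes eq | _       = inj₂ (inj₁ eq)
    ... | no d≢q | yes Ud  = inj₁ (Ud , ¬Z)
    ... | no d≢q | no ¬Ud  = inj₂ (inj₂ (closed Uc e , d≢q , ¬Ud))

    open TwoLinks G {X = v₁ ⊑_} {A = A} {Al = Al} {Z = v₂ ⊑_} (v₁ ⊑?_) A? X⊆Al q Al-closed

    -- `G - s` is connected. A walk in it may cross the subtree of `v₂`, but the neighbours of that
    -- subtree lie below `c₂`, and the remainder of the subtree of `c₂` is held together by `c₂` and
    -- does not contain `s`, which is an ancestor of `v₁`.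
    escape : ∀ {s} → q ⊑ s → s ⊑ v₁ → Escape s
    escape {s} q⊑s s⊑v₁ with a₀ , Aa@(_ , a₀≢q , ¬Ua₀) ← some₀ = run
      where
      a₀≢s : a₀ ≢ s
      a₀≢s refl = [ ¬Ua₀ , a₀≢q ]′ (on-chain q⊑s s⊑v₁)
      from : ∀ {b} → b ≢ s → v₁ ⊑ b → Escape s
      from {b} b≢s v₁⊑b = b , a₀ , v₁⊑b , Aa ,
        Avoiding.avoiding G (v₂ ⊑?_)
          (λ v₂⊑x e _ → no-exit no-exit₂ v₂⊑x e)
          (λ C ¬Z C′ ¬Z′ → side C ¬Z ⊙ reverse-in (side C′ ¬Z′))
          (reach⇒walk b≢s a₀≢s (no-cut s b a₀ b≢s a₀≢s)) (apart v₁⊑b) (λ v₂⊑a₀ → ¬Ua₀ (v₂-in v₂⊑a₀))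
        where
        side : ∀ {g} → c₂ ⊑ g → v₂ ⋢ g → WalkIn (λ z → z ≢ s × v₂ ⋢ z) g c₂
        side c₂⊑g v₂⋢g = weaken (λ (p , r) →
          (λ { refl → c-apart c₁⊑v₁ (⊑-trans p s⊑v₁) }) , λ v₂⊑z → v₂⋢g (⊑-trans v₂⊑z r)) (up c₂⊑g)
      run : Escape s
      run with s ≟ v₁
      ... | yes refl = from (λ { refl → child-⋢ (Nest.l-child N₁) self }) (child⇒⊑ (Nest.l-child N₁))
      ... | no s≢v₁ = from (≢-sym s≢v₁) self

    links : Links v₁ q []
    links with vs , w , uq , vs⊆ , _ ← ascent q⊑v₁ = go w uq vs⊆
      where
      go : ∀ {vs} → Walk v₁ vs q → Unique vs → (∀ {z} → z ∈ vs → q ⊑ z × z ⊑ v₁) → Links v₁ q []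
      go stop uq vs⊆ = ⊥-elim (q∉U (v₁-in self))
      go w@(_ ► _) uq vs⊆ = two-links (λ { s (_ , _ , ¬U) → ¬U (v₁-in s) }) self w uq
        (λ z∈ → let s , t = vs⊆ (there z∈) in
          [ (λ Uz → inj₁ (Uz , λ v₂⊑z → apart self (⊑-trans v₂⊑z t))) , inj₂ ]′ (on-chain s t)
          , λ v₁⊑z → unique-∉ uq (subst (_∈ _) (⊑-antisym t v₁⊑z) z∈))
        (λ z∈ → let s , t = vs⊆ z∈ in escape s t)

    prong : ∀ {x₁ x₂ y₁ y₂ m} {S₁ S₂ : Pred (V G) 0ℓ} →
      E G x₁ y₁ → E G x₂ y₂ → WalkIn S₁ y₁ q → WalkIn S₂ y₂ m →
      (∀ {z} → S₁ z → K₁ z) → (∀ {z} → S₂ z → K₂ z × (z ∈ verts P → z ≡ m)) →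
      (∀ {z} → S₁ z → ¬ S₂ z) → m ∈ verts P → Prongs x₁ x₂
    prong e₁ e₂ w₁ w₂ f₁ f₂ dis m∈ with k₁ , r₁ , u₁ , s₁ ← simple-in w₁
                                      | k₂ , r₂ , u₂ , s₂ ← simple-in w₂ = record
      { edge₁ = e₁ ; edge₂ = e₂ ; walk₁ = r₁ ; walk₂ = r₂ ; unique₁ = u₁ ; unique₂ = u₂
      ; in₁ = f₁ ∘ All.lookup s₁ ; in₂ = f₂ ∘ All.lookup s₂
      ; disjoint = λ z∈ z∈′ → dis (All.lookup s₁ z∈) (All.lookup s₂ z∈′) ; m∈P = m∈ }

    module _ (L : Links v₁ q []) where
      open Links L

      S₁ S₂ : Pred (V G) 0ℓ
      S₁ z = z ∈ vs₁ × v₁ ⋢ z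
      S₂ z = (z ∈ vs₂ ⊎ A z) × v₁ ⋢ z

      v₁⋢q : v₁ ⋢ q
      v₁⋢q s = q∉U (v₁-in s)

      A-apart : ∀ {z} → A z → v₁ ⋢ z
      A-apart (_ , _ , ¬U) s = ¬U (v₁-in s)

      Al₂ : ∀ {z} → z ∈ vs₂ → Al z
      Al₂ z∈ with proj₁ (ok₂ z∈)
      ... | inj₁ al = al
      ... | inj₂ refl = ⊥-elim (disjoint (end∈ walk₁) z∈)

      leave₁ : ∃ λ y → E G x₁ y × WalkIn S₁ y q
      leave₁ with last-visit (v₁ ⊑?_) (vs₁ , walk₁ , All.tabulate id) v₁⋢q
      ... | inj₁ (¬X , _) = ⊥-elim (¬X X₁)
      -- The walk meets the subtree of `v₁` only in `x₁`, so the last visit is there.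
      ... | inj₂ (x , y , x∈ , Xx , e , r) with refl ← proj₂ (proj₂ (ok₁ x∈)) Xx = y , e , r

      leave₂ : ∃₂ λ y m → E G x₂ y × WalkIn S₂ y m × m ∈ verts P
      leave₂ with target
      ... | inj₂ Aw with m , m∈ , r ← return₀ Aw
        with last-visit (v₁ ⊑?_) (join-in {S = λ z → z ∈ vs₂ ⊎ A z}
               (vs₂ , walk₂ , All.tabulate inj₁) edge (weaken inj₂ r)) (A-apart (walkIn-end r))
      ...   | inj₁ (¬X , _) = ⊥-elim (¬X X₂)
      ...   | inj₂ (x , y , inj₂ Ax , Xx , _) = ⊥-elim (A-apart Ax Xx)
      ...   | inj₂ (x , y , inj₁ x∈ , Xx , e , r′) with refl ← proj₂ (proj₂ (ok₂ x∈)) Xx =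
        y , m , e , r′ , m∈

      S₁⇒K₁ : ∀ {z} → S₁ z → K₁ z
      S₁⇒K₁ (z∈ , n) = proj₁ (ok₁ z∈) , n

      S₂⇒K₂ : ∀ {z} → S₂ z → K₂ z
      S₂⇒K₂ (inj₁ z∈ , n) = inj₁ (Al₂ z∈) , n
      S₂⇒K₂ (inj₂ Az , n) = inj₂ Az , n

      S-disjoint : ∀ {z} → S₁ z → ¬ S₂ z
      S-disjoint (z∈ , _) (inj₁ z∈′ , _) = disjoint z∈ z∈′
      S-disjoint (z∈ , _) (inj₂ (_ , z≢q , ¬U) , _) with proj₁ (ok₁ z∈)
      ... | inj₁ (Uz , _) = ¬U Uz
      ... | inj₂ z≡q = z≢q z≡q

      prongs : Prongs x₁ x₂
      prongs with y₁ , e₁ , r₁ ← leave₁ | y₂ , m , e₂ , r₂ , m∈ ← leave₂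
        with first-visit (_∈? verts P) r₂ m∈
      ... | inj₁ y₂∈ = prong e₁ e₂ r₁ (here-walk {S = λ z → S₂ z × z ≡ y₂} (walkIn-start r₂ , refl))
              S₁⇒K₁ (λ (s , z≡) → S₂⇒K₂ s , λ _ → z≡) (λ s (s′ , _) → S-disjoint s s′) y₂∈
      ... | inj₂ (n′ , x , r , f , x∈ , Sx) = prong e₁ e₂ r₁
              (join-in {S = λ z → S₂ z × (z ∈ verts P → z ≡ x)}
                (weaken (λ (s , z∉) → s , λ z∈ → ⊥-elim (z∉ z∈)) r) f (here-walk (Sx , λ _ → refl)))
              S₁⇒K₁ (λ (s , z≡) → S₂⇒K₂ s , z≡) (λ s (s′ , _) → S-disjoint s s′) x∈

    -- All vertices on the climb are ancestors of `w`, so none of them is below `v₁`; up to `c₁` the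
    -- climb is apart from `c₂`, and above it there is nothing below `v₂`.
    home : ∀ {w} → c₁ ⊑ w → v₁ ⋢ w → WalkIn K₁ w q
    home c₁⊑w v₁⋢w =
      weaken (λ (s , t) → inj₁ (below-u (⊑-trans u⊑c₁ s) , λ v₂⊑z → c-apart s (⊑-trans c₂⊑v₂ v₂⊑z))
                        , λ v₁⊑z → v₁⋢w (⊑-trans v₁⊑z t)) (up c₁⊑w)
      ⊙ weaken (λ (s , t) → [ (λ Uz → inj₁ (Uz , λ v₂⊑z → c-apart self (⊑-trans c₂⊑v₂ (⊑-trans v₂⊑z t)))) , inj₂ ]′
                              (on-chain s (⊑-trans t c₁⊑v₁))
                          , λ v₁⊑z → v₁⋢w (⊑-trans (⊑-trans v₁⊑z t) c₁⊑w))
          (up (⊑-trans q⊑u u⊑c₁))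

    -- The exit edge is continued towards q outside the subtree of v₁ until it meets one of the two
    -- prongs, whose beginning it then replaces.
    reroute : ∀ {x₁ x₂ f w} → Prongs x₁ x₂ → v₁ ⊑ f → v₁ ⋢ w → E G f w →
      Prongs f x₂ ⊎ Prongs x₁ f
    reroute {f = f} {w} pr v₁⊑f v₁⋢w e = go (first-visit (λ z → (z ∈? k₁) ⊎-dec (z ∈? k₂))
        (home (no-exit no-exit₁ v₁⊑f e) v₁⋢w) (inj₁ (end∈ walk₁)))
      where
      open Prongs pr
      Free : Pred (V G) 0ℓ
      Free z = K₁ z × ¬ (z ∈ k₁ ⊎ z ∈ k₂)

      free-U : ∀ {z} → Free z → U z × v₂ ⋢ z
      free-U ((inj₁ s , _) , _) = s
      free-U ((inj₂ refl , _) , n) = ⊥-elim (n (inj₁ (end∈ walk₁)))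

      via₁ : WalkIn (λ z → Free z ⊎ z ∈ k₁) w q → Prongs f _
      via₁ r = prong {S₂ = _∈ k₂} e edge₂ r (k₂ , walk₂ , All.tabulate id)
        [ proj₁ , in₁ ]′ in₂ [ (λ (_ , n) z∈ → n (inj₂ z∈)) , disjoint ]′ m∈P
      via₂ : WalkIn (λ z → Free z ⊎ z ∈ k₂) w m → Prongs _ f
      via₂ r = prong {S₁ = _∈ k₁} edge₁ e (k₁ , walk₁ , All.tabulate id) r
        in₁ [ (λ s → (inj₁ (free-U s) , proj₂ (proj₁ s)) , λ z∈ → ⊥-elim (P∌U z∈ (proj₁ (free-U s)))) , in₂ ]′
        (λ z∈ → [ (λ (_ , n) → n (inj₁ z∈)) , disjoint z∈ ]′) m∈P
      tail₁ : ∀ {x} → x ∈ k₁ → WalkIn (λ z → Free z ⊎ z ∈ k₁) x q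
      tail₁ x∈ with us , r , us⊆ , _ ← suffix walk₁ x∈ = us , r , All.tabulate (inj₂ ∘ us⊆)
      tail₂ : ∀ {x} → x ∈ k₂ → WalkIn (λ z → Free z ⊎ z ∈ k₂) x m
      tail₂ x∈ with us , r , us⊆ , _ ← suffix walk₂ x∈ = us , r , All.tabulate (inj₂ ∘ us⊆)

      go : _ → Prongs f _ ⊎ Prongs _ f
      go (inj₁ (inj₁ w∈)) = inj₁ (via₁ (tail₁ w∈))
      go (inj₁ (inj₂ w∈)) = inj₂ (via₂ (tail₂ w∈))
      go (inj₂ (m′ , x , r , g , inj₁ x∈ , _)) = inj₁ (via₁ (join-in (weaken inj₁ r) g (tail₁ x∈)))
      go (inj₂ (m′ , x , r , g , inj₂ x∈ , _)) = inj₂ (via₂ (join-in (weaken inj₁ r) g (tail₂ x∈)))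

    v₁≢root : v₁ ≢ root
    v₁≢root = below-child≢root u-child (⊑-trans u⊑c₁ c₁⊑v₁)

    half : M ⊎ Pear P K₀ v₁ v₂ n
    half = go links
      where
      open Nest N₁ using (l-child; r-child; l≢r; l-big; r-big)
      finish : ∀ {x₁ x₂ f} → Prongs x₁ x₂ → (v₁ ≡ x₁ × x₂ ≡ f ⊎ v₁ ≡ x₂ × x₁ ≡ f) →
        Forked v₁ f n → Pear P K₀ v₁ v₂ n
      finish pr s record { pocket = K ; big = B ; outcome = inj₁ g } with s
      ... | inj₁ (refl , refl) = assembled pr B g
      ... | inj₂ (refl , refl) = assembled pr B (turn {K = K} g)
      -- The exit edge takes the place of one foot, and the closing path joins `f′` to the other
      -- foot, which is `v₁` or `f` according to `s`.
      finish {x₁} {x₂} {f} pr s record { pocket = K ; big = B ; outcome = inj₂ ex }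
        with reroute pr v⊑f′ v⋢w edge
        where open Exiting ex
      ... | inj₁ pr′ = assembled pr′ B (turn {K = K} (Exiting.guarding ex (port₂ s)))
        where
        port₂ : (v₁ ≡ x₁ × x₂ ≡ f ⊎ v₁ ≡ x₂ × x₁ ≡ f) → x₂ ≡ v₁ ⊎ x₂ ≡ f
        port₂ (inj₁ (_ , eq)) = inj₂ eq
        port₂ (inj₂ (eq , _)) = inj₁ (sym eq)
      ... | inj₂ pr′ = assembled pr′ B (Exiting.guarding ex (port₁ s))
        where
        port₁ : (v₁ ≡ x₁ × x₂ ≡ f ⊎ v₁ ≡ x₂ × x₁ ≡ f) → x₁ ≡ v₁ ⊎ x₁ ≡ f
        port₁ (inj₁ (eq , _)) = inj₁ (sym eq)
        port₁ (inj₂ (_ , eq)) = inj₂ eq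

      go : Links v₁ q [] → M ⊎ Pear P K₀ v₁ v₂ n
      go L with Links.v≡ L
      ... | inj₁ refl with fork v₁≢root l-child r-child l≢r l-big r-big
                             (Links.X₂ L) (≢-sym (Links.x₁≢x₂ L))
      ...   | inj₁ mn = inj₁ mn
      ...   | inj₂ F = inj₂ (finish (prongs L) (inj₁ (refl , refl)) F)
      go L | inj₂ refl with fork v₁≢root l-child r-child l≢r l-big r-big
                             (Links.X₁ L) (Links.x₁≢x₂ L)
      ...   | inj₁ mn = inj₁ mn
      ...   | inj₂ F = inj₂ (finish (prongs L) (inj₂ (refl , refl)) F)

  record Twins {P : Path G} {n} (S : Site P n) (n′ : ℕ) : Set₁ where
    field
      {v₁ v₂} : V G
      pear₁ : Pear P (Site.pocket S) v₁ v₂ n′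
      pear₂ : Pear P (Site.pocket S) v₂ v₁ n′
      in₁ : ∀ {z} → v₁ ⊑ z → Pocket.U (Site.pocket S) z
      in₂ : ∀ {z} → v₂ ⊑ z → Pocket.U (Site.pocket S) z
      apart : ∀ {z} → v₁ ⊑ z → v₂ ⋢ z

  grow : ∀ {P : Path G} {n} (S : Site P (suc (ℓ + suc (ℓ + n)))) → M ⊎ Twins S n
  grow {P} S with mkBranching u⊑a lc rc l≢r L R ← branching (Site.big S)
    with nest (below-child≢root lc self) L | nest (below-child≢root rc self) R
  ... | inj₁ m | _ = inj₁ m
  ... | inj₂ _ | inj₁ m = inj₁ m
  ... | inj₂ N₁ | inj₂ N₂ = result
    where
    u⊑l = ⊑-trans u⊑a (child⇒⊑ lc)
    u⊑r = ⊑-trans u⊑a (child⇒⊑ rc)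
    module H = Half {P = P} (Site.pocket S) (Site.guards S) lc rc l≢r u⊑l u⊑r N₁ N₂
    module H′ = Half {P = P} (Site.pocket S) (Site.guards S) rc lc (≢-sym l≢r) u⊑r u⊑l N₂ N₁
    result : M ⊎ Twins S _
    result with H.half | H′.half
    ... | inj₁ m | _ = inj₁ m
    ... | inj₂ _ | inj₁ m = inj₁ m
    ... | inj₂ p₁ | inj₂ p₂ = inj₂ record
      { pear₁ = p₁ ; pear₂ = p₂ ; in₁ = H.v₁-in ; in₂ = H.v₂-in ; apart = H.apart }

  -- One generation costs two descents by ℓ branchings to a subtree without exits, and two single
  -- branchings.
  need : ℕ → ℕ
  need zero    = 0
  need (suc h) = suc (ℓ + suc (ℓ + need h))

  -- Gluing the generations into a pear tree

  record Grown (P₀ Q₀ : Path G) (v : V G) (t : BTree) : Set where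
    field
      B : PearData G t
      root-P : P B here ≡ P₀
      root-Q : Q B here ≡ Q₀
      isPear : IsPearTree G t B
      clean : Clean G t B
      region : ∀ {x} → x ≢ here → ∀ {z} → z ∈ verts (Q B x) → v ⊑ z

  module Node {P₀ Q₀ : Path G} {n n′} (S : Site P₀ n) (T : Twins S n′)
    (P-long : 2 ≤ pathLength P₀) (Q-long : 2 ≤ pathLength Q₀) (P⊆Q : SubPath P₀ Q₀)
    (pocket-Q : ∀ {z} → z ∈ verts Q₀ → Site.v S ⊑ z → z ∈ verts P₀) {l r}
    (L : Grown (Pear.Pₓ (Twins.pear₁ T)) (Pear.Qₓ (Twins.pear₁ T)) (Twins.v₁ T) l)
    (R : Grown (Pear.Pₓ (Twins.pear₂ T)) (Pear.Qₓ (Twins.pear₂ T)) (Twins.v₂ T) r)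
    where
    open Twins T
    open Site S using (v; pocket; guards; outer)
    module L = Grown L
    module R = Grown R
    module p₁ = Pear pear₁
    module p₂ = Pear pear₂

    B : PearData G (node2 l r)
    B = record { P = pick-P ; Q = pick-Q }
      where
      pick-P pick-Q : Pos (node2 l r) → Path G
      pick-P here    = P₀
      pick-P (inL x) = P L.B x
      pick-P (inR x) = P R.B x
      pick-Q here    = Q₀
      pick-Q (inL x) = Q L.B x
      pick-Q (inR x) = Q R.B x

    here? : ∀ {t} (x : Pos t) → Dec (x ≡ here)
    here? here    = yes refl
    here? (in1 x) = no λ ()
    here? (inL x) = no λ ()
    here? (inR x) = no λ ()

    child≢here : ∀ {t} {x y : Pos t} → ChildOf x y → x ≢ here
    child≢here c1     ()
    child≢here cL     ()
    child≢here cR     ()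
    child≢here (s1 _) ()
    child≢here (sL _) ()
    child≢here (sR _) ()

    U⇒v : ∀ {z} → Pocket.U pocket z → v ⊑ z
    U⇒v Uz = ⊑-trans (Pocket.v⊑q pocket) (Pocket.U⇒below pocket Uz)

    U⇒∉Q : ∀ {z} → Pocket.U pocket z → z ∉ verts Q₀
    U⇒∉Q Uz z∈ = Guards.avoids guards (pocket-Q z∈ (U⇒v Uz)) Uz

    regionL : ∀ x {z} → z ∈ verts (Q L.B x) → v ⊑ z
    regionL x z∈ with here? x
    ... | yes refl = p₁.Q-region (subst (λ q → _ ∈ verts q) L.root-Q z∈)
    ... | no x≢ = U⇒v (in₁ (L.region x≢ z∈))
    regionR : ∀ x {z} → z ∈ verts (Q R.B x) → v ⊑ z
    regionR x z∈ with here? x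
    ... | yes refl = p₂.Q-region (subst (λ q → _ ∈ verts q) R.root-Q z∈)
    ... | no x≢ = U⇒v (in₂ (R.region x≢ z∈))

    avoidsL : ∀ x {z} → z ∈ verts (Q L.B x) → v₂ ⋢ z
    avoidsL x z∈ with here? x
    ... | yes refl = p₁.Q-avoids (subst (λ q → _ ∈ verts q) L.root-Q z∈)
    ... | no x≢ = apart (L.region x≢ z∈)
    avoidsR : ∀ x {z} → z ∈ verts (Q R.B x) → v₁ ⋢ z
    avoidsR x z∈ with here? x
    ... | yes refl = p₂.Q-avoids (subst (λ q → _ ∈ verts q) R.root-Q z∈)
    ... | no x≢ = λ s → apart s (R.region x≢ z∈)

    -- An ear of `P₀` is only known to avoid `P₀`. It stays below `v`, however, where `Q₀` has no
    -- further vertices.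
    ear-off-Q : ∀ {q} → IsEar q P₀ → (∀ {z} → z ∈ verts q → v ⊑ z) →
      ∀ z → z ∈ inner q → z ∉ verts Q₀
    ear-off-Q {q} (_ , _ , off) reg z z∈ z∈Q =
      off z z∈ (pocket-Q z∈Q (reg (proj₁ (inner-props q z∈))))

    earL : IsEar (Q L.B here) P₀
    earL = subst (λ q → IsEar q P₀) (sym L.root-Q) p₁.ear
    earR : IsEar (Q R.B here) P₀
    earR = subst (λ q → IsEar q P₀) (sym R.root-Q) p₂.ear

    basics : ∀ x → 2 ≤ pathLength (P B x) × 2 ≤ pathLength (Q B x) × SubPath (P B x) (Q B x)
    basics here    = P-long , Q-long , P⊆Q
    basics (inL x) = proj₁ L.isPear x
    basics (inR x) = proj₁ R.isPear x

    isPear : IsPearTree G (node2 l r) B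
    isPear = basics , conditions
      where
      conditions : ∀ x y → ChildOf x y → _
      conditions _ _ cL = earL
        , (λ none → ⊥-elim (none (inR here) (here , cL , cR , λ ())))
        , λ { x′ (_ , cL , cL , x≢) → ⊥-elim (x≢ refl)
            ; x′ (_ , cL , cR , x≢) →
                (λ { here _ _ → ear-off-Q {Q L.B here} earL (regionL here)
                   ; (inL z) ¬i _ → ⊥-elim (¬i (dL top))
                   ; (inR z) _ ¬i → ⊥-elim (¬i (dR top)) })
              , λ z z∈ z∈′ → avoidsR here z∈′
                  (p₁.P-inner (subst (λ q → z ∈ inner q) L.root-P z∈)) }
      conditions _ _ cR = earR
        , (λ none → ⊥-elim (none (inL here) (here , cR , cL , λ ())))
        , λ { x′ (_ , cR , cR , x≢) → ⊥-elim (x≢ refl)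
            ; x′ (_ , cR , cL , x≢) →
                (λ { here _ _ → ear-off-Q {Q R.B here} earR (regionR here)
                   ; (inR z) ¬i _ → ⊥-elim (¬i (dR top))
                   ; (inL z) _ ¬i → ⊥-elim (¬i (dL top)) })
              , λ z z∈ z∈′ → avoidsL here z∈′
                  (p₂.P-inner (subst (λ q → z ∈ inner q) R.root-P z∈)) }
      -- A path `Q` of a vertex strictly inside the left tree lies below `v₁`. This is inside the
      -- reserve, hence off `Q₀`, and `avoidsR` keeps the whole right tree away from it.
      conditions (inL x) (inL y) (sL ch) with ear , alone , paired ← proj₂ L.isPear x y ch =
        ear
        , (λ none → far (alone (λ x′ (y′ , c , c′ , x≢) →
              none (inL x′) (inL y′ , sL c , sL c′ , λ { refl → x≢ refl }))))
        , λ { x′ (_ , cL , _) → ⊥-elim (child≢here ch refl)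
            ; (inL x′) (_ , sL c , sL c′ , x≢) →
                let p , p′ = paired x′ (_ , c , c′ , λ { refl → x≢ refl }) in
                (λ { here _ _ w w∈ → near w w∈
                   ; (inL z) ¬i ¬i′ → p z (λ i → ¬i (dL i)) (λ i → ¬i′ (dL i))
                   ; (inR z) _ _ w w∈ → cross z w w∈ }) , p′ }
        where
        near : ∀ w → w ∈ inner (Q L.B x) → w ∉ verts Q₀
        near w w∈ = U⇒∉Q (in₁ (L.region (child≢here ch) (proj₁ (inner-props (Q L.B x) w∈))))
        cross : ∀ z w → w ∈ inner (Q L.B x) → w ∉ verts (Q R.B z)
        cross z w w∈ w∈′ = avoidsR z w∈′ (L.region (child≢here ch) (proj₁ (inner-props (Q L.B x) w∈)))
        far : (∀ z → ¬ InSub x z → ∀ w → w ∈ inner (Q L.B x) → w ∉ verts (Q L.B z)) →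
          ∀ z → ¬ InSub (inL x) z → ∀ w → w ∈ inner (Q L.B x) → w ∉ verts (Q B z)
        far p here    _  w w∈ = near w w∈
        far p (inL z) ¬i      = p z (λ i → ¬i (dL i))
        far p (inR z) _  w w∈ = cross z w w∈
      conditions (inR x) (inR y) (sR ch) with ear , alone , paired ← proj₂ R.isPear x y ch =
        ear
        , (λ none → far (alone (λ x′ (y′ , c , c′ , x≢) →
              none (inR x′) (inR y′ , sR c , sR c′ , λ { refl → x≢ refl }))))
        , λ { x′ (_ , cR , _) → ⊥-elim (child≢here ch refl)
            ; (inR x′) (_ , sR c , sR c′ , x≢) →
                let p , p′ = paired x′ (_ , c , c′ , λ { refl → x≢ refl }) in
                (λ { here _ _ w w∈ → near w w∈
                   ; (inR z) ¬i ¬i′ → p z (λ i → ¬i (dR i)) (λ i → ¬i′ (dR i))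
                   ; (inL z) _ _ w w∈ → cross z w w∈ }) , p′ }
        where
        near : ∀ w → w ∈ inner (Q R.B x) → w ∉ verts Q₀
        near w w∈ = U⇒∉Q (in₂ (R.region (child≢here ch) (proj₁ (inner-props (Q R.B x) w∈))))
        cross : ∀ z w → w ∈ inner (Q R.B x) → w ∉ verts (Q L.B z)
        cross z w w∈ w∈′ = avoidsL z w∈′ (R.region (child≢here ch) (proj₁ (inner-props (Q R.B x) w∈)))
        far : (∀ z → ¬ InSub x z → ∀ w → w ∈ inner (Q R.B x) → w ∉ verts (Q R.B z)) →
          ∀ z → ¬ InSub (inR x) z → ∀ w → w ∈ inner (Q R.B x) → w ∉ verts (Q B z)
        far p here    _  w w∈ = near w w∈
        far p (inR z) ¬i      = p z (λ i → ¬i (dR i))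
        far p (inL z) _  w w∈ = cross z w w∈

    isClean : Clean G (node2 l r) B
    isClean here _ with e , e≡ , v⋢e ← outer =
      e , e≡ , λ { _ cL e∈ → v⋢e (regionL here e∈) ; _ cR e∈ → v⋢e (regionR here e∈) }
    isClean (inL y) (_ , sL ch) with e , e≡ , off ← L.clean y (_ , ch) =
      e , e≡ , λ { _ (sL c) → off _ c }
    isClean (inR y) (_ , sR ch) with e , e≡ , off ← R.clean y (_ , ch) =
      e , e≡ , λ { _ (sR c) → off _ c }

    region : ∀ {x} → x ≢ here → ∀ {z} → z ∈ verts (Q B x) → v ⊑ z
    region {here}  x≢ _ = ⊥-elim (x≢ refl)
    region {inL x} _    = regionL x
    region {inR x} _    = regionR x

    node : Grown P₀ Q₀ v (node2 l r)
    node = record { B = B ; root-P = refl ; root-Q = refl ; isPear = isPear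
                  ; clean = isClean ; region = region }

  -- The budget `h` only bounds the height, since the two subtrees of a full tree may differ in
  -- height while their sites have equal reserves.
  build : ∀ {t} → Full t → ∀ h → height t ≤ h → ∀ {P₀ Q₀} (S : Site P₀ (need h)) →
    2 ≤ pathLength P₀ → 2 ≤ pathLength Q₀ → SubPath P₀ Q₀ →
    (∀ {z} → z ∈ verts Q₀ → Site.v S ⊑ z → z ∈ verts P₀) → M ⊎ Grown P₀ Q₀ (Site.v S) t
  build leaf h _ {P₀} {Q₀} S Pl Ql sub pocket-Q = inj₂ record
    { B = record { P = λ _ → P₀ ; Q = λ _ → Q₀ } ; root-P = refl ; root-Q = refl
    ; isPear = (λ _ → Pl , Ql , sub) , (λ _ _ ()) ; clean = λ { _ (_ , ()) }
    ; region = λ { {here} x≢ → ⊥-elim (x≢ refl) } }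
  build (node2 fl fr) (suc h) (s≤s ht) S Pl Ql sub pocket-Q with grow S
  ... | inj₁ m = inj₁ m
  ... | inj₂ T
    with build fl h (ℕ.≤-trans (ℕ.m≤m⊔n _ _) ht) p₁.site p₁.P-long p₁.Q-long p₁.P⊆Q
           (λ z∈ s → p₁.Q-pocket z∈ (subst (_⊑ _) p₁.site-v s))
       | build fr h (ℕ.≤-trans (ℕ.m≤n⊔m _ _) ht) p₂.site p₂.P-long p₂.Q-long p₂.P⊆Q
           (λ z∈ s → p₂.Q-pocket z∈ (subst (_⊑ _) p₂.site-v s))
    where
    module p₁ = Pear (Twins.pear₁ T)
    module p₂ = Pear (Twins.pear₂ T)
  ...   | inj₁ m | _ = inj₁ m
  ...   | inj₂ _ | inj₁ m = inj₁ m
  ...   | inj₂ L | inj₂ R = inj₂ (Node.node S T Pl Ql sub pocket-Q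
            (subst (λ v → Grown _ _ v _) (Pear.site-v (Twins.pear₁ T)) L)
            (subst (λ v → Grown _ _ v _) (Pear.site-v (Twins.pear₂ T)) R))

  -- One branching leads away from the root, so that `v` has a parent, which serves as the end of
  -- the path outside the subtree of `v`. A second one supplies the two children of `v`, and `ℓ`
  -- more are spent on the pocket.
  first-site : ∀ {n} → Big (2 + (ℓ + n)) root → M ⊎ Σ (Path G) λ P₀ → 2 ≤ pathLength P₀ × Site P₀ n
  first-site B with mkBranching _ lc _ _ L _ ← branching B
    with mkBranching {v} {l} {r} l₀⊑v cl cr l≢r Bl Br ← branching L
    with fork v≢root cl cr l≢r Bl Br (child⇒⊑ cl) (λ { refl → child-⋢ cl self })
    where
    v≢root : v ≢ root
    v≢root = below-child≢root lc l₀⊑v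
  ... | inj₁ m = inj₁ m
  ... | inj₂ F = inj₂ (from-parent l₀⊑v lc (Forked.outcome F))
    where
    K = Forked.pocket F
    path : ∀ {w f} → Ch v w → f ≢ v → Guarding K v f → Σ (Path G) λ P₀ → 2 ≤ pathLength P₀ × Site P₀ _
    path {w} {f} ch f≢v (L , r , u , L⊆ , g)
      with P₀ , eq , refl , refl ← walk⇒path (Ch-edge ch ► r)
             (unique-∷ (λ w∈ → child-⋢ ch (L⊆ w∈)) u) (λ { refl → child-⋢ ch (L⊆ (end∈ r)) })
      = P₀
        , long-path P₀ (recast (sym eq) (there (start∈ r)))
            (λ { refl → child-⋢ ch self }) (≢-sym f≢v)
        , record { pocket = K
                 ; guards = guards-⊆ {K = K} (λ z∈ → recast (sym eq) (there z∈))
                     (λ z∈ Uz → case recast eq z∈ of λ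
                       { (here refl) → child-⋢ ch (⊑-trans (Pocket.v⊑q K) (Pocket.U⇒below K Uz))
                       ; (there z∈′) → Guards.avoids g z∈′ Uz }) g
                 ; big = Forked.big F
                 ; outer = _ , inj₁ refl , child-⋢ ch }
    parent : ∀ {a p} → a ⊑ v → Ch a p → ∃ (Ch v)
    parent self ch = _ , ch
    parent (down _ d) _ = _ , d
    from-parent : ∀ {a p} → a ⊑ v → Ch a p → Guarding K v l ⊎ Exiting K l →
      Σ (Path G) λ P₀ → 2 ≤ pathLength P₀ × Site P₀ _
    from-parent a⊑v ch (inj₁ g) =
      path (proj₂ (parent a⊑v ch)) (λ { refl → child-⋢ cl self }) g
    from-parent a⊑v ch (inj₂ ex) =
      path (proj₂ (parent a⊑v ch)) (Exiting.f′≢v ex) (Exiting.guarding ex (inj₁ refl))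

-- Heap numbering of complete binary trees

data Heap : ℕ → ℕ → Set where
  left  : ∀ {p} → Heap (2 * p + 1) p
  right : ∀ {p} → Heap (2 * p + 2) p

heap-< : ∀ {c p} → Heap c p → p < c
heap-< {p = p} left  = ℕ.≤-trans (ℕ.≤-reflexive (ℕ.+-comm 1 p)) (ℕ.+-monoˡ-≤ 1 (ℕ.m≤m+n p _))
heap-< {p = p} right = ℕ.≤-trans (heap-< (left {p})) (ℕ.+-monoʳ-≤ (2 * p) (s≤s z≤n))

odd≢even : ∀ m n → 2 * m + 1 ≢ 2 * n + 2
odd≢even m n eq = ℕ.even≢odd (suc n) m
  (trans (ℕ.*-suc 2 n) (trans (ℕ.+-comm 2 (2 * n)) (trans (sym eq) (ℕ.+-comm (2 * m) 1))))

-- The equation is a separate argument because matching cannot unify two indices such as `2 * p + 1`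
-- and `2 * p′ + 2`.
heap-parent′ : ∀ {c c′ p p′} → Heap c p → Heap c′ p′ → c ≡ c′ → p ≡ p′
heap-parent′ {p = p} {p′} left left eq = ℕ.*-cancelˡ-≡ p p′ 2 (ℕ.+-cancelʳ-≡ 1 _ _ eq)
heap-parent′ {p = p} {p′} right right eq = ℕ.*-cancelˡ-≡ p p′ 2 (ℕ.+-cancelʳ-≡ 2 _ _ eq)
heap-parent′ {p = p} {p′} left right eq = ⊥-elim (odd≢even p p′ eq)
heap-parent′ {p = p} {p′} right left eq = ⊥-elim (odd≢even p′ p (sym eq))

heap-parent : ∀ {c p p′} → Heap c p → Heap c p′ → p ≡ p′
heap-parent h h′ = heap-parent′ h h′ refl

heap-≤ : ∀ {a b} → Ancestor Heap a b → a ≤ b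
heap-≤ self       = ℕ.≤-refl
heap-≤ (down p h) = ℕ.≤-trans (heap-≤ p) (ℕ.<⇒≤ (heap-< h))

heap-apart : ∀ {i j} → Ancestor Heap (2 * i + 1) j → ¬ Ancestor Heap (2 * i + 2) j
heap-apart {i} p q with ancestor-laminar heap-parent p q
... | inj₁ r = below r refl
  where
  below : ∀ {b} → Ancestor Heap (2 * i + 1) b → b ≢ 2 * i + 2
  below self eq = odd≢even i i eq
  below (down r h) eq with refl ← heap-parent′ h (right {i}) eq =
    ℕ.<⇒≱ (heap-< (left {i})) (heap-≤ r)
... | inj₂ r = ℕ.<⇒≱ (ℕ.+-monoʳ-< (2 * i) (s≤s (s≤s z≤n))) (heap-≤ r)

-- Position j, or the edge from j to j′, or the leaf j, in the heap-numbered complete binary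
-- tree of height h rooted at i.
data Node∈ : ℕ → ℕ → ℕ → Set where
  root-node : ∀ {h i} → Node∈ h i i
  deeper    : ∀ {h i c j} → Heap c i → Node∈ h c j → Node∈ (suc h) i j

data Edge∈ : ℕ → ℕ → ℕ → ℕ → Set where
  root-edge : ∀ {h i c} → Heap c i → Edge∈ (suc h) i i c
  deeper    : ∀ {h i c j j′} → Heap c i → Edge∈ h c j j′ → Edge∈ (suc h) i j j′

data Leaf∈ : ℕ → ℕ → ℕ → Set where
  root-leaf : ∀ {i} → Leaf∈ 0 i i
  deeper    : ∀ {h i c j} → Heap c i → Leaf∈ h c j → Leaf∈ (suc h) i j

node-snoc : ∀ {h i j c} → Node∈ h i j → Heap c j → Node∈ (suc h) i c
node-snoc root-node    k = deeper k root-node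
node-snoc (deeper e n) k = deeper e (node-snoc n k)

edge-snoc : ∀ {h i j c} → Node∈ h i j → Heap c j → Edge∈ (suc h) i j c
edge-snoc root-node    k = root-edge k
edge-snoc (deeper e n) k = deeper e (edge-snoc n k)

leaf-snoc : ∀ {h i j c} → Leaf∈ h i j → Heap c j → Leaf∈ (suc h) i c
leaf-snoc root-leaf    k = deeper k root-leaf
leaf-snoc (deeper e n) k = deeper e (leaf-snoc n k)

heap-view : ∀ j → j ≡ 0 ⊎ ∃ (Heap j)
heap-view zero = inj₁ refl
heap-view (suc j) with heap-view j
... | inj₁ refl = inj₂ (0 , left)
... | inj₂ (p , left) = inj₂ (p , subst (λ c → Heap c p) (ℕ.+-suc (2 * p) 1) right)
... | inj₂ (p , right) = inj₂ (suc p , subst (λ c → Heap c (suc p)) eq left)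
  where
  eq : 2 * suc p + 1 ≡ suc (2 * p + 2)
  eq = trans (cong (_+ 1) (trans (ℕ.*-suc 2 p) (ℕ.+-comm 2 (2 * p)))) (ℕ.+-comm _ 1)

-- Counted from 1, the children of `n` are `2n` and `2n + 1`, and the levels are the intervals
-- between powers of two. All bounds are stated with `suc` for this reason.
heap-bounds : ∀ {c p} → Heap c p → 2 * suc p ≤ suc c × suc c ≤ suc (2 * suc p)
heap-bounds {p = p} left = ℕ.≤-reflexive eq , ℕ.≤-trans (ℕ.≤-reflexive (sym eq)) (ℕ.n≤1+n _)
  where
  eq : 2 * suc p ≡ suc (2 * p + 1)
  eq = trans (ℕ.*-suc 2 p) (cong suc (ℕ.+-comm 1 (2 * p)))
heap-bounds {p = p} right = ℕ.≤-trans (ℕ.n≤1+n _) (ℕ.≤-reflexive eq) , ℕ.≤-reflexive (sym eq)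
  where
  eq : suc (2 * suc p) ≡ suc (2 * p + 2)
  eq = cong suc (trans (ℕ.*-suc 2 p) (ℕ.+-comm 2 (2 * p)))

parent-bound : ∀ {c p} X → Heap c p → suc c < 2 * X → suc p < X
parent-bound X h c< = ℕ.*-cancelˡ-< 2 _ _ (ℕ.≤-<-trans (proj₁ (heap-bounds h)) c<)

parent-leaf : ∀ {c p} X → Heap c p → 2 * X ≤ suc c → X ≤ suc p
parent-leaf {p = p} X h ≤c with ℕ.≤-<-connex X (suc p)
... | inj₁ X≤ = X≤
... | inj₂ p<X = ⊥-elim (ℕ.1+n≰n (ℕ.≤-trans (ℕ.≤-trans (ℕ.≤-reflexive (sym (ℕ.*-suc 2 (suc p))))
        (ℕ.*-monoʳ-≤ 2 p<X)) (ℕ.≤-trans ≤c (proj₂ (heap-bounds h)))))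

all-nodes : ∀ h j → suc j < 2 ^ suc h → Node∈ h 0 j
all-nodes h j j< with heap-view j
... | inj₁ refl = root-node
all-nodes zero j j< | inj₂ (_ , k) = ⊥-elim (ℕ.<⇒≱ (parent-bound 1 k j<) (s≤s z≤n))
all-nodes (suc h) j j< | inj₂ (p , k) = node-snoc (all-nodes h p (parent-bound (2 ^ suc h) k j<)) k

all-edges : ∀ h {j p} → Heap j p → suc j < 2 ^ suc h → Edge∈ h 0 p j
all-edges zero {p = p} k j< = ⊥-elim (ℕ.<⇒≱ (parent-bound 1 k j<) (s≤s z≤n))
all-edges (suc h) {p = p} k j< = edge-snoc (all-nodes h p (parent-bound (2 ^ suc h) k j<)) k

all-leaves : ∀ h j → suc j < 2 ^ suc h → 2 ^ h ≤ suc j → Leaf∈ h 0 j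
all-leaves zero zero _ _ = root-leaf
all-leaves zero (suc j) (s≤s (s≤s ())) _
all-leaves (suc h) j j< ≤j with heap-view j
... | inj₁ refl = ⊥-elim (ℕ.<⇒≱ (ℕ.*-monoʳ-≤ 2 (ℕ.m^n>0 2 h)) ≤j)
... | inj₂ (p , k) = leaf-snoc (all-leaves h p (parent-bound (2 ^ suc h) k j<) (parent-leaf (2 ^ h) k ≤j)) k

tree-rel : ∀ i j → T (treeRel i j) → Heap j i
tree-rel i j t with Equivalence.to T-∨ t
... | inj₁ t′ with refl ← ℕ.≡ᵇ⇒≡ j (2 * i + 1) t′ = left
... | inj₂ t′ with refl ← ℕ.≡ᵇ⇒≡ j (2 * i + 2) t′ = right

-- The last position in the tree of height `h` rooted at `i` is `(2 + i) * 2 ^ h - 2`. Passing to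
-- the right child with one level less leaves this value unchanged.
heap-double : ∀ i X → (2 + (2 * i + 2)) * X ≡ (2 + i) * (2 * X)
heap-double i X = trans (cong (_* X) eq) (trans (cong (_* X) (ℕ.*-comm 2 (2 + i))) (ℕ.*-assoc (2 + i) 2 X))
  where
  eq : 2 + (2 * i + 2) ≡ 2 * (2 + i)
  eq = trans (cong (2 +_) (ℕ.+-comm (2 * i) 2)) (sym (ℕ.*-distribˡ-+ 2 2 i))

-- The minor Γ⁺ ℓ

module LeafConnected {G : Graph} (tree : SpanningBinaryTree G) where
  open Walks G
  open Tree tree

  module _ {Q : Pred (V G) 0ℓ} where

    -- The heap position whose branch set receives `x`. Vertices that hang off the frontier tree are
    -- counted with the position at which they leave it, so no vertex below `p` is lost and each can
    -- climb within its set.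
    index : ∀ {h p} → Frontier Q h p → ℕ → V G → ℕ
    index (tip _) i x = i
    index (along {c = c} _ F) i x with c ⊑? x
    ... | yes _ = index F i x
    ... | no  _ = i
    index (branch {c = c} {c′} _ _ _ F F′) i x with c ⊑? x | c′ ⊑? x
    ... | yes _ | _     = index F (2 * i + 1) x
    ... | no  _ | yes _ = index F′ (2 * i + 2) x
    ... | no  _ | no  _ = i

    index-along : ∀ {h c p} (ch : Ch c p) (F : Frontier Q h c) {i x} → c ⊑ x →
      index (along ch F) i x ≡ index F i x
    index-along {c = c} ch F {x = x} s with c ⊑? x
    ... | yes _ = refl
    ... | no ¬s = ⊥-elim (¬s s)

    index-left : ∀ {h c c′ p} (ch : Ch c p) (ch′ : Ch c′ p) c≢ (F : Frontier Q h c)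
      (F′ : Frontier Q h c′) {i x} → c ⊑ x →
      index (branch ch ch′ c≢ F F′) i x ≡ index F (2 * i + 1) x
    index-left {c = c} {c′} ch ch′ c≢ F F′ {x = x} s with c ⊑? x | c′ ⊑? x
    ... | yes _ | _ = refl
    ... | no ¬s | _ = ⊥-elim (¬s s)

    index-right : ∀ {h c c′ p} (ch : Ch c p) (ch′ : Ch c′ p) c≢ (F : Frontier Q h c)
      (F′ : Frontier Q h c′) {i x} → c′ ⊑ x →
      index (branch ch ch′ c≢ F F′) i x ≡ index F′ (2 * i + 2) x
    index-right {c = c} {c′} ch ch′ c≢ F F′ {x = x} s with c ⊑? x | c′ ⊑? x
    ... | yes r | _ = ⊥-elim (siblings-disjoint ch ch′ c≢ r s)
    ... | no _ | yes _ = refl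
    ... | no _ | no ¬s = ⊥-elim (¬s s)

    index-top : ∀ {h p} (F : Frontier Q h p) {i} → index F i p ≡ i
    index-top (tip _) = refl
    index-top {p = p} (along {c = c} ch F) with c ⊑? p
    ... | yes s = ⊥-elim (child-⋢ ch s)
    ... | no _ = refl
    index-top {p = p} (branch {c = c} {c′} ch ch′ _ F F′) with c ⊑? p | c′ ⊑? p
    ... | yes s | _ = ⊥-elim (child-⋢ ch s)
    ... | no _ | yes s = ⊥-elim (child-⋢ ch′ s)
    ... | no _ | no _ = refl

    index-below : ∀ {h p} (F : Frontier Q h p) i x → Ancestor Heap i (index F i x)
    index-below (tip _) i x = self
    index-below (along {c = c} ch F) i x with c ⊑? x
    ... | yes _ = index-below F i x
    ... | no _ = self
    index-below (branch {c = c} {c′} _ _ _ F F′) i x with c ⊑? x | c′ ⊑? x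
    ... | yes _ | _ = ancestor-trans (down self left) (index-below F _ x)
    ... | no _ | yes _ = ancestor-trans (down self right) (index-below F′ _ x)
    ... | no _ | no _ = self

    index-bound : ∀ {h p} (F : Frontier Q h p) i x → 2 + index F i x ≤ (2 + i) * 2 ^ h
    index-bound (tip _) i x = ℕ.≤-reflexive (sym (ℕ.*-identityʳ (2 + i)))
    index-bound {h} (along {c = c} ch F) i x with c ⊑? x
    ... | yes _ = index-bound F i x
    ... | no _ = ℕ.m≤m*n (2 + i) (2 ^ h) {{ℕ.m^n≢0 2 h}}
    index-bound {suc h} (branch {c = c} {c′} _ _ _ F F′) i x with c ⊑? x | c′ ⊑? x
    ... | yes _ | _ = ℕ.≤-trans (index-bound F (2 * i + 1) x) (ℕ.≤-trans
            (ℕ.*-monoˡ-≤ (2 ^ h) (s≤s (s≤s (ℕ.+-monoʳ-≤ (2 * i) (s≤s (z≤n {1})))))) (double i h))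
      where
      double : ∀ i h → (2 + (2 * i + 2)) * 2 ^ h ≤ (2 + i) * 2 ^ suc h
      double i h = ℕ.≤-reflexive (heap-double i (2 ^ h))
    ... | no _ | yes _ = ℕ.≤-trans (index-bound F′ (2 * i + 2) x) (ℕ.≤-reflexive (heap-double i (2 ^ h)))
    ... | no _ | no _ = ℕ.m≤m*n (2 + i) (2 ^ suc h) {{ℕ.m^n≢0 2 (suc h)}}

    Fibre : ∀ {h p} → Frontier Q h p → ℕ → ℕ → Pred (V G) 0ℓ
    Fibre {p = p} F i j z = p ⊑ z × index F i z ≡ j

    -- Vertices off the chosen children climb to `p`. At a branching, positions below the two
    -- children are disjoint and exclude `i`, so a fibre lies under one child or consists of
    -- vertices that climb.
    fibre-connected : ∀ {h p} (F : Frontier Q h p) i {j x y} → Fibre F i j x → Fibre F i j y →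
      WalkIn (Fibre F i j) x y
    fibre-connected (tip _) i (s , refl) (t , refl) =
      weaken (λ (a , _) → a , refl) (up s) ⊙ reverse-in (weaken (λ (a , _) → a , refl) (up t))
    fibre-connected {p = p} F@(along {c = c} ch F₀) i {j} {x} {y} a@(s , eq) b@(t , eq′) =
      go (c ⊑? x) (c ⊑? y)
      where
      lift : ∀ {z} → Fibre F₀ i j z → Fibre F i j z
      lift (r , e) = ⊑-trans (child⇒⊑ ch) r , trans (index-along ch F₀ r) e
      lower : ∀ {z} → c ⊑ z → Fibre F i j z → Fibre F₀ i j z
      lower r (_ , e) = r , trans (sym (index-along ch F₀ r)) e
      off : ∀ {z} → c ⋢ z → index F i z ≡ i
      off {z} n with c ⊑? z
      ... | yes r = ⊥-elim (n r)
      ... | no _ = refl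
      climb : ∀ {z} → Fibre F i j z → c ⋢ z → i ≡ j × WalkIn (Fibre F i j) z p
      climb (r , e) n = i≡j , weaken (λ (u , v) → u , trans (off (λ w → n (⊑-trans w v))) i≡j) (up r)
        where i≡j = trans (sym (off n)) e
      cross : ∀ {z} → i ≡ j → Fibre F i j z → c ⊑ z → WalkIn (Fibre F i j) z p
      cross i≡j f r = join-in (weaken lift (fibre-connected F₀ i (lower r f) (self , trans (index-top F₀) i≡j)))
        (E-sym (Ch-edge ch)) (here-walk (self , trans (index-top F) i≡j))
      go : Dec (c ⊑ x) → Dec (c ⊑ y) → WalkIn (Fibre F i j) x y
      go (yes r) (yes r′) = weaken lift (fibre-connected F₀ i (lower r a) (lower r′ b))
      go (yes r) (no n) with e , w ← climb b n = cross e a r ⊙ reverse-in w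
      go (no n) (yes r) with e , w ← climb a n = w ⊙ reverse-in (cross e b r)
      go (no n) (no n′) = proj₂ (climb a n) ⊙ reverse-in (proj₂ (climb b n′))
    fibre-connected {p = p} F@(branch {c = c} {c′} ch ch′ c≢ F₁ F₂) i {j} {x} {y} a@(s , eq) b@(t , eq′) =
      go (c ⊑? x) (c′ ⊑? x) (c ⊑? y) (c′ ⊑? y)
      where
      L : ∀ {z} → c ⊑ z → Fibre F i j z → Fibre F₁ (2 * i + 1) j z
      L r (_ , e) = r , trans (sym (index-left ch ch′ c≢ F₁ F₂ r)) e
      R : ∀ {z} → c′ ⊑ z → Fibre F i j z → Fibre F₂ (2 * i + 2) j z
      R r (_ , e) = r , trans (sym (index-right ch ch′ c≢ F₁ F₂ r)) e
      L⁻ : ∀ {z} → Fibre F₁ (2 * i + 1) j z → Fibre F i j z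
      L⁻ (r , e) = ⊑-trans (child⇒⊑ ch) r , trans (index-left ch ch′ c≢ F₁ F₂ r) e
      R⁻ : ∀ {z} → Fibre F₂ (2 * i + 2) j z → Fibre F i j z
      R⁻ (r , e) = ⊑-trans (child⇒⊑ ch′) r , trans (index-right ch ch′ c≢ F₁ F₂ r) e
      L-anc : ∀ {z} → c ⊑ z → Fibre F i j z → Ancestor Heap (2 * i + 1) j
      L-anc r f = subst (Ancestor Heap _) (proj₂ (L r f)) (index-below F₁ _ _)
      R-anc : ∀ {z} → c′ ⊑ z → Fibre F i j z → Ancestor Heap (2 * i + 2) j
      R-anc r f = subst (Ancestor Heap _) (proj₂ (R r f)) (index-below F₂ _ _)
      off : ∀ {z} → c ⋢ z → c′ ⋢ z → index F i z ≡ i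
      off {z} n n′ with c ⊑? z | c′ ⊑? z
      ... | yes r | _ = ⊥-elim (n r)
      ... | no _ | yes r = ⊥-elim (n′ r)
      ... | no _ | no _ = refl
      climb : ∀ {z} → Fibre F i j z → c ⋢ z → c′ ⋢ z → i ≡ j × WalkIn (Fibre F i j) z p
      climb (r , e) n n′ = i≡j , weaken (λ (u , v) → u ,
          trans (off (λ w → n (⊑-trans w v)) (λ w → n′ (⊑-trans w v))) i≡j) (up r)
        where i≡j = trans (sym (off n n′)) e
      L≢ : Ancestor Heap (2 * i + 1) j → i ≢ j
      L≢ r refl = ℕ.<⇒≱ (heap-< (left {i})) (heap-≤ r)
      R≢ : Ancestor Heap (2 * i + 2) j → i ≢ j
      R≢ r refl = ℕ.<⇒≱ (heap-< (right {i})) (heap-≤ r)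
      go : Dec (c ⊑ x) → Dec (c′ ⊑ x) → Dec (c ⊑ y) → Dec (c′ ⊑ y) → WalkIn (Fibre F i j) x y
      go (yes r) _ (yes r′) _ = weaken L⁻ (fibre-connected F₁ _ (L r a) (L r′ b))
      go (yes r) _ (no _) (yes r′) = ⊥-elim (heap-apart {i} (L-anc r a) (R-anc r′ b))
      go (yes r) _ (no n) (no n′) = ⊥-elim (L≢ (L-anc r a) (proj₁ (climb b n n′)))
      go (no _) (yes r) (yes r′) _ = ⊥-elim (heap-apart {i} (L-anc r′ b) (R-anc r a))
      go (no _) (yes r) (no _) (yes r′) = weaken R⁻ (fibre-connected F₂ _ (R r a) (R r′ b))
      go (no _) (yes r) (no n) (no n′) = ⊥-elim (R≢ (R-anc r a) (proj₁ (climb b n n′)))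
      go (no n) (no n′) (yes r) _ = ⊥-elim (L≢ (L-anc r b) (proj₁ (climb a n n′)))
      go (no n) (no n′) (no _) (yes r) = ⊥-elim (R≢ (R-anc r b) (proj₁ (climb a n n′)))
      go (no n) (no n′) (no m) (no m′) = proj₂ (climb a n n′) ⊙ reverse-in (proj₂ (climb b m m′))

    hits-node : ∀ {h p i j} (F : Frontier Q h p) → Node∈ h i j → ∃ (Fibre F i j)
    hits-node {p = p} F root-node = p , self , index-top F
    hits-node (along ch F) n@(deeper _ _) with x , s , eq ← hits-node F n =
      x , ⊑-trans (child⇒⊑ ch) s , trans (index-along ch F s) eq
    hits-node (branch ch ch′ c≢ F F′) (deeper left n) with x , s , eq ← hits-node F n =
      x , ⊑-trans (child⇒⊑ ch) s , trans (index-left ch ch′ c≢ F F′ s) eq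
    hits-node (branch ch ch′ c≢ F F′) (deeper right n) with x , s , eq ← hits-node F′ n =
      x , ⊑-trans (child⇒⊑ ch′) s , trans (index-right ch ch′ c≢ F F′ s) eq

    -- The whole subtree of a tip goes to its leaf, because the edge that leads out may start
    -- anywhere below the tip.
    hits-leaf : ∀ {h p i j} (F : Frontier Q h p) → Leaf∈ h i j →
      ∃ λ y → Q y × ∀ {x} → y ⊑ x → Fibre F i j x
    hits-leaf (tip q) root-leaf = _ , q , λ s → s , refl
    hits-leaf (along ch F) n with y , q , f ← hits-leaf F n =
      y , q , λ s → let r , eq = f s in ⊑-trans (child⇒⊑ ch) r , trans (index-along ch F r) eq
    hits-leaf (branch ch ch′ c≢ F F′) (deeper left n) with y , q , f ← hits-leaf F n =
      y , q , λ s → let r , eq = f s in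
        ⊑-trans (child⇒⊑ ch) r , trans (index-left ch ch′ c≢ F F′ r) eq
    hits-leaf (branch ch ch′ c≢ F F′) (deeper right n) with y , q , f ← hits-leaf F′ n =
      y , q , λ s → let r , eq = f s in
        ⊑-trans (child⇒⊑ ch′) r , trans (index-right ch ch′ c≢ F F′ r) eq

    hits-edge : ∀ {h p i j j′} (F : Frontier Q h p) → Edge∈ h i j j′ →
      ∃₂ λ x y → Fibre F i j x × Fibre F i j′ y × E G x y
    hits-edge (along ch F) n with x , y , (s , e) , (t , e′) , f ← hits-edge F n =
      x , y , (⊑-trans (child⇒⊑ ch) s , trans (index-along ch F s) e)
            , (⊑-trans (child⇒⊑ ch) t , trans (index-along ch F t) e′) , f
    hits-edge {p = p} F₀@(branch {c = c} ch ch′ c≢ F F′) (root-edge left) =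
      p , c , (self , index-top F₀)
            , (child⇒⊑ ch , trans (index-left ch ch′ c≢ F F′ self) (index-top F)) , Ch-edge ch
    hits-edge {p = p} F₀@(branch {c′ = c′} ch ch′ c≢ F F′) (root-edge right) =
      p , c′ , (self , index-top F₀)
             , (child⇒⊑ ch′ , trans (index-right ch ch′ c≢ F F′ self) (index-top F′)) , Ch-edge ch′
    hits-edge (branch ch ch′ c≢ F F′) (deeper left n)
      with x , y , (s , e) , (t , e′) , f ← hits-edge F n =
      x , y , (⊑-trans (child⇒⊑ ch) s , trans (index-left ch ch′ c≢ F F′ s) e)
            , (⊑-trans (child⇒⊑ ch) t , trans (index-left ch ch′ c≢ F F′ t) e′) , f
    hits-edge (branch ch ch′ c≢ F F′) (deeper right n)
      with x , y , (s , e) , (t , e′) , f ← hits-edge F′ n =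
      x , y , (⊑-trans (child⇒⊑ ch′) s , trans (index-right ch ch′ c≢ F F′ s) e)
            , (⊑-trans (child⇒⊑ ch′) t , trans (index-right ch ch′ c≢ F F′ t) e′) , f

  module _ {O : Pred (V G) 0ℓ} (O? : Decidable O) {c h}
    (F : Frontier (λ y → ∃ λ x → y ⊑ x × ∃ λ w → O w × E G x w) h c)
    (O-below : ∀ {x} → O x → c ⋢ x) (O-conn : ∀ {a b} → O a → O b → WalkIn O a b) (some : ∃ O)
    where

    private
      N : ℕ
      N = 2 ^ suc h ∸ 1

      1+N : suc N ≡ 2 ^ suc h
      1+N = ℕ.m+[n∸m]≡n {1} (ℕ.m^n>0 2 (suc h))

      index< : ∀ x → suc (index F 0 x) < 2 ^ suc h
      index< x = index-bound F 0 x

      f : V G → Maybe (V (Γ⁺ h))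
      f x with c ⊑? x | O? x
      ... | yes _ | _     = just (fromℕ< (ℕ.<-trans (ℕ.n<1+n _) (index< x)))
      ... | no _  | yes _ = just (fromℕ< (ℕ.≤-reflexive 1+N))
      ... | no _  | no _  = nothing

      Branch : V (Γ⁺ h) → Pred (V G) 0ℓ
      Branch u x = Fibre F 0 (toℕ u) x ⊎ (O x × toℕ u ≡ N)

      f⇒ : ∀ {x u} → f x ≡ just u → Branch u x
      f⇒ {x} eq with c ⊑? x | O? x
      f⇒ refl | yes s | _ = inj₁ (s , sym (Fin.toℕ-fromℕ< _))
      f⇒ refl | no _ | yes o = inj₂ (o , Fin.toℕ-fromℕ< _)

      ⇒f : ∀ {x u} → Branch u x → f x ≡ just u
      ⇒f {x} (inj₁ (s , eq)) with c ⊑? x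
      ... | yes _ = cong just (Fin.toℕ-injective (trans (Fin.toℕ-fromℕ< _) eq))
      ... | no n = ⊥-elim (n s)
      ⇒f {x} (inj₂ (o , eq)) with c ⊑? x | O? x
      ... | yes s | _ = ⊥-elim (O-below o s)
      ... | no _ | yes _ = cong just (Fin.toℕ-injective (trans (Fin.toℕ-fromℕ< _) (sym eq)))
      ... | no _ | no n = ⊥-elim (n o)

      index≢N : ∀ {x j} → Fibre F 0 j x → j ≢ N
      index≢N {x} (_ , refl) eq = ℕ.<-irrefl (trans (cong suc eq) 1+N) (index< x)

      low-or-N : ∀ (u : V (Γ⁺ h)) → suc (toℕ u) < 2 ^ suc h ⊎ toℕ u ≡ N
      low-or-N u with ℕ.m≤n⇒m<n∨m≡n (Fin.toℕ<n u)
      ... | inj₁ u< = inj₁ u<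
      ... | inj₂ eq = inj₂ (ℕ.suc-injective (trans eq (sym 1+N)))

      Rel : V (Γ⁺ h) → V (Γ⁺ h) → Set
      Rel u u′ = Heap (toℕ u′) (toℕ u) ⊎ (toℕ u ≡ N × 2 ^ h ∸ 1 ≤ toℕ u′)

      rel : ∀ u u′ → T (treeRel (toℕ u) (toℕ u′)
        ∨ ((toℕ u ℕ.≡ᵇ N) ∧ ((2 ^ h ∸ 1) ℕ.≤ᵇ toℕ u′))) → Rel u u′
      rel u u′ t with Equivalence.to T-∨ t
      ... | inj₁ t′ = inj₁ (tree-rel _ _ t′)
      ... | inj₂ t′ with s , r ← Equivalence.to T-∧ t′ =
        inj₂ (ℕ.≡ᵇ⇒≡ _ N s , ℕ.≤ᵇ⇒≤ _ _ r)

      rels : ∀ u u′ → E (Γ⁺ h) u u′ → Rel u u′ ⊎ Rel u′ u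
      rels u u′ e with Equivalence.to T-∨ (proj₁ (Equivalence.to T-∧ e))
      ... | inj₁ t = inj₁ (rel u u′ t)
      ... | inj₂ t = inj₂ (rel u′ u t)

      Joined : V (Γ⁺ h) → V (Γ⁺ h) → Set
      Joined u u′ = ∃₂ λ x y → f x ≡ just u × f y ≡ just u′ × E G x y

      flip : ∀ {u u′} → Joined u u′ → Joined u′ u
      flip (x , y , p , q , e) = y , x , q , p , E-sym e

      leaf-joined : ∀ {u u′} → suc (toℕ u) < 2 ^ suc h → 2 ^ h ≤ suc (toℕ u) → toℕ u′ ≡ N → Joined u u′
      leaf-joined u< ≤u eq with y , (x , y⊑x , w , o , e) , fib ← hits-leaf F (all-leaves h _ u< ≤u) =
        x , w , ⇒f (inj₁ (fib y⊑x)) , ⇒f (inj₂ (o , eq)) , e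

      Rel-joined : ∀ u u′ → E (Γ⁺ h) u u′ → Rel u u′ → Joined u u′
      Rel-joined u u′ e (inj₁ k) with low-or-N u′
      ... | inj₁ u′< with x , y , p , q , f′ ← hits-edge F (all-edges h k u′<) =
        x , y , ⇒f (inj₁ p) , ⇒f (inj₁ q) , f′
      -- `treeRel` is not cut off at the height of the tree: the added vertex `N` is the left child
      -- of the first leaf. This edge is one of those between `N` and the leaves.
      ... | inj₂ eq = leaf-joined (ℕ.<-≤-trans (s≤s (heap-< k)) (Fin.toℕ<n u′))
        (parent-leaf (2 ^ h) k (ℕ.≤-reflexive (sym (trans (cong suc eq) 1+N)))) eq
      Rel-joined u u′ e (inj₂ (eq , ≤u′)) with low-or-N u′
      ... | inj₁ u′< = flip (leaf-joined u′<
        (ℕ.≤-trans (ℕ.≤-reflexive (sym (ℕ.m+[n∸m]≡n {1} (ℕ.m^n>0 2 h)))) (s≤s ≤u′)) eq)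
      -- The comparison with `2 ^ h ∸ 1` also admits `N` itself, but the graph has no loops.
      ... | inj₂ eq′ with refl ← Fin.toℕ-injective (trans eq (sym eq′)) =
        ⊥-elim (Walks.E-irrefl (Γ⁺ h) {u} e)

    leaf-connected-minor : Minor (Γ⁺ h) G
    leaf-connected-minor = record
      { f = f
      ; nonempty = λ u → case low-or-N u of λ
          { (inj₁ u<) → let x , p = hits-node F (all-nodes h _ u<) in x , ⇒f (inj₁ p)
          ; (inj₂ eq) → let o , p = some in o , ⇒f (inj₂ (p , eq)) }
      ; conn = λ u a b fa fb → walk⇒reach (connect u (f⇒ fa) (f⇒ fb))
      ; edges = λ u u′ e → case rels u u′ e of λ
          { (inj₁ r) → Rel-joined u u′ e r
          ; (inj₂ r) → flip (Rel-joined u′ u (Walks.E-sym (Γ⁺ h) {u} {u′} e) r) } }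
      where
      connect : ∀ u {a b} → Branch u a → Branch u b → WalkIn (λ x → f x ≡ just u) a b
      connect u (inj₁ p) (inj₁ q) = weaken (⇒f ∘ inj₁) (fibre-connected F 0 p q)
      connect u (inj₁ p) (inj₂ (_ , eq)) = ⊥-elim (index≢N p eq)
      connect u (inj₂ (_ , eq)) (inj₁ q) = ⊥-elim (index≢N q eq)
      connect u (inj₂ (o , eq)) (inj₂ (o′ , _)) = weaken (λ r → ⇒f (inj₂ (r , eq))) (O-conn o o′)

  open Pockets tree using (HasExit; hasExit?)

  exit-gap : ∀ ℓ {a c h} → a ≢ root → a ⊑ c → Big (ℓ + h) c →
    Minor (Γ⁺ ℓ) G ⊎ ∃ λ z → c ⊑ z × Big h z × ¬ HasExit a z
  exit-gap ℓ {a} a≢ a⊑c B with frontier-or-gap (hasExit? a) ℓ B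
  ... | inj₂ r = inj₂ r
  ... | inj₁ F = inj₁ (leaf-connected-minor (λ x → ¬? (a ⊑? x)) F (λ a⋢x c⊑x → a⋢x (⊑-trans a⊑c c⊑x))
        (λ n n′ → climb n ⊙ reverse-in (climb n′))
        (root , λ { self → a≢ refl ; (down _ ch) → root-top ch }))
    where
    climb : ∀ {x} → a ⋢ x → WalkIn (a ⋢_) x root
    climb n = weaken (λ (_ , t) s → n (⊑-trans s t)) (up (reach _))

-- Contracting a vertex off the subdivision

module _ (n : ℕ) {R : Fin n → Fin n → Set} (R? : ∀ x y → Dec (R x y))
  (R-sym : ∀ {x y} → R x y → R y x) (R-irr : ∀ {x} → ¬ R x x) where

  graphOf : Graph
  graphOf = record
    { size = n ; adj = λ x y → isYes (R? x y) ; adj-sym = same ; adj-irr = none }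
    where
    same : ∀ x y → isYes (R? x y) ≡ isYes (R? y x)
    same x y with R? x y | R? y x
    ... | yes _ | yes _ = refl
    ... | yes r | no n  = ⊥-elim (n (R-sym r))
    ... | no n  | yes r = ⊥-elim (n (R-sym r))
    ... | no _  | no _  = refl
    none : ∀ x → isYes (R? x x) ≡ false
    none x with R? x x
    ... | yes r = ⊥-elim (R-irr r)
    ... | no _  = refl

  graphOf-intro : ∀ {x y} → R x y → E graphOf x y
  graphOf-intro = fromWitness

  graphOf-elim : ∀ {x y} → E graphOf x y → R x y
  graphOf-elim = toWitness

-- z has a neighbour w such that G - z - w is connected. While scanning the neighbours of z, keep w
-- and a vertex c that all neighbours seen so far except w reach in G - z - w; the next neighbour
-- either reaches c in G - z - w too, or it can take the place of w.
module NonCut (G : Graph) (big : 3 ≤ size G) (no-cut : ∀ x → ConnectedSet G (λ v → v ≢ x))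
  (z : V G) where
  open Walks G

  Off : V G → Pred (V G) 0ℓ
  Off w v = v ≢ z × v ≢ w

  Hub : V G → V G → List (V G) → Set
  Hub w c ys = ∀ {y} → y ∈ ys → y ≢ w → WalkIn (Off w) y c

  third : ∀ a b → ∃ λ c → c ≢ a × c ≢ b
  third a b with any? (λ c → ¬? (c ≟ a) ×-dec ¬? (c ≟ b))
  ... | yes r = r
  ... | no none = ⊥-elim (ℕ.<⇒≱ big (Fin.injective⇒≤ {f = code} code-inj))
    where
    code : V G → Fin 2
    code c = if does (c ≟ a) then Fin.zero else Fin.suc Fin.zero
    code-inj : ∀ {c d} → code c ≡ code d → c ≡ d
    code-inj {c} {d} eq with c ≟ a | d ≟ a
    ... | yes refl | yes refl = refl
    ... | no c≢ | no d≢ with c ≟ b | d ≟ b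
    ...   | yes refl | yes refl = refl
    ...   | no c≢b | _ = ⊥-elim (none (c , c≢ , c≢b))
    ...   | _ | no d≢b = ⊥-elim (none (d , d≢ , d≢b))

  -- If one of the hub walks runs through `y`, its remainder takes `y` to `c`. If none does, they
  -- all survive when `y` is deleted in place of `w`.
  reroute-hub : ∀ {w c y} ys → Hub w c ys →
    WalkIn (Off w) y c ⊎ (∀ {x} → x ∈ ys → x ≢ w → WalkIn (Off y) x c)
  reroute-hub [] hub = inj₂ λ ()
  reroute-hub {w} {c} {y} (x ∷ ys) hub with reroute-hub {w} {c} {y} ys (hub ∘ there)
  ... | inj₁ r = inj₁ r
  ... | inj₂ g with x ≟ w
  ...   | yes refl = inj₂ λ { (here refl) x≢ → ⊥-elim (x≢ refl) ; (there z∈) → g z∈ }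
  ...   | no x≢w with vs , r , s ← hub (here refl) x≢w with y ∈? vs
  ...     | yes y∈ with us , r′ , us⊆ , _ ← suffix r y∈ =
    inj₁ (us , r′ , All.tabulate (All.lookup s ∘ us⊆))
  ...     | no y∉ = inj₂ λ
    { (here refl) _ → vs , r , All.tabulate (λ v∈ →
        proj₁ (All.lookup s v∈) , λ { refl → y∉ v∈ })
    ; (there z∈) → g z∈ }

  hub : ∀ ys {y₀} → E G z y₀ → (∀ {y} → y ∈ ys → E G z y) →
    ∃₂ λ w c → E G z w × c ≢ z × c ≢ w × Hub w c (y₀ ∷ ys)
  hub [] {y₀} e adj with c , c≢z , c≢y₀ ← third z y₀ =
    y₀ , c , e , c≢z , c≢y₀ , λ { (here refl) y≢ → ⊥-elim (y≢ refl) }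
  hub (y ∷ ys) {y₀} e₀ adj with w , c , ew , c≢z , c≢w , h ← hub ys e₀ (adj ∘ there) = extend
    where
    keep : (y ≢ w → WalkIn (Off w) y c) → Hub w c (y₀ ∷ y ∷ ys)
    keep r (here refl) = h (here refl)
    keep r (there (here refl)) = r
    keep r (there (there y∈)) = h (there y∈)
    ey : E G z y
    ey = adj (here refl)
    ≢z : ∀ {v} → E G z v → v ≢ z
    ≢z e refl = E-irrefl {z} e
    extend : ∃₂ λ w c → E G z w × c ≢ z × c ≢ w × Hub w c (y₀ ∷ y ∷ ys)
    extend with y ≟ w | y ≟ c
    ... | yes refl | _ = w , c , ew , c≢z , c≢w , keep λ n → ⊥-elim (n refl)
    ... | no _ | yes refl = w , c , ew , c≢z , c≢w , keep λ _ → here-walk (c≢z , c≢w)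
    ... | no y≢w | no y≢c with reroute-hub {y = y} (y₀ ∷ ys) h
    ...   | inj₁ r = w , c , ew , c≢z , c≢w , keep λ _ → r
    -- A simple walk from `w` to `c` in `G - z` decides. If it misses `y`, then `w` reaches `c` and
    -- `y` replaces it; if it passes `y`, its remainder avoids `w`, so `w` can stay.
    ...   | inj₂ g with simple-in (reach⇒walk (≢z ew) c≢z (no-cut z w c (≢z ew) c≢z))
    ...     | us , r , u , s with y ∈? us
    ...       | no y∉ = y , c , ey , c≢z , (≢-sym y≢c) , λ
      { (here refl) x≢ → from-w-or (here refl)
      ; (there (here refl)) x≢ → ⊥-elim (x≢ refl)
      ; (there (there x∈)) x≢ → from-w-or (there x∈) }
      where
      from-w-or : ∀ {x} → x ∈ y₀ ∷ ys → WalkIn (Off y) x c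
      from-w-or {x} x∈ with x ≟ w
      ... | no x≢w = g x∈ x≢w
      ... | yes refl = us , r , All.tabulate (λ v∈ → All.lookup s v∈ , λ { refl → y∉ v∈ })
    ...       | yes y∈ = w , c , ew , c≢z , c≢w , keep λ _ → after r u y∈ s
      where
      after : ∀ {us} → Walk w us c → Unique us → y ∈ us → All (_≢ z) us → WalkIn (Off w) y c
      after stop _ (here refl) _ = ⊥-elim (y≢w refl)
      after (_ ► _) _ (here refl) _ = ⊥-elim (y≢w refl)
      after (_ ► r) u (there y∈) (_ ∷ s) with ts , r′ , ts⊆ , _ ← suffix r y∈ =
        ts , r′ , All.tabulate (λ v∈ → All.lookup s (ts⊆ v∈) , λ { refl → unique-∉ u (ts⊆ v∈) })

  -- A walk to `c` in `G - w` that meets `z` is cut just before its first visit. The vertex there is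
  -- a neighbour of `z`, for which the hub has a walk.
  non-cut-neighbour : Connected G →
    ∃ λ w → E G z w × (∀ {a b} → a ≢ z → a ≢ w → b ≢ z → b ≢ w → WalkIn (Off w) a b)
  non-cut-neighbour conn with o , o≢z , _ ← third z z
    with reach⇒walk {S = λ _ → ⊤} tt tt (conn z o tt tt)
  ... | _ , stop , _ = ⊥-elim (o≢z refl)
  ... | _ , e₀ ► _ , _
    with w , c , ew , c≢z , c≢w , h ← hub (filter (E? z) (allFin _)) e₀ (λ y∈ → proj₂ (∈-filter⁻ (E? z) {xs = allFin _} y∈))
    = w , ew , λ a b a′ b′ → to-c a b ⊙ reverse-in (to-c a′ b′)
    where
    to-c : ∀ {a} → a ≢ z → a ≢ w → WalkIn (Off w) a c
    to-c a≢z a≢w with vs , r , s ← reach⇒walk a≢w c≢w (no-cut w _ c a≢w c≢w) with z ∈? vs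
    ... | no z∉ = vs , r , All.tabulate (λ v∈ → (λ { refl → z∉ v∈ }) , All.lookup s v∈)
    ... | yes z∈ with us , r′ , us⊆ ← prefix r z∈
      with first-visit (_≟ z) (us , r′ , All.tabulate (All.lookup s ∘ us⊆)) refl
    ...   | inj₁ refl = ⊥-elim (a≢z refl)
    ...   | inj₂ (m , _ , r″ , e , refl , _) =
      weaken (λ (p , q) → q , p) r″ ⊙ h (there (∈-filter⁺ (E? z) (∈-allFin m) (E-sym e)))
        (proj₁ (walkIn-end r″))

module Contraction (G : Graph) {n : ℕ} (size≡ : size G ≡ suc n) (z w : V G) (zw : E G z w) where
  open Walks G

  private
    cast : V G → Fin (suc n)
    cast = subst Fin size≡
    cast⁻ : Fin (suc n) → V G
    cast⁻ = subst Fin (sym size≡)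

  ι : Fin n → V G
  ι x = cast⁻ (punchIn (cast z) x)

  private
    cast-cast⁻ : ∀ x → cast (cast⁻ x) ≡ x
    cast-cast⁻ x = subst-subst-sym size≡
    cast⁻-cast : ∀ x → cast⁻ (cast x) ≡ x
    cast⁻-cast x = subst-sym-subst size≡

    off : ∀ {x} → x ≢ z → cast z ≢ cast x
    off {x} x≢ eq = x≢ (trans (sym (cast⁻-cast x)) (trans (cong cast⁻ (sym eq)) (cast⁻-cast z)))

    out : ∀ {x} → x ≢ z → Fin n
    out x≢ = punchOut (off x≢)

    ι-out : ∀ {x} (x≢ : x ≢ z) → ι (out x≢) ≡ x
    ι-out {x} x≢ = trans (cong cast⁻ (Fin.punchIn-punchOut (off x≢))) (cast⁻-cast x)

  ι≢z : ∀ {x} → ι x ≢ z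
  ι≢z {x} eq = Fin.punchInᵢ≢i (cast z) x (trans (sym (cast-cast⁻ _)) (cong cast eq))

  ι-injective : ∀ {x y} → ι x ≡ ι y → x ≡ y
  ι-injective eq = Fin.punchIn-injective (cast z) _ _
    (trans (sym (cast-cast⁻ _)) (trans (cong cast eq) (cast-cast⁻ _)))

  w≢z : w ≢ z
  w≢z refl = E-irrefl {w} zw

  w′ : Fin n
  w′ = out w≢z

  ι-w′ : ι w′ ≡ w
  ι-w′ = ι-out w≢z

  π : V G → Fin n
  π x with x ≟ z
  ... | yes _ = w′
  ... | no x≢ = out x≢

  ι-π : ∀ {x} → x ≢ z → ι (π x) ≡ x
  ι-π {x} x≢ with x ≟ z
  ... | yes eq = ⊥-elim (x≢ eq)
  ... | no x≢′ = ι-out x≢′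

  π-z : π z ≡ w′
  π-z with z ≟ z
  ... | yes _ = refl
  ... | no n = ⊥-elim (n refl)

  π-ι : ∀ x → π (ι x) ≡ x
  π-ι x = ι-injective (ι-π ι≢z)

  Adj : Fin n → Fin n → Set
  Adj x y = x ≢ y × (E G (ι x) (ι y) ⊎ (x ≡ w′ × E G z (ι y) ⊎ y ≡ w′ × E G z (ι x)))

  Adj? : ∀ x y → Dec (Adj x y)
  Adj? x y = ¬? (x ≟ y) ×-dec (E? _ _ ⊎-dec ((x ≟ w′ ×-dec E? _ _) ⊎-dec (y ≟ w′ ×-dec E? _ _)))

  Adj-sym : ∀ {x y} → Adj x y → Adj y x
  Adj-sym (x≢ , inj₁ e) = ≢-sym x≢ , inj₁ (E-sym e)
  Adj-sym (x≢ , inj₂ (inj₁ p)) = ≢-sym x≢ , inj₂ (inj₂ p)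
  Adj-sym (x≢ , inj₂ (inj₂ p)) = ≢-sym x≢ , inj₂ (inj₁ p)

  contracted : Graph
  contracted = graphOf n Adj? Adj-sym (λ (x≢ , _) → x≢ refl)

  adj-intro : ∀ {x y} → Adj x y → E contracted x y
  adj-intro = graphOf-intro n Adj? Adj-sym (λ (x≢ , _) → x≢ refl)

  adj-elim : ∀ {x y} → E contracted x y → Adj x y
  adj-elim = graphOf-elim n Adj? Adj-sym (λ (x≢ , _) → x≢ refl)

  module W′ = Walks contracted

  π-edge : ∀ {x y} → E G x y → π x ≡ π y ⊎ E contracted (π x) (π y)
  π-edge {x} {y} e = [ inj₁ , (λ π≢ → inj₂ (adj-intro (π≢ , link))) ]′ (toSum (π x ≟ π y))
    where
    link : E G (ι (π x)) (ι (π y)) ⊎ (π x ≡ w′ × E G z (ι (π y)) ⊎ π y ≡ w′ × E G z (ι (π x)))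
    link with x ≟ z | y ≟ z
    ... | yes refl | yes refl = ⊥-elim (E-irrefl {z} e)
    ... | yes refl | no y≢ = inj₂ (inj₁ (refl , subst (E G z) (sym (ι-out y≢)) e))
    ... | no x≢ | yes refl = inj₂ (inj₂ (refl , subst (E G z) (sym (ι-out x≢)) (E-sym e)))
    ... | no x≢ | no y≢ = inj₁ (subst₂ (E G) (sym (ι-out x≢)) (sym (ι-out y≢)) e)

  π-walk : ∀ {S : Pred (V G) 0ℓ} {S′ : Pred (Fin n) 0ℓ} → (∀ {v} → S v → S′ (π v)) →
    ∀ {x y} → WalkIn S x y → W′.WalkIn S′ (π x) (π y)
  π-walk f (_ , stop , s ∷ _) = W′.here-walk (f s)
  π-walk {S′ = S′} f (_ , e ► r , s ∷ ss) with π-walk {S′ = S′} f (_ , r , ss) | π-edge e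
  ... | r′ | inj₁ eq = subst (λ a → W′.WalkIn S′ a _) (sym eq) r′
  ... | r′ | inj₂ e′ = W′.step-walk (f s) e′ r′

  walk-ι : ∀ {S : Pred (V G) 0ℓ} {S′ : Pred (Fin n) 0ℓ} → (∀ {v} → S v → S′ (π v)) →
    ∀ {x y} → WalkIn S (ι x) (ι y) → Reach contracted S′ x y
  walk-ι {S′ = S′} f {x} {y} r =
    W′.walk⇒reach (subst₂ (W′.WalkIn S′) (π-ι x) (π-ι y) (π-walk f r))

  -- Deleting `w′` amounts to deleting `z` and `w` in `G`, which is where `off-zw` is used. For any
  -- other vertex, a walk in `G` that avoids it projects to the contraction.
  contracted-2-connected : 3 ≤ n → TwoConnected G →
    (∀ {a b} → a ≢ z → a ≢ w → b ≢ z → b ≢ w → WalkIn (λ v → v ≢ z × v ≢ w) a b) →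
    TwoConnected contracted
  contracted-2-connected 3≤n (_ , conn , no-cut) off-zw = 3≤n
    , (λ x y _ _ → walk-ι {S = λ _ → ⊤} (λ _ → tt) (reach⇒walk tt tt (conn (ι x) (ι y) tt tt)))
    , λ c x y x≢c y≢c → cases c x≢c y≢c
    where
    cases : ∀ c {x y} → x ≢ c → y ≢ c → Reach contracted (_≢ c) x y
    cases c {x} {y} x≢c y≢c with c ≟ w′
    ... | yes refl = walk-ι
      (λ { (v≢z , v≢w) eq → v≢w (trans (sym (ι-π v≢z)) (trans (cong ι eq) ι-w′)) })
      (off-zw ι≢z (ιw x≢c) ι≢z (ιw y≢c))
      where
      ιw : ∀ {x} → x ≢ w′ → ι x ≢ w
      ιw x≢ eq = x≢ (ι-injective (trans eq (sym ι-w′)))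
    ... | no c≢ = walk-ι (λ {v} v≢ eq → avoid v v≢ eq)
      (reach⇒walk (x≢c ∘ ι-injective) (y≢c ∘ ι-injective)
        (no-cut (ι c) (ι x) (ι y) (x≢c ∘ ι-injective) (y≢c ∘ ι-injective)))
      where
      avoid : ∀ v → v ≢ ι c → π v ≢ c
      avoid v v≢ eq with v ≟ z
      ... | yes refl = c≢ (sym eq)
      ... | no v≢z = v≢ (trans (sym (ι-out v≢z)) (cong ι eq))

  contracted-minor : Minor contracted G
  contracted-minor = record
    { f = just ∘ π
    ; nonempty = λ x → ι x , cong just (π-ι x)
    ; conn = λ h a b p q → fibre (trans (just-injective p) (sym (just-injective q)))
    ; edges = λ x y e → edge (proj₂ (adj-elim e)) }
    where
    fibre : ∀ {S : Pred (V G) 0ℓ} {a b} → π a ≡ π b → Reach G S a b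
    fibre {a = a} {b} eq with a ≟ z | b ≟ z
    ... | yes refl | yes refl = inj₁ refl
    ... | no a≢ | no b≢ = inj₁ (trans (sym (ι-out a≢)) (trans (cong ι eq) (ι-out b≢)))
    ... | yes refl | no b≢ =
      inj₂ ([] , subst (E G z) (trans (sym ι-w′) (trans (cong ι eq) (ι-out b≢))) zw ∷ [-] , [])
    ... | no a≢ | yes refl =
      inj₂ ([] , E-sym (subst (E G z) (trans (sym ι-w′) (trans (cong ι (sym eq)) (ι-out a≢))) zw) ∷ [-] , [])
    edge : ∀ {x y} → E G (ι x) (ι y) ⊎ (x ≡ w′ × E G z (ι y) ⊎ y ≡ w′ × E G z (ι x)) →
      ∃₂ λ g g′ → just (π g) ≡ just x × just (π g′) ≡ just y × E G g g′
    edge {x} {y} (inj₁ e) = ι x , ι y , cong just (π-ι x) , cong just (π-ι y) , e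
    edge {x} {y} (inj₂ (inj₁ (refl , e))) = z , ι y , cong just π-z , cong just (π-ι y) , e
    edge {x} {y} (inj₂ (inj₂ (refl , e))) = ι x , z , cong just (π-ι x) , cong just π-z , E-sym e

  contracted-proper : ProperMinor contracted G
  contracted-proper = contracted-minor
    , λ (φ , _) → ℕ.1+n≢n (sym (trans (↔⇒≡ φ) size≡))

  π-injective : ∀ {x y} → x ≢ z → y ≢ z → π x ≡ π y → x ≡ y
  π-injective x≢ y≢ eq = trans (sym (ι-π x≢)) (trans (cong ι eq) (ι-π y≢))

  π-path : (p : Path G) → z ∉ verts p → Path contracted
  π-path p z∉ = record
    { start = π (start p) ; inner = map π (inner p) ; end = π (end p)
    ; linked = subst (λ vs → Linked (E contracted) (π (start p) ∷ vs)) (map-++ π (inner p) _)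
        (map-linked z∉ (linked p))
    ; unique = subst (λ vs → Unique (π (start p) ∷ vs)) (map-++ π (inner p) _)
        (map-unique z∉ (unique p)) }
    where
    map-linked : ∀ {vs} → z ∉ vs → Linked (E G) vs → Linked (E contracted) (map π vs)
    map-linked z∉ [] = []
    map-linked z∉ [-] = [-]
    map-linked {x ∷ y ∷ _} z∉ (e ∷ l) with map-linked (z∉ ∘ there) l | π-edge e
    ... | l′ | inj₂ e′ = e′ ∷ l′
    ... | _  | inj₁ eq = ⊥-elim (E-irrefl (subst (E G x) (sym x≡y) e))
      where
      x≡y : x ≡ y
      x≡y = π-injective (λ { refl → z∉ (here refl) }) (λ { refl → z∉ (there (here refl)) }) eq
    map-unique : ∀ {vs} → z ∉ vs → Unique vs → Unique (map π vs)
    map-unique {[]} z∉ u = []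
    map-unique {x ∷ vs} z∉ u@(_ ∷ u′) = unique-∷ fresh (map-unique (z∉ ∘ there) u′)
      where
      fresh : π x ∉ map π vs
      fresh πx∈ with y , y∈ , eq ← ∈-map⁻ π πx∈ = unique-∉ u (subst (_∈ vs) (sym
        (π-injective (λ { refl → z∉ (here refl) }) (λ { refl → z∉ (there y∈) }) eq)) y∈)

  contracted-subdivision : ∀ {H} (S : ContainsSubdivision G H) → let open ContainsSubdivision S in
    (∀ u → φ u ≢ z) → (∀ u v e → z ∉ inner (route u v e)) → ContainsSubdivision contracted H
  contracted-subdivision {H} S φ≢z off-z = record
    { φ = π ∘ φ
    ; φ-inj = λ u v eq → φ-inj u v (π-injective (φ≢z u) (φ≢z v) eq)
    ; route = λ u v e → π-path (route u v e) (z∉verts u v e)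
    ; r-start = λ u v e → cong π (r-start u v e)
    ; r-end = λ u v e → cong π (r-end u v e)
    ; r-avoid = λ u v e x y y∈ eq → let a , a∈ , y≡ = back u v e y∈ in
        r-avoid u v e x a a∈ (π-injective (inner≢z u v e a∈) (φ≢z x) (trans (sym y≡) eq))
    ; r-disj = λ u v e u′ v′ e′ y y∈ y∈′ →
        let a , a∈ , y≡ = back u v e y∈
            b , b∈ , y≡′ = back u′ v′ e′ y∈′
            a≡b = π-injective (inner≢z u v e a∈) (inner≢z u′ v′ e′ b∈)
                    (trans (sym y≡) y≡′)
        in r-disj u v e u′ v′ e′ a a∈ (subst (_∈ inner (route u′ v′ e′)) (sym a≡b) b∈) }
    where
    open ContainsSubdivision S
    inner≢z : ∀ u v e {a} → a ∈ inner (route u v e) → a ≢ z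
    inner≢z u v e a∈ refl = off-z u v e a∈
    z∉verts : ∀ u v e → z ∉ verts (route u v e)
    z∉verts u v e (here eq) = φ≢z u (trans (sym (r-start u v e)) (sym eq))
    z∉verts u v e (there z∈) with ∈-++⁻ (inner (route u v e)) z∈
    ... | inj₁ z∈i = off-z u v e z∈i
    ... | inj₂ (here eq) = φ≢z v (trans (sym (r-end u v e)) (sym eq))
    back : ∀ u v e {y} → y ∈ map π (inner (route u v e)) → ∃ λ a → a ∈ inner (route u v e) × y ≡ π a
    back u v e = ∈-map⁻ π

inhabited : ∀ {m} → Fin m → ∃ λ n → m ≡ suc n
inhabited {suc n} _ = n , refl

module Canonical {G H : Graph} (S : ContainsSubdivision G H) where
  open ContainsSubdivision S
  private
    module WG = Walks G
    module WH = Walks H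

  Inner : V H → V H → Pred (V G) 0ℓ
  Inner u v x = Σ (E H u v) λ e → toℕ u < toℕ v × x ∈ inner (route u v e)

  private
    oriented : ∀ u v (e : E H u v) → Dec (toℕ u < toℕ v) →
      Σ (Path G) λ p → start p ≡ φ u × end p ≡ φ v × (∀ {x} → x ∈ inner p → Inner u v x ⊎ Inner v u x)
    oriented u v e (yes u<v) = route u v e , r-start u v e , r-end u v e , λ x∈ → inj₁ (e , u<v , x∈)
    oriented u v e (no u≮v) with p , s , t , sub ← WG.backwards (route v u (WH.E-sym e)) =
      p , trans s (r-end v u _) , trans t (r-start v u _) , λ x∈ → inj₂ (_ , v<u , sub x∈)
      where
      v<u : toℕ v < toℕ u
      v<u = ℕ.≤∧≢⇒< (ℕ.≮⇒≥ u≮v) λ eq →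
        WH.E-irrefl (subst (E H u) (Fin.toℕ-injective eq) e)

  Unordered : V H → V H → V H → V H → Set
  Unordered u v u′ v′ = (u ≡ u′ × v ≡ v′) ⊎ (u ≡ v′ × v ≡ u′)

  inner-disjoint : ∀ {u v u′ v′ x} → Inner u v x → Inner u′ v′ x → Unordered u v u′ v′
  inner-disjoint (e , _ , x∈) (e′ , _ , x∈′) = r-disj _ _ e _ _ e′ _ x∈ x∈′

  private
    orient : ∀ u v (e : E H u v) → Σ (Path G) λ p → start p ≡ φ u × end p ≡ φ v
      × (∀ {x} → x ∈ inner p → Inner u v x ⊎ Inner v u x)
    orient u v e = oriented u v e (toℕ u ℕ.<? toℕ v)

    avoid : ∀ {u v x} w → Inner u v x ⊎ Inner v u x → x ≢ φ w
    avoid w (inj₁ (e , _ , x∈)) = r-avoid _ _ e w _ x∈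
    avoid w (inj₂ (e , _ , x∈)) = r-avoid _ _ e w _ x∈
    meet : ∀ {u v u′ v′ x} → Inner u v x ⊎ Inner v u x → Inner u′ v′ x ⊎ Inner v′ u′ x → Unordered u v u′ v′
    meet (inj₁ a) (inj₁ b) = inner-disjoint a b
    meet (inj₁ a) (inj₂ b) = [ inj₂ , inj₁ ]′ (inner-disjoint a b)
    meet (inj₂ a) (inj₁ b) = [ (λ (p , q) → inj₂ (q , p)) , (λ (p , q) → inj₁ (q , p)) ]′ (inner-disjoint a b)
    meet (inj₂ a) (inj₂ b) = [ (λ (p , q) → inj₁ (q , p)) , (λ (p , q) → inj₂ (q , p)) ]′ (inner-disjoint a b)

  canonical-inner : ∀ u v e {x} → x ∈ inner (proj₁ (orient u v e)) → Inner u v x ⊎ Inner v u x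
  canonical-inner u v e = proj₂ (proj₂ (proj₂ (orient u v e)))

  -- The routes for (u , v) and (v , u) may differ; only the one with u < v is kept.
  canonical : ContainsSubdivision G H
  canonical = record
    { φ = φ ; φ-inj = φ-inj
    ; route = λ u v e → proj₁ (orient u v e)
    ; r-start = λ u v e → proj₁ (proj₂ (orient u v e))
    ; r-end = λ u v e → proj₁ (proj₂ (proj₂ (orient u v e)))
    ; r-avoid = λ u v e w x x∈ → avoid w (canonical-inner u v e x∈)
    ; r-disj = λ u v e u′ v′ e′ x x∈ x∈′ → meet (canonical-inner u v e x∈) (canonical-inner u′ v′ e′ x∈′) }

  On : Pred (V G) 0ℓ
  On x = (∃ λ u → x ≡ φ u) ⊎ ∃₂ λ u v → Inner u v x

  on? : Decidable On
  on? x = any? (λ u → x ≟ φ u) ⊎-dec any? λ u → any? λ v → inner? u v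
    where
    inner? : ∀ u v → Dec (Inner u v x)
    inner? u v with WH.E? u v | toℕ u ℕ.<? toℕ v
    ... | no ¬e | _ = no λ (e , _) → ¬e e
    ... | yes _ | no u≮v = no λ (_ , u<v , _) → u≮v u<v
    ... | yes e | yes u<v with x WG.∈? inner (route u v e)
    ...   | yes x∈ = yes (e , u<v , x∈)
    ...   | no x∉ = no λ (e′ , _ , x∈) → x∉ (subst (λ e → x ∈ inner (route u v e)) (T-irrelevant e′ e) x∈)

  spanning : MinorMinimal2ConnSubdiv G H → 3 ≤ size H → ∀ x → On x
  spanning (2conn@(3≤ , conn , no-cut) , _ , minimal) 3≤H z with on? z
  ... | yes o = o
  ... | no off with n , eq ← inhabited z | w , zw , off-zw ← NonCut.non-cut-neighbour G 3≤ no-cut z conn =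
    contradict n eq w zw off-zw
    where
    contradict : ∀ n → size G ≡ suc n → ∀ w → E G z w →
      (∀ {a b} → a ≢ z → a ≢ w → b ≢ z → b ≢ w → WG.WalkIn (λ v → v ≢ z × v ≢ w) a b) → On z
    contradict n eq w zw off-zw =
      ⊥-elim (minimal contracted contracted-proper (contracted-2-connected 3≤n 2conn off-zw) S′)
      where
      open Contraction G eq z w zw
      S′ : ContainsSubdivision contracted H
      S′ = contracted-subdivision canonical
        (λ u eq → off (inj₁ (u , sym eq)))
        (λ u v e z∈ → [ (λ i → off (inj₂ (u , v , i))) , (λ i → off (inj₂ (v , u , i))) ]′
          (canonical-inner u v e z∈))
      -- The contraction still contains the branch vertices of the subdivision, and these are at
      -- least three.
      3≤n : 3 ≤ n
      3≤n = ℕ.≤-trans 3≤H (Fin.injective⇒≤ {f = ContainsSubdivision.φ S′}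
        (λ {u} {v} → ContainsSubdivision.φ-inj S′ u v))

-- The spanning tree of a subdivision

linked-at : ∀ {A : Set} {R : A → A → Set} xs {u v ys} → Linked R (xs ++ u ∷ v ∷ ys) → R u v
linked-at []           (r ∷ _) = r
linked-at (x ∷ [])     (_ ∷ l) = linked-at [] l
linked-at (x ∷ y ∷ xs) (_ ∷ l) = linked-at (y ∷ xs) l

unique-successor : ∀ {A : Set} {vs : List A} xs xs′ {u a b ys ys′} → Unique vs →
  vs ≡ xs ++ u ∷ a ∷ ys → vs ≡ xs′ ++ u ∷ b ∷ ys′ → a ≡ b
unique-successor [] [] _ refl refl = refl
unique-successor [] (x ∷ xs′) u refl eq with refl , eq′ ← ∷-injective eq =
  ⊥-elim (unique-∉ u (subst (x ∈_) (sym eq′) (∈-++⁺ʳ xs′ (here refl))))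
unique-successor (x ∷ xs) [] u refl eq with refl , eq′ ← ∷-injective eq =
  ⊥-elim (unique-∉ u (∈-++⁺ʳ xs (here refl)))
unique-successor (x ∷ xs) (_ ∷ xs′) (_ ∷ u) refl eq with refl , eq′ ← ∷-injective eq =
  unique-successor xs xs′ u refl eq′

unique-predecessor : ∀ {A : Set} {vs : List A} xs xs′ {a b v ys ys′} → Unique vs →
  vs ≡ xs ++ a ∷ v ∷ ys → vs ≡ xs′ ++ b ∷ v ∷ ys′ → a ≡ b
unique-predecessor [] [] _ refl refl = refl
unique-predecessor [] (x ∷ xs′) (_ ∷ u) refl eq with refl , eq′ ← ∷-injective eq =
  ⊥-elim (absurd xs′ u eq′)
  where
  absurd : ∀ xs′ {b v ys ys′} → Unique (v ∷ ys) → v ∷ ys ≡ xs′ ++ b ∷ v ∷ ys′ → ⊥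
  absurd [] u refl = unique-∉ u (here refl)
  absurd (x ∷ xs′) u refl = unique-∉ u (∈-++⁺ʳ xs′ (there (here refl)))
unique-predecessor (x ∷ []) [] (_ ∷ u) refl eq with refl , eq′ ← ∷-injective eq
  with refl , _ ← ∷-injective eq′ = ⊥-elim (unique-∉ u (here refl))
unique-predecessor (x ∷ y ∷ xs) [] (_ ∷ u) refl eq with refl , eq′ ← ∷-injective eq
  with refl , _ ← ∷-injective eq′ = ⊥-elim (unique-∉ u (∈-++⁺ʳ xs (there (here refl))))
unique-predecessor (x ∷ xs) (_ ∷ xs′) (_ ∷ u) refl eq with refl , eq′ ← ∷-injective eq =
  unique-predecessor xs xs′ u refl eq′

first-cases : ∀ {A : Set} xs mid {s t u v : A} {ys} → s ∷ mid ++ t ∷ [] ≡ xs ++ u ∷ v ∷ ys →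
  u ∈ mid ⊎ u ≡ s
first-cases [] mid eq with refl , _ ← ∷-injective eq = inj₂ refl
first-cases (x ∷ xs) [] eq with _ , eq′ ← ∷-injective eq with xs
... | []    = case proj₂ (∷-injective eq′) of λ ()
... | _ ∷ xs′ with _ , eq″ ← ∷-injective eq′ with xs′
...   | []    = case eq″ of λ ()
...   | _ ∷ _ = case eq″ of λ ()
first-cases (x ∷ xs) (m ∷ mid) eq with _ , eq′ ← ∷-injective eq with first-cases xs mid eq′
... | inj₁ u∈ = inj₁ (there u∈)
... | inj₂ refl = inj₁ (here refl)

second-cases : ∀ {A : Set} xs mid {s t u v : A} {ys} → s ∷ mid ++ t ∷ [] ≡ xs ++ u ∷ v ∷ ys →
  v ∈ mid ⊎ v ≡ t
second-cases [] mid eq with _ , eq′ ← ∷-injective eq with mid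
... | []    = inj₂ (sym (proj₁ (∷-injective eq′)))
... | _ ∷ _ = inj₁ (here (sym (proj₁ (∷-injective eq′))))
second-cases (x ∷ xs) [] eq with _ , eq′ ← ∷-injective eq with xs
... | []    = case proj₂ (∷-injective eq′) of λ ()
... | _ ∷ xs′ with _ , eq″ ← ∷-injective eq′ with xs′
...   | []    = case eq″ of λ ()
...   | _ ∷ _ = case eq″ of λ ()
second-cases (x ∷ xs) (m ∷ mid) eq with second-cases xs mid (proj₂ (∷-injective eq))
... | inj₁ v∈ = inj₁ (there v∈)
... | inj₂ v≡ = inj₂ v≡

Γ-edge⇒heap : ∀ {k} (u v : V (Γ k)) → E (Γ k) u v → toℕ u < toℕ v → Heap (toℕ v) (toℕ u)
Γ-edge⇒heap u v e u<v with Equivalence.to T-∨ (proj₁ (Equivalence.to T-∧ e))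
... | inj₁ t = tree-rel (toℕ u) (toℕ v) t
... | inj₂ t = ⊥-elim (ℕ.<-asym u<v (heap-< (tree-rel (toℕ v) (toℕ u) t)))

heap⇒Γ-edge : ∀ {k} (u v : V (Γ k)) → Heap (toℕ v) (toℕ u) → E (Γ k) u v
heap⇒Γ-edge u v h = Equivalence.from T-∧
  ( Equivalence.from T-∨ (inj₁ (rel-tree h))
  , apart (toℕ u) (toℕ v) (ℕ.<⇒≢ (heap-< h)))
  where
  rel-tree : ∀ {i j} → Heap j i → T (treeRel i j)
  rel-tree {i} left = Equivalence.from (T-∨ {2 * i + 1 ℕ.≡ᵇ 2 * i + 1}) (inj₁ (ℕ.≡⇒≡ᵇ (2 * i + 1) _ refl))
  rel-tree {i} right = Equivalence.from (T-∨ {2 * i + 2 ℕ.≡ᵇ 2 * i + 1}) (inj₂ (ℕ.≡⇒≡ᵇ (2 * i + 2) _ refl))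
  apart : ∀ m n → m ≢ n → T (not (m ℕ.≡ᵇ n))
  apart m n m≢n with m ℕ.≡ᵇ n in eq
  ... | false = tt
  ... | true = m≢n (ℕ.≡ᵇ⇒≡ m n (subst T (sym eq) tt))

module FromSubdivision {G : Graph} {k} (S : ContainsSubdivision G (Γ k)) (on : ∀ x → Canonical.On S x) where
  open ContainsSubdivision S

  private
    size> : 0 < size (Γ k)
    size> = ℕ.m<n⇒0<n∸m (ℕ.^-monoʳ-< 2 (s≤s (s≤s z≤n)) (s≤s (z≤n {k})))

    zeroᵛ : V (Γ k)
    zeroᵛ = fromℕ< size>

    record Edge : Set where
      constructor mkEdge
      field
        parent child : V (Γ k)
        heap : Heap (toℕ child) (toℕ parent)
      route′ : Path G
      route′ = route parent child (heap⇒Γ-edge {k} parent child heap)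

    open Edge

    -- Edges are compared by their ends only. The route depends on the heap proof through a Boolean
    -- edge proof, and that one is unique.
    data Pos≡ : Edge → Edge → Set where
      same : ∀ {p c h h′} → Pos≡ (mkEdge p c h) (mkEdge p c h′)

    same-route : ∀ {e e′} → Pos≡ e e′ → route′ e ≡ route′ e′
    same-route (same {p} {c}) = cong (route p c) (T-irrelevant _ _)

    Ch : V G → V G → Set
    Ch y x = Σ Edge λ e → PEdge (route′ e) x y

    Tail : Edge → Pred (V G) 0ℓ
    Tail e y = y ∈ inner (route′ e) ⊎ y ≡ φ (child e)

    tail : ∀ {x y} (e : Edge) → PEdge (route′ e) x y → Tail e y
    tail e (xs , ys , eq) with second-cases xs (inner (route′ e)) eq
    ... | inj₁ y∈ = inj₁ y∈
    ... | inj₂ refl = inj₂ (r-end _ _ _)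

    edge-ext : ∀ {e e′} → parent e ≡ parent e′ → child e ≡ child e′ → Pos≡ e e′
    edge-ext refl refl = same

    inner-edge : ∀ {e e′ y} → y ∈ inner (route′ e) → y ∈ inner (route′ e′) → Pos≡ e e′
    inner-edge {e} {e′} y∈ y∈′ with r-disj _ _ _ _ _ _ _ y∈ y∈′
    ... | inj₁ (p , c) = edge-ext p c
    ... | inj₂ (p , c) = ⊥-elim (ℕ.<-asym (heap-< (heap e))
      (subst₂ (λ a b → toℕ a < toℕ b) (sym c) (sym p) (heap-< (heap e′))))

    -- Routes are internally disjoint and a branch vertex ends just one downward route, that from
    -- its heap parent. Parents in the tree are therefore unique.
    tail-edge : ∀ {e e′ y} → Tail e y → Tail e′ y → Pos≡ e e′
    tail-edge {e} {e′} (inj₁ y∈) (inj₁ y∈′) = inner-edge {e} {e′} y∈ y∈′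
    tail-edge (inj₁ y∈) (inj₂ eq) = ⊥-elim (r-avoid _ _ _ _ _ y∈ eq)
    tail-edge (inj₂ eq) (inj₁ y∈) = ⊥-elim (r-avoid _ _ _ _ _ y∈ eq)
    tail-edge {e} {e′} (inj₂ eq) (inj₂ eq′) with c ← φ-inj _ _ (trans (sym eq) eq′) =
      edge-ext (Fin.toℕ-injective (heap-parent′ (heap e) (heap e′) (cong toℕ c))) c

    Ch-parent : ∀ {c p p′} → Ch c p → Ch c p′ → p ≡ p′
    Ch-parent (e , pe@(xs , _ , eq)) (e′ , pe′@(xs′ , _ , eq′))
      with same-route (tail-edge {e} {e′} (tail e pe) (tail e′ pe′))
    ... | r = unique-predecessor xs xs′ (unique (route′ e)) eq (trans (cong verts r) eq′)

    Ch-edge : ∀ {c p} → Ch c p → E G p c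
    Ch-edge (e , xs , _ , eq) = linked-at xs (subst (Linked (E G)) eq (linked (route′ e)))

    side : ∀ {c p} → Heap c p → Bool
    side left  = true
    side right = false

    same-side : ∀ {c c′ p} (h : Heap c p) (h′ : Heap c′ p) → side h ≡ side h′ → c ≡ c′
    same-side left  left  _ = refl
    same-side right right _ = refl

    Start : Edge → Pred (V G) 0ℓ
    Start e x = x ∈ inner (route′ e) ⊎ x ≡ φ (parent e)

    start-of : ∀ {x y} (e : Edge) → PEdge (route′ e) x y → Start e x
    start-of e (xs , ys , eq) with first-cases xs (inner (route′ e)) eq
    ... | inj₁ x∈ = inj₁ x∈
    ... | inj₂ refl = inj₂ (r-start _ _ _)

    -- An inner vertex of a route determines the route, and a branch vertex starts at most one route
    -- on each side. Two sides allow at most two children.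
    start-edge : ∀ {e e′ x} → Start e x → Start e′ x → side (heap e) ≡ side (heap e′) → Pos≡ e e′
    start-edge {e} {e′} (inj₁ x∈) (inj₁ x∈′) _ = inner-edge {e} {e′} x∈ x∈′
    start-edge (inj₁ x∈) (inj₂ eq) _ = ⊥-elim (r-avoid _ _ _ _ _ x∈ eq)
    start-edge (inj₂ eq) (inj₁ x∈) _ = ⊥-elim (r-avoid _ _ _ _ _ x∈ eq)
    start-edge {mkEdge p c h} {mkEdge p′ c′ h′} (inj₂ eq) (inj₂ eq′) s
      with refl ← φ-inj _ _ (trans (sym eq) eq′) =
      edge-ext refl (Fin.toℕ-injective (same-side h h′ s))

    slot : ∀ {a x} → Ch a x → Bool
    slot (e , _) = side (heap e)

    same-slot : ∀ {a b x} (p : Ch a x) (q : Ch b x) → slot p ≡ slot q → a ≡ b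
    same-slot (e , pe@(xs , _ , eq)) (e′ , pe′@(xs′ , _ , eq′)) s
      with same-route (start-edge {e} {e′} (start-of e pe) (start-of e′ pe′) s)
    ... | r = unique-successor xs xs′ (unique (route′ e)) eq (trans (cong verts r) eq′)

    Ch-two : ∀ {a b c x} → Ch a x → Ch b x → Ch c x → a ≡ b ⊎ a ≡ c ⊎ b ≡ c
    Ch-two p q r with slot p in i | slot q in j | slot r in l
    ... | true  | true  | _     = inj₁ (same-slot p q (trans i (sym j)))
    ... | false | false | _     = inj₁ (same-slot p q (trans i (sym j)))
    ... | true  | false | true  = inj₂ (inj₁ (same-slot p r (trans i (sym l))))
    ... | false | true  | false = inj₂ (inj₁ (same-slot p r (trans i (sym l))))
    ... | true  | false | false = inj₂ (inj₂ (same-slot q r (trans j (sym l))))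
    ... | false | true  | true  = inj₂ (inj₂ (same-slot q r (trans j (sym l))))

    root-top : ∀ {p} → ¬ Ch (φ zeroᵛ) p
    root-top (e , pe) with tail e pe
    ... | inj₁ y∈ = r-avoid _ _ _ _ _ y∈ refl
    ... | inj₂ eq with refl ← φ-inj _ _ eq =
      ℕ.n≮0 (subst (toℕ (parent e) <_) (Fin.toℕ-fromℕ< size>) (heap-< (heap e)))

    along-route : ∀ e xs {a ys} → verts (route′ e) ≡ xs ++ a ∷ ys →
      ∀ {v} → v ∈ a ∷ ys → Ancestor Ch a v
    along-route e xs eq (here refl) = self
    along-route e xs {a} {b ∷ ys} eq (there v∈) = ancestor-trans (down self (e , xs , ys , eq))
      (along-route e (xs ++ a ∷ []) (trans eq (sym (++-assoc xs (a ∷ []) (b ∷ ys)))) v∈)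

    from-start : ∀ e {v} → v ∈ verts (route′ e) → Ancestor Ch (φ (parent e)) v
    from-start e v∈ = subst (λ a → Ancestor Ch a _) (r-start _ _ _) (along-route e [] refl v∈)

    end∈ : ∀ e → φ (child e) ∈ verts (route′ e)
    end∈ e = subst (_∈ verts (route′ e)) (r-end _ _ _) (∈-++⁺ʳ (start (route′ e) ∷ inner (route′ e)) (here refl))

    reach-φ : ∀ i → Acc _<_ (toℕ i) → Ancestor Ch (φ zeroᵛ) (φ i)
    reach-φ i (acc rs) with heap-view (toℕ i)
    ... | inj₁ eq with refl ← Fin.toℕ-injective {i = i} {j = zeroᵛ} (trans eq (sym (Fin.toℕ-fromℕ< size>))) = self
    ... | inj₂ (p , h) = ancestor-trans
            (reach-φ pᵛ (rs (subst (_< toℕ i) (sym p≡) (heap-< h)))) (from-start e (end∈ e))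
      where
      p< : p < size (Γ k)
      p< = ℕ.<-trans (heap-< h) (Fin.toℕ<n i)
      pᵛ : V (Γ k)
      pᵛ = fromℕ< p<
      p≡ : toℕ pᵛ ≡ p
      p≡ = Fin.toℕ-fromℕ< p<
      e : Edge
      e = mkEdge pᵛ i (subst (Heap _) (sym p≡) h)

    reach : ∀ x → Ancestor Ch (φ zeroᵛ) x
    reach x with on x
    ... | inj₁ (i , refl) = reach-φ i (<-wellFounded _)
    ... | inj₂ (u , v , e , u<v , x∈) = ancestor-trans (reach-φ u (<-wellFounded _)) (from-start e′
            (there (∈-++⁺ˡ (subst (λ e → x ∈ inner (route u v e)) (T-irrelevant _ _) x∈))))
      where
      e′ : Edge
      e′ = mkEdge u v (Γ-edge⇒heap {k} u v e u<v)

  tree : SpanningBinaryTree G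
  tree = record
    { Ch = Ch ; Ch-edge = Ch-edge ; Ch-parent = Ch-parent ; Ch-two = Ch-two
    ; root = φ zeroᵛ ; root-top = root-top ; reach = reach }

  open Tree tree using (Big; big0; branch; big-up)

  private
    shape : ∀ e {mid} → inner (route′ e) ≡ mid →
      verts (route′ e) ≡ φ (parent e) ∷ mid ++ φ (child e) ∷ []
    shape e eq = congruent (r-start _ _ _) eq (r-end _ _ _)
      where
      congruent : ∀ {s s′ t t′ : V G} {m m′} → s ≡ s′ → m ≡ m′ → t ≡ t′ →
        s ∷ m ++ t ∷ [] ≡ s′ ∷ m′ ++ t′ ∷ []
      congruent refl refl refl = refl

    first : ∀ e → ∃ λ f → Ch f (φ (parent e)) × Tail e f × Ancestor Ch f (φ (child e))
    first e with inner (route′ e) in eq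
    ... | [] = φ (child e) , (e , [] , [] , shape e eq) , inj₂ refl , self
    ... | f ∷ fs = f , (e , [] , fs ++ φ (child e) ∷ [] , shape e eq)
        , inj₁ (here refl)
        , along-route e (φ (parent e) ∷ []) (shape e eq) (there (∈-++⁺ʳ fs (here refl)))

    -- The hypothesis says that the last position `(2 + i) * 2 ^ h - 2` of the heap subtree of
    -- height `h` at `i` still belongs to `Γ k`.
    big-φ : ∀ h (i : V (Γ k)) → (2 + toℕ i) * 2 ^ h ≤ 2 ^ suc k → Big h (φ i)
    big-φ zero i _ = big0
    big-φ (suc h) i bound =
      branch (proj₁ (proj₂ (first eL))) (proj₁ (proj₂ (first eR))) firsts≢
        (big-up (proj₂ (proj₂ (proj₂ (first eL)))) bigL) (big-up (proj₂ (proj₂ (proj₂ (first eR)))) bigR)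
      where
      X = 2 ^ h
      j = toℕ i
      total : (2 + (2 * j + 2)) * X ≤ 2 ^ suc k
      total = ℕ.≤-trans (ℕ.≤-reflexive (heap-double j X)) bound
      R< : 2 * j + 2 < size (Γ k)
      R< = ℕ.∸-monoˡ-≤ 1 (ℕ.≤-trans (ℕ.m≤m*n (2 + (2 * j + 2)) X {{ℕ.m^n≢0 2 h}}) total)
      L< : 2 * j + 1 < size (Γ k)
      L< = ℕ.≤-<-trans (ℕ.+-monoʳ-≤ (2 * j) (s≤s (z≤n {1}))) R<
      eL eR : Edge
      eL = mkEdge i (fromℕ< L<) (subst (λ c → Heap c j) (sym (Fin.toℕ-fromℕ< L<)) left)
      eR = mkEdge i (fromℕ< R<) (subst (λ c → Heap c j) (sym (Fin.toℕ-fromℕ< R<)) right)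
      tailL = proj₁ (proj₂ (proj₂ (first eL)))
      tailR = proj₁ (proj₂ (proj₂ (first eR)))
      firsts≢ : proj₁ (first eL) ≢ proj₁ (first eR)
      firsts≢ eq = ends≢ (tail-edge {eL} {eR} tailL (subst (Tail eR) (sym eq) tailR))
        where
        ends≢ : ¬ Pos≡ eL eR
        ends≢ s = odd≢even j j (trans (sym (Fin.toℕ-fromℕ< L<))
          (trans (cong toℕ (child≡ s)) (Fin.toℕ-fromℕ< R<)))
          where
          child≡ : ∀ {e e′} → Pos≡ e e′ → child e ≡ child e′
          child≡ same = refl
      bigL : Big h (φ (child eL))
      bigL = big-φ h _ (ℕ.≤-trans (ℕ.*-monoˡ-≤ X (ℕ.+-monoʳ-≤ 2
        (ℕ.≤-trans (ℕ.≤-reflexive (Fin.toℕ-fromℕ< L<)) (ℕ.+-monoʳ-≤ (2 * j) (s≤s (z≤n {1})))))) total)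
      bigR : Big h (φ (child eR))
      bigR = big-φ h _ (ℕ.≤-trans (ℕ.*-monoˡ-≤ X (ℕ.+-monoʳ-≤ 2
        (ℕ.≤-reflexive (Fin.toℕ-fromℕ< R<)))) total)

  big-root : Big k (SpanningBinaryTree.root tree)
  big-root = big-φ k zeroᵛ (ℕ.≤-reflexive (cong (λ i → (2 + i) * 2 ^ k) (Fin.toℕ-fromℕ< size>)))

-- Counting the branchings

module _ {G : Graph} (tree : SpanningBinaryTree G) (no-cut : ∀ x → ConnectedSet G (λ v → v ≢ x))
  (ℓ : ℕ) where
  open Growing tree no-cut {M = Minor (Γ⁺ ℓ) G} ℓ (LeafConnected.exit-gap tree ℓ)
  open Tree tree using (Big; root; big-≤)

  need-linear : ∀ h → need h ≡ h * (2 + 2 * ℓ)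
  need-linear zero = refl
  need-linear (suc h) rewrite need-linear h =
    solve 2 (λ l n → con 1 :+ (l :+ (con 1 :+ (l :+ n))) := con 2 :+ con 2 :* l :+ n) refl ℓ (h * (2 + 2 * ℓ))
    where open +-*-Solver

  minor-or-pear-tree : ∀ {t} → Full t → ∀ h → height t ≤ h → Big (2 + (ℓ + h * (2 + 2 * ℓ))) root →
    Minor (Γ⁺ ℓ) G ⊎ Σ (PearData G t) (λ B → IsPearTree G t B × Clean G t B)
  minor-or-pear-tree full h ht B
    with first-site (subst (λ n → Big (2 + (ℓ + n)) root) (sym (need-linear h)) B)
  ... | inj₁ m = inj₁ m
  ... | inj₂ (P₀ , long , S)
    with build full h ht {P₀} {P₀} S long long (Walks.subPath G P₀ P₀ [] [] (sym (++-identityʳ _))) (λ z∈ _ → z∈)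
  ...   | inj₁ m = inj₁ m
  ...   | inj₂ g = inj₂ (Grown.B g , Grown.isPear g , Grown.clean g)

height-budget : ∀ ℓ k → 1 ≤ ℓ → 9 * ℓ * ℓ ∸ 3 * ℓ + 1 ≤ k →
  2 + (ℓ + (3 * ℓ ∸ 2) * (2 + 2 * ℓ)) ≤ k
height-budget (suc m) k _ bound = ℕ.≤-trans (ℕ.m+n≤o⇒m≤o _ (ℕ.≤-reflexive total)) bound
  where
  open +-*-Solver
  square : 9 * suc m * suc m ≡ (9 * m * m + 15 * m + 6) + 3 * suc m
  square = solve 1 (λ m → con 9 :* (con 1 :+ m) :* (con 1 :+ m) :=
    (con 9 :* m :* m :+ con 15 :* m :+ con 6) :+ con 3 :* (con 1 :+ m)) refl m
  triple : 3 * suc m ∸ 2 ≡ 3 * m + 1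
  triple = trans (cong (_∸ 2) (solve 1 (λ m → con 3 :* (con 1 :+ m) := con 3 :* m :+ con 1 :+ con 2) refl m))
    (ℕ.m+n∸n≡m (3 * m + 1) 2)
  -- In terms of `m = ℓ - 1`, the branchings used number `6m² + 15m + 7` and the bound is
  -- `9m² + 15m + 7`.
  total : 2 + (suc m + (3 * suc m ∸ 2) * (2 + 2 * suc m)) + 3 * m * m ≡ 9 * suc m * suc m ∸ 3 * suc m + 1
  total = trans (cong (λ n → 2 + (suc m + n * (2 + 2 * suc m)) + 3 * m * m) triple)
    (trans (solve 1 (λ m → con 2 :+ (con 1 :+ m :+ (con 3 :* m :+ con 1) :* (con 2 :+ con 2 :* (con 1 :+ m)))
        :+ con 3 :* m :* m := (con 9 :* m :* m :+ con 15 :* m :+ con 6) :+ con 1) refl m)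
      (cong (_+ 1) (sym (trans (cong (_∸ 3 * suc m) square) (ℕ.m+n∸n≡m _ (3 * suc m))))))

theorem5p1 : (ℓ k : ℕ) → 1 ≤ ℓ → 9 * ℓ * ℓ ∸ 3 * ℓ + 1 ≤ k →
    (G : Graph) → MinorMinimal2ConnSubdiv G (Γ k) →
    (T¹ : BTree) → Full T¹ → height T¹ ≤ 3 * ℓ ∸ 2 →
    Minor (Γ⁺ ℓ) G ⊎ Σ (PearData G T¹) (λ B → IsPearTree G T¹ B × Clean G T¹ B)
theorem5p1 ℓ k 1≤ℓ bound G minimal@((_ , _ , no-cut) , S , _) T¹ full ht =
  minor-or-pear-tree tree no-cut ℓ full (3 * ℓ ∸ 2) ht
    (Tree.big-≤ tree (height-budget ℓ k 1≤ℓ bound) big-root)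
  where
  3≤Γ : 3 ≤ size (Γ k)
  3≤Γ = ℕ.∸-monoˡ-≤ 1 (ℕ.^-monoʳ-≤ 2 (s≤s (ℕ.≤-trans (ℕ.m≤n+m 1 _) bound)))
  open FromSubdivision {k = k} S (Canonical.spanning S minimal 3≤Γ)
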